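{- Let $G \cong C_2 \oplus C_2 \oplus C_{2n}$, where $n \ge 2$ is an integer. A sequence $S$ over $G$ of length $|S| = \mathsf{s}(G) - 1 = 4n+2$ contains no zero-sum subsequence of length $\exp(G)=2n$ if and only if there exist a basis $\{f_1,f_2,f_3\}$ of $G$ with $\operatorname{ord}(f_1)=\operatorname{ord}(f_2)=2$ and $\operatorname{ord}(f_3)=2n$, and an element $f \in G$, such that the translated sequence $-f + S$ is equal to one of the following sequences: (s1) $0^{2\alpha+1} f_2^{2n-2\alpha-1} f_3^{2n-1-2\beta} (f_3+f_2)^{2\beta+1} (a f_3 + f_1)\bigl((1-a) f_3 + f_2 + f_1\bigr)$ with $a \in [2,n-1]$ and $\alpha,\beta \in [0,n-1]$; (s2) $0^{2n-1} f_3^{2n-1} (a f_3 + f_2)\bigl((1-a)f_3 + f_2\bigr)(b f_3 + f_1)\bigl((1-b) f_3 + f_1\bigr)$ with $a,b \in [2,n-1]$ and $a \ge b$; (s3) $0^{2\alpha+1} f_1^{2\beta+1} f_2^{2\gamma+1} \prod_{i=1}^{2n+1} (f_3 + d_i)$, where $\alpha,\beta,\gamma \in [0,n-1]$ satisfy $\alpha+\beta+\gamma = n-1$, and $S' = \prod_{i=1}^{2n+1} d_i$ is a sequence over the subgroup $\langle f_1,f_2\rangle$ with $\sigma(S') \notin \operatorname{supp}(S')$.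
   Context: $C_m$ denotes a cyclic group of order $m$; $\operatorname{ord}(g)$ is the order of $g$; $[a,b]=\{z\in\mathbb{Z}: a\le z\le b\}$. A basis of a finite abelian group is an independent generating set, where $g_1,\dots,g_k$ are independent if $\sum a_i g_i = 0$ with integers $a_i$ implies $a_i g_i = 0$ for all $i$. A sequence over $G$ is an element of the free abelian monoid over $G$ (finite multiset, written multiplicatively; $g^k$ means $g$ repeated $k$ times). For $S = g_1\cdots g_\ell$: $|S|=\ell$, $\sigma(S)=\sum g_i$, $\operatorname{supp}(S)$ is the set of distinct elements occurring in $S$; for $h\in G$, $h+S = (h+g_1)\cdots(h+g_\ell)$. A subsequence is a sub-multiset; a zero-sum sequence is one with sum $0$. $\exp(G)$ is the exponent of $G$. $\mathsf{s}(G)$ (Erdős–Ginzburg–Ziv constant) is the smallest integer $\ell$ such that every sequence over $G$ of length at least $\ell$ has a zero-sum subsequence of length exactly $\exp(G)$; for this $G$, $\mathsf{s}(G)=4n+3$. -}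

module Defs where

open import Data.Nat using (ℕ; zero; suc; _+_; _*_; _∸_; _≤_; _<_; NonZero)
open import Data.Nat.DivMod using (_mod_)
open import Data.Fin as Fin using (Fin; toℕ)
open import Data.Integer as ℤ using (ℤ; +_; -[1+_])
open import Data.Product using (_×_; _,_; ∃; ∃-syntax)
open import Data.List using (List; []; _∷_; length; foldr; map; replicate; _++_)
open import Data.List.Membership.Propositional using (_∈_; _∉_)
open import Data.List.Relation.Unary.All using (All)
open import Data.List.Relation.Binary.Sublist.Propositional using (_⊆_)
open import Relation.Binary.PropositionalEquality using (_≡_)

addZ : ∀ {m} → Fin m → Fin m → Fin m
addZ {suc m} a b = (toℕ a + toℕ b) mod suc m

negZ : ∀ {m} → Fin m → Fin m
negZ {suc m} a = (suc m ∸ toℕ a) mod suc m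

nonZero-2* : ∀ {n} → {{NonZero n}} → NonZero (2 * n)
nonZero-2* {suc k} = _

record G (n : ℕ) : Set where
  constructor ⟨_,_,_⟩
  field
    c₁ : Fin 2
    c₂ : Fin 2
    c₃ : Fin (2 * n)

infixl 6 _+G_
_+G_ : ∀ {n} → G n → G n → G n
⟨ a , b , c ⟩ +G ⟨ a' , b' , c' ⟩ = ⟨ addZ a a' , addZ b b' , addZ c c' ⟩

-G_ : ∀ {n} → G n → G n
-G ⟨ a , b , c ⟩ = ⟨ negZ a , negZ b , negZ c ⟩

0G : ∀ {n} → {{NonZero n}} → G n
0G {n} = ⟨ Fin.zero , Fin.zero , _mod_ 0 (2 * n) {{nonZero-2* {n}}} ⟩

_∈[_,_] : ℕ → ℕ → ℕ → Set
a ∈[ lo , hi ] = lo ≤ a × a ≤ hi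

module _ {n : ℕ} {{_ : NonZero n}} where

  infixr 7 _·ℕ_ _·_
  _·ℕ_ : ℕ → G n → G n
  zero  ·ℕ g = 0G
  suc k ·ℕ g = g +G (k ·ℕ g)

  _·_ : ℤ → G n → G n
  (+ k)      · g = k ·ℕ g
  (-[1+ k ]) · g = -G (suc k ·ℕ g)

  -- σ(S), the sum of a sequence (sequences = lists up to permutation)
  σ : List (G n) → G n
  σ = foldr _+G_ 0G

  Order : G n → ℕ → Set
  Order g k = 0 < k × k ·ℕ g ≡ 0G × (∀ m → 0 < m → m ·ℕ g ≡ 0G → k ≤ m)

  Independent : G n → G n → G n → Set
  Independent f₁ f₂ f₃ = ∀ (a₁ a₂ a₃ : ℤ) → a₁ · f₁ +G a₂ · f₂ +G a₃ · f₃ ≡ 0G →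
    a₁ · f₁ ≡ 0G × a₂ · f₂ ≡ 0G × a₃ · f₃ ≡ 0G

  Generates : G n → G n → G n → Set
  Generates f₁ f₂ f₃ = ∀ (g : G n) → ∃[ a₁ ] ∃[ a₂ ] ∃[ a₃ ] g ≡ a₁ · f₁ +G a₂ · f₂ +G a₃ · f₃

  IsBasis : G n → G n → G n → Set
  IsBasis f₁ f₂ f₃ = Independent f₁ f₂ f₃ × Generates f₁ f₂ f₃

  In⟨_,_⟩ : G n → G n → G n → Set
  In⟨ f₁ , f₂ ⟩ g = ∃[ a₁ ] ∃[ a₂ ] g ≡ a₁ · f₁ +G a₂ · f₂

  HasZeroSumSubseqOfLength : List (G n) → ℕ → Set
  HasZeroSumSubseqOfLength S k = ∃[ T ] (T ⊆ S × length T ≡ k × σ T ≡ 0G)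

  _+ₛ_ : G n → List (G n) → List (G n)
  h +ₛ S = map (h +G_) S

  seq1 : (f₁ f₂ f₃ : G n) (a α β : ℕ) → List (G n)
  seq1 f₁ f₂ f₃ a α β =
    replicate (2 * α + 1) 0G ++ replicate (2 * n ∸ 2 * α ∸ 1) f₂ ++
    replicate (2 * n ∸ 1 ∸ 2 * β) f₃ ++ replicate (2 * β + 1) (f₃ +G f₂) ++
    ((+ a) · f₃ +G f₁) ∷ ((+ 1 ℤ.- + a) · f₃ +G f₂ +G f₁) ∷ []

  seq2 : (f₁ f₂ f₃ : G n) (a b : ℕ) → List (G n)
  seq2 f₁ f₂ f₃ a b =
    replicate (2 * n ∸ 1) 0G ++ replicate (2 * n ∸ 1) f₃ ++
    ((+ a) · f₃ +G f₂) ∷ ((+ 1 ℤ.- + a) · f₃ +G f₂) ∷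
    ((+ b) · f₃ +G f₁) ∷ ((+ 1 ℤ.- + b) · f₃ +G f₁) ∷ []

  seq3 : (f₁ f₂ f₃ : G n) (α β γ : ℕ) (d : List (G n)) → List (G n)
  seq3 f₁ f₂ f₃ α β γ d =
    replicate (2 * α + 1) 0G ++ replicate (2 * β + 1) f₁ ++
    replicate (2 * γ + 1) f₂ ++ f₃ +ₛ d

module Submission where

-- Let K be the kernel of the class map G → G/2G ≅ F₂³, a cyclic group of order n. Pairing off equal classes turns S
-- into pairs with sum in K and leftover elements of distinct classes. The Moser–Scherk theorem yields the
-- Erdős–Ginzburg–Ziv theorem for K and its inverse: 2n − 2 elements of K without a zero-sum subsequence of length n
-- take two values x, y, each n − 1 times. So 6 or 8 elements are left over. A quadruple of leftovers in an affine plane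
-- of F₂³ acts as two more pairs, so its sum is forced to be x + y. Comparing planes excludes 8 leftovers and shows that
-- S is supported on the 6 leftover elements; they form three pairs with a common sum s, 2s = x + y, and an element
-- p of multiplicity at least 3 satisfies 2p ∈ {x, y}. The forms (s3), (s1), (s2) correspond to three, two or one of
-- the three pairs consisting of such p.

open import Defs
open import Algebra.Bundles using (AbelianGroup)
import Algebra.Properties.Group as GroupProperties
import Algebra.Solver.CommutativeMonoid as CMSolver
open import Algebra.Structures using (IsAbelianGroup)
open import Data.Bool using (Bool; true; false; _xor_; _∧_)
import Data.Bool.Properties as Boolₚ
open import Data.Empty using (⊥; ⊥-elim)
open import Data.Fin as Fin using (Fin; toℕ)
import Data.Fin.Properties as Finₚ
open import Data.Integer as ℤ using (ℤ; -[1+_]; ∣_∣)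
open import Data.List using (List; []; _∷_; [_]; length; foldr; map; applyUpTo; upTo; cartesianProduct; replicate; _++_; filter)
open import Data.List.Membership.Propositional using (_∈_; _∉_; find)
import Data.List.Membership.DecPropositional as DecMembership
open import Data.List.Membership.Propositional.Properties
  using (∈-∃++; ∈-cartesianProduct⁺; ∈-applyUpTo⁻; ∈-upTo⁺; ∈-++⁺ˡ; ∈-++⁺ʳ; ∈-++⁻; ∈-map⁺; ∈-map⁻; ∈-filter⁺; ∈-filter⁻)
open import Data.List.Properties
  using (filter-++; length-applyUpTo; length-upTo; ++-assoc; length-++; ++-identityʳ; length-replicate; length-map; filter-all; filter-none; map-++; map-replicate; ∷-injective)
open import Data.List.Relation.Binary.Permutation.Propositional hiding (↭-trans) renaming (trans to ↭-trans)
open import Data.List.Relation.Binary.Permutation.Propositional.Properties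
  using (shift; drop-∷; ↭-length; ↭-map-inv; ++-comm; ∈-resp-↭; All-resp-↭; ++-commutativeMonoid; filter-↭)
  renaming (++⁺ to ↭-++⁺; ++⁺ˡ to ↭-++⁺ˡ; ++⁺ʳ to ↭-++⁺ʳ; map⁺ to ↭-map⁺)
import Data.List.Relation.Binary.Permutation.Setoid.Properties as PermSetoid
open import Data.List.Relation.Binary.Sublist.Propositional using (_⊆_; []; _∷_; _∷ʳ_; ⊆-refl)
open import Data.List.Relation.Binary.Sublist.Propositional.Properties using (All-resp-⊆; []⊆-universal)
  renaming (map⁺ to ⊆-map⁺)
open import Data.List.Relation.Unary.All as All using (All; []; _∷_)
import Data.List.Relation.Unary.All.Properties as Allₚ
open import Data.List.Relation.Unary.AllPairs using ([]; _∷_)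
open import Data.List.Relation.Unary.Any using (here; there)
import Data.List.Relation.Unary.Unique.DecPropositional as DecUnique
open import Data.List.Relation.Unary.Unique.Propositional using (Unique)
import Data.List.Relation.Unary.Unique.Propositional.Properties as Uniqueₚ
open import Data.Nat using (ℕ; zero; suc; _+_; _*_; _∸_; _≤_; _<_; z≤n; s≤s; NonZero; _≤?_; _<?_)
open import Data.Nat.DivMod using (_mod_; _%_; _/_; m%n<n; m<n⇒m%n≡m; n%n≡0; m*n%n≡0; m%n%n≡m%n; %-distribˡ-+; m≡m%n+[m/n]*n)
open import Data.Nat.Properties hiding (_≤?_; _<?_)
open import Data.Nat.Solver using (module +-*-Solver)
open import Data.Product using (_×_; _,_; ∃-syntax; proj₁; proj₂)
open import Data.Product.Properties using (≡-dec)
open import Data.Sum using (_⊎_; inj₁; inj₂)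
open import Function using (_∘_; id)
open import Level using (0ℓ)
open import Relation.Binary.Definitions using (DecidableEquality)
open import Relation.Binary.PropositionalEquality
  using (_≡_; _≢_; refl; sym; cong; cong₂; subst; setoid; isEquivalence; module ≡-Reasoning; trans)
open import Relation.Nullary using (¬_; Dec; yes; no)
open import Relation.Nullary.Decidable using (¬?; decidable-stable; _×-dec_; True; toWitness)
open import Relation.Unary using (Pred; Decidable)

-- Subsequences up to permutation

-- The inverse theorem is needed in two lengths. Six leftovers come with `2n - 2` pairs, but eight
-- come with only `2n - 3`. There the lost term is made up for by the condition `Missing`: some
-- element of `K` is not a sum of `n - 2` pair sums. Such an element is at hand, because a quadruple
-- `X` of leftovers in a plane, together with `n - 2` pairs of total sum `-σ(X)`, would be a
-- zero-sum subsequence of length `2n`. In a sequence of `n - 1` terms `x` and `n - 2` terms `y`,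
-- the sums of `n - 2` terms leave out exactly one element of `K`, namely `-(x + y)`; this is what
-- forces `σ(X) = x + y`. Length `2n - 2` is reduced to the same statement by dropping one term. The
-- pairing is not canonical. A pair may be broken and its members treated as leftovers, which yields
-- further quadruples with the same forced sum; all information about the individual pairs comes
-- from such exchanges.

infix 4 _⊑_

-- Sums ignore the order of terms, whereas `_⊆_` in the statement preserves it. With the complement
-- `rest` as data, removing and exchanging terms becomes manipulation of `_++_`; `⊆⇒⊑` and `⊑⇒⊆`
-- mediate between the two notions.
record _⊑_ {A : Set} (T S : List A) : Set where
  constructor _,_
  field
    rest : List A
    split : S ↭ T ++ rest

module _ {A : Set} where

  module ++-Solver = CMSolver (++-commutativeMonoid {A = A})

  ++-interchange : (a b c d : List A) → (a ++ b) ++ (c ++ d) ↭ (a ++ c) ++ (b ++ d)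
  ++-interchange = solve 4 (λ a b c d → (a ⊕ b) ⊕ (c ⊕ d) ⊜ (a ⊕ c) ⊕ (b ⊕ d)) refl
    where open ++-Solver

  ⊑-refl : {S : List A} → S ⊑ S
  ⊑-refl {S} = [] , ↭-reflexive (sym (++-identityʳ S))

  []⊑ : {S : List A} → [] ⊑ S
  []⊑ {S} = S , refl

  ⊑-trans : {S T U : List A} → S ⊑ T → T ⊑ U → S ⊑ U
  ⊑-trans {S} (R , p) (R' , q) = R ++ R' , ↭-trans q (↭-trans (↭-++⁺ʳ R' p) (↭-reflexive (++-assoc S R R')))

  ⊑-respʳ-↭ : {S T T' : List A} → T ↭ T' → S ⊑ T → S ⊑ T'
  ⊑-respʳ-↭ p (R , q) = R , ↭-trans (↭-sym p) q

  ⊑-respˡ-↭ : {S S' T : List A} → S ↭ S' → S ⊑ T → S' ⊑ T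
  ⊑-respˡ-↭ p (R , q) = R , ↭-trans q (↭-++⁺ʳ R p)

  ⊑-++⁺ : {S S' T T' : List A} → S ⊑ S' → T ⊑ T' → S ++ T ⊑ S' ++ T'
  ⊑-++⁺ {S} {S'} {T} {T'} (R , p) (R' , q) =
    R ++ R' , ↭-trans (↭-++⁺ p q) (++-interchange S R T R')

  ⊑-++ˡ : (S T : List A) → S ⊑ S ++ T
  ⊑-++ˡ S T = T , refl

  ⊑-++ʳ : (S T : List A) → T ⊑ S ++ T
  ⊑-++ʳ S T = S , ++-comm S T

  ⊑-length : {S T : List A} → S ⊑ T → length S ≤ length T
  ⊑-length {S} (R , p) = subst (length S ≤_) (trans (sym (length-++ S)) (sym (↭-length p))) (m≤m+n (length S) (length R))

  ⊑-All : {P : A → Set} {S T : List A} → S ⊑ T → All P T → All P S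
  ⊑-All {S = S} (R , p) ps = Allₚ.++⁻ˡ S (All-resp-↭ p ps)

  ∈⇒↭ : {x : A} {S : List A} → x ∈ S → [ x ] ⊑ S
  ∈⇒↭ x∈S with ys , zs , refl ← ∈-∃++ x∈S = ys ++ zs , shift _ ys zs

  ⊆⇒⊑ : {T S : List A} → T ⊆ S → T ⊑ S
  ⊆⇒⊑ [] = [] , refl
  ⊆⇒⊑ {T} (y ∷ʳ s) with R , p ← ⊆⇒⊑ s = y ∷ R , ↭-trans (prep y p) (↭-sym (shift y T R))
  ⊆⇒⊑ (refl ∷ s) with R , p ← ⊆⇒⊑ s = R , prep _ p

  ⊆-resp-↭ : {T S S' : List A} → S ↭ S' → T ⊆ S → ∃[ T' ] (T ↭ T' × T' ⊆ S')
  ⊆-resp-↭ refl s = _ , refl , s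
  ⊆-resp-↭ (prep x p) (.x ∷ʳ s) with T' , q , s' ← ⊆-resp-↭ p s = T' , q , x ∷ʳ s'
  ⊆-resp-↭ (prep x p) (refl ∷ s) with T' , q , s' ← ⊆-resp-↭ p s = x ∷ T' , prep x q , refl ∷ s'
  ⊆-resp-↭ (swap x y p) (.x ∷ʳ .y ∷ʳ s) with T' , q , s' ← ⊆-resp-↭ p s = T' , q , y ∷ʳ x ∷ʳ s'
  ⊆-resp-↭ (swap x y p) (.x ∷ʳ (refl ∷ s)) with T' , q , s' ← ⊆-resp-↭ p s = y ∷ T' , prep y q , refl ∷ x ∷ʳ s'
  ⊆-resp-↭ (swap x y p) (refl ∷ (.y ∷ʳ s)) with T' , q , s' ← ⊆-resp-↭ p s = x ∷ T' , prep x q , y ∷ʳ refl ∷ s'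
  ⊆-resp-↭ (swap x y p) (refl ∷ (refl ∷ s)) with T' , q , s' ← ⊆-resp-↭ p s = y ∷ x ∷ T' , swap x y q , refl ∷ refl ∷ s'
  ⊆-resp-↭ (↭-trans p p') s with T' , q , s' ← ⊆-resp-↭ p s with T'' , q' , s'' ← ⊆-resp-↭ p' s' = T'' , ↭-trans q q' , s''

  ++-⊆ : (T R : List A) → T ⊆ T ++ R
  ++-⊆ [] R = []⊆-universal R
  ++-⊆ (x ∷ T) R = refl ∷ ++-⊆ T R

  ⊑⇒⊆ : {T S : List A} → T ⊑ S → ∃[ T' ] (T ↭ T' × T' ⊆ S)
  ⊑⇒⊆ {T} (R , p) = ⊆-resp-↭ (↭-sym p) (++-⊆ T R)

  ⊆-++⁻ : (S S' : List A) {T : List A} → T ⊆ S ++ S' → ∃[ U ] ∃[ U' ] (T ≡ U ++ U' × U ⊆ S × U' ⊆ S')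
  ⊆-++⁻ [] S' s = [] , _ , refl , [] , s
  ⊆-++⁻ (x ∷ S) S' (.x ∷ʳ s) with U , U' , refl , u , u' ← ⊆-++⁻ S S' s = U , U' , refl , x ∷ʳ u , u'
  ⊆-++⁻ (x ∷ S) S' (refl ∷ s) with U , U' , refl , u , u' ← ⊆-++⁻ S S' s = x ∷ U , U' , refl , refl ∷ u , u'

  ⊆-replicate⁻ : (k : ℕ) {x : A} {T : List A} → T ⊆ replicate k x → ∃[ j ] (j ≤ k × T ≡ replicate j x)
  ⊆-replicate⁻ zero [] = 0 , z≤n , refl
  ⊆-replicate⁻ (suc k) (_ ∷ʳ s) with j , j≤k , refl ← ⊆-replicate⁻ k s = j , m≤n⇒m≤1+n j≤k , refl
  ⊆-replicate⁻ (suc k) (refl ∷ s) with j , j≤k , refl ← ⊆-replicate⁻ k s = suc j , s≤s j≤k , refl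

  map-++⁻ : {B : Set} (f : B → A) (S : List B) (T : List A) {R : List A} → map f S ≡ T ++ R →
    ∃[ T' ] ∃[ R' ] (S ≡ T' ++ R' × map f T' ≡ T × map f R' ≡ R)
  map-++⁻ f S [] e = [] , S , refl , refl , e
  map-++⁻ f (s ∷ S) (t ∷ T) e with e₁ , e₂ ← ∷-injective e with T' , R' , refl , e₃ , e₄ ← map-++⁻ f S T e₂ =
    s ∷ T' , R' , refl , cong₂ _∷_ e₁ e₃ , e₄

  ↭-map-++⁻ : {B : Set} (f : B → A) {S : List B} {T R : List A} → map f S ↭ T ++ R →
    ∃[ T' ] ∃[ R' ] (S ↭ T' ++ R' × map f T' ≡ T × map f R' ≡ R)
  ↭-map-++⁻ f {T = T} p with S' , e , q ← ↭-map-inv f p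
    with T' , R' , refl , e₁ , e₂ ← map-++⁻ f S' T (sym e) = T' , R' , q , e₁ , e₂

  replicate-+ : (j k : ℕ) {x : A} → replicate j x ++ replicate k x ≡ replicate (j + k) x
  replicate-+ zero k = refl
  replicate-+ (suc j) k = cong (_ ∷_) (replicate-+ j k)

  ⊑-replicate : {j k : ℕ} {x : A} → j ≤ k → replicate j x ⊑ replicate k x
  ⊑-replicate {j} {k} {x} j≤k = replicate (k ∸ j) x ,
    ↭-reflexive (trans (cong (λ i → replicate i x) (sym (m+[n∸m]≡n j≤k))) (sym (replicate-+ j (k ∸ j))))

  All≡⇒replicate : {x : A} (S : List A) → All (_≡ x) S → S ≡ replicate (length S) x
  All≡⇒replicate [] [] = refl
  All≡⇒replicate (_ ∷ S) (refl ∷ ps) = cong (_ ∷_) (All≡⇒replicate S ps)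

  All⊎⇒↭-++ : {P Q : A → Set} (S : List A) → All (λ x → P x ⊎ Q x) S →
    ∃[ T ] ∃[ U ] (S ↭ T ++ U × All P T × All Q U)
  All⊎⇒↭-++ [] [] = [] , [] , refl , [] , []
  All⊎⇒↭-++ (x ∷ S) (px ∷ ps) with T , U , p , a , b ← All⊎⇒↭-++ S ps with px
  ... | inj₁ q = x ∷ T , U , prep x p , q ∷ a , b
  ... | inj₂ q = T , x ∷ U , ↭-trans (prep x p) (↭-sym (shift x T U)) , a , q ∷ b

  -- The pigeonhole principle of the development: with `⊑-length` it bounds the number of distinct
  -- elements, and with `⊑-full` it turns equality of lengths into a permutation.
  Unique⇒⊑ : {S T : List A} → Unique S → (∀ {x} → x ∈ S → x ∈ T) → S ⊑ T
  Unique⇒⊑ {[]} _ _ = []⊑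
  Unique⇒⊑ {x ∷ S} {T} u@(_ ∷ uS) sub with R , p ← ∈⇒↭ (sub (here refl)) =
    let R' , q = Unique⇒⊑ uS (λ y∈S → tail y∈S (∈-resp-↭ p (sub (there y∈S)))) in R' , ↭-trans p (prep x q)
    where
    tail : ∀ {y R} → y ∈ S → y ∈ x ∷ R → y ∈ R
    tail y∈S (here refl) = ⊥-elim (Uniqueₚ.Unique[x∷xs]⇒x∉xs u y∈S)
    tail y∈S (there y∈R) = y∈R

  ∉⇒Unique-∷ : {x : A} {S : List A} → x ∉ S → Unique S → Unique (x ∷ S)
  ∉⇒Unique-∷ x∉S u = Allₚ.¬Any⇒All¬ _ x∉S ∷ u

  ⊑-full : {S T : List A} → S ⊑ T → length T ≤ length S → T ↭ S
  ⊑-full {S} {T} ([] , p) _ = ↭-trans p (↭-reflexive (++-identityʳ S))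
  ⊑-full {S} {T} (x ∷ R , p) T≤S = ⊥-elim (<-irrefl refl (≤-trans (s≤s (m≤m+n (length S) (length R)))
    (≤-trans (≤-reflexive (trans (sym (+-suc (length S) (length R)))
      (trans (sym (length-++ S)) (sym (↭-length p))))) T≤S)))

Unique-resp-↭ : {A : Set} {S T : List A} → S ↭ T → Unique S → Unique T
Unique-resp-↭ p = PermSetoid.Unique-resp-↭ (setoid _) (↭⇒↭ₛ p)

-- The size count of the Dyson transform: with `f` a translation and `P` membership in `S`, every
-- element of `T` is either added to `S` or kept in `T`.
length-filter-split : {A B : Set} {P : Pred B 0ℓ} (P? : Decidable P) (f : A → B) (S : List A) →
  length (filter (¬? ∘ P?) (map f S)) + length (filter (P? ∘ f) S) ≡ length S
length-filter-split P? f [] = refl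
length-filter-split P? f (x ∷ S) with P? (f x)
... | yes _ = trans (+-suc _ _) (cong suc (length-filter-split P? f S))
... | no _ = cong suc (length-filter-split P? f S)

-- Search through all sublists decides whether a short zero-sum subsequence exists, so that
-- `extract` can branch on it constructively.
any-⊆? : {A : Set} {P : List A → Set} → (∀ T → Dec (P T)) → ∀ S → Dec (∃[ T ] (T ⊆ S × P T))
any-⊆? P? [] with P? []
... | yes p = yes ([] , [] , p)
... | no ¬p = no λ { ([] , [] , p) → ¬p p }
any-⊆? P? (x ∷ S) with any-⊆? P? S | any-⊆? (P? ∘ (x ∷_)) S
... | yes (T , T⊆S , p) | _ = yes (T , x ∷ʳ T⊆S , p)
... | no _ | yes (T , T⊆S , p) = yes (x ∷ T , refl ∷ T⊆S , p)
... | no ¬p | no ¬q = no λ { (T , _ ∷ʳ T⊆S , p) → ¬p (T , T⊆S , p) ; (_ ∷ T , refl ∷ T⊆S , p) → ¬q (T , T⊆S , p) }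

argmax : {A : Set} (f : A → ℕ) (x : A) (S : List A) → ∃[ y ] All (λ z → f z ≤ f y) (x ∷ S)
argmax f x [] = x , ≤-refl ∷ []
argmax f x (z ∷ S) with y , p ∷ ps ← argmax f x S with ≤-total (f z) (f y)
... | inj₁ fz≤fy = y , p ∷ fz≤fy ∷ ps
... | inj₂ fy≤fz = z , ≤-trans p fy≤fz ∷ ≤-refl ∷ All.map (λ q → ≤-trans q fy≤fz) ps

-- Abelian groups with decidable equality and the Dyson transform.

module FinAbGroup {A : Set} (_∙_ : A → A → A) (ε : A) (_⁻¹ : A → A)
  (isAbelianGroup : IsAbelianGroup _≡_ _∙_ ε _⁻¹) (_≟_ : DecidableEquality A) where

  open IsAbelianGroup isAbelianGroup public
    using (assoc; comm; identityˡ; identityʳ; inverseˡ; inverseʳ; isCommutativeMonoid)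
  open DecMembership _≟_ public using (_∈?_)

  abelianGroup : AbelianGroup _ _
  abelianGroup = record { isAbelianGroup = isAbelianGroup }

  open GroupProperties (AbelianGroup.group abelianGroup) public
    using (∙-cancelˡ; ∙-cancelʳ; ⁻¹-involutive; identityˡ-unique; identityʳ-unique; inverseʳ-unique; inverseˡ-unique)

  module ∙-Solver = CMSolver (AbelianGroup.commutativeMonoid abelianGroup)
  open ∙-Solver using (solve; _⊕_; _⊜_)

  ∙-⁻¹-cancelˡ : ∀ z x → z ∙ ((z ⁻¹) ∙ x) ≡ x
  ∙-⁻¹-cancelˡ z x = trans (sym (assoc z _ x)) (trans (cong (_∙ x) (inverseʳ z)) (identityˡ x))

  ⁻¹-∙-cancelˡ : ∀ z x → (z ⁻¹) ∙ (z ∙ x) ≡ x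
  ⁻¹-∙-cancelˡ z x = trans (sym (assoc _ z x)) (trans (cong (_∙ x) (inverseˡ z)) (identityˡ x))

  sum : List A → A
  sum = foldr _∙_ ε

  infixr 8 _•_
  _•_ : ℕ → A → A
  zero • x = ε
  suc k • x = x ∙ (k • x)

  sum-↭ : ∀ {S T} → S ↭ T → sum S ≡ sum T
  sum-↭ p = PermSetoid.foldr-commMonoid (setoid A) isCommutativeMonoid (↭⇒↭ₛ p)

  sum-++ : ∀ S T → sum (S ++ T) ≡ sum S ∙ sum T
  sum-++ [] T = sym (identityˡ _)
  sum-++ (x ∷ S) T = trans (cong (x ∙_) (sum-++ S T)) (sym (assoc _ _ _))

  sum-replicate : ∀ k x → sum (replicate k x) ≡ k • x
  sum-replicate zero x = refl
  sum-replicate (suc k) x = cong (x ∙_) (sum-replicate k x)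

  •-+ : ∀ j k x → (j + k) • x ≡ (j • x) ∙ (k • x)
  •-+ zero k x = sym (identityˡ _)
  •-+ (suc j) k x = trans (cong (x ∙_) (•-+ j k x)) (sym (assoc _ _ _))

  ∙-interchange : ∀ a b c d → (a ∙ b) ∙ (c ∙ d) ≡ (a ∙ c) ∙ (b ∙ d)
  ∙-interchange = solve 4 (λ a b c d → (a ⊕ b) ⊕ (c ⊕ d) ⊜ (a ⊕ c) ⊕ (b ⊕ d)) refl

  •-∙ : ∀ k x y → k • (x ∙ y) ≡ (k • x) ∙ (k • y)
  •-∙ zero x y = sym (identityˡ _)
  •-∙ (suc k) x y = trans (cong ((x ∙ y) ∙_) (•-∙ k x y)) (∙-interchange _ _ _ _)

  •-ε : ∀ k → k • ε ≡ ε
  •-ε zero = refl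
  •-ε (suc k) = trans (identityˡ _) (•-ε k)

  •-* : ∀ j k x → (j * k) • x ≡ j • (k • x)
  •-* zero k x = refl
  •-* (suc j) k x = trans (•-+ k (j * k) x) (cong ((k • x) ∙_) (•-* j k x))

  sum-map-∙ : ∀ x S → sum (map (x ∙_) S) ≡ (length S • x) ∙ sum S
  sum-map-∙ x [] = sym (identityˡ _)
  sum-map-∙ x (y ∷ S) = trans (cong ((x ∙ y) ∙_) (sum-map-∙ x S)) (∙-interchange _ _ _ _)

  map-∙-Unique : ∀ x {S} → Unique S → Unique (map (x ∙_) S)
  map-∙-Unique x = Uniqueₚ.map⁺ (∙-cancelˡ x _ _)

  -- If `S ∙ b` stayed inside `S`, counting would make it all of `S`, and the element `ε` of `S`
  -- would have the excluded form `a ∙ b`. The `a` found here is the pivot for which the Dyson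
  -- transform really shrinks `T`.
  translate-proper : ∀ {b S} → b ≢ ε → Unique S → ε ∈ S → (∀ {a} → a ∈ S → a ∙ b ≢ ε) →
    ∃[ a ] (a ∈ S × a ∙ b ∉ S)
  translate-proper {b} {S} b≢ε uS ε∈S neg with All.all? (λ a → (a ∙ b) ∈? S) S
  ... | no ¬all with a , a∈S , q ← find (Allₚ.¬All⇒Any¬ (λ a → (a ∙ b) ∈? S) S ¬all) = a , a∈S , q
  ... | yes all
    with p ← ⊑-full (Unique⇒⊑ {T = S} (Uniqueₚ.map⁺ {f = _∙ b} (∙-cancelʳ b _ _) uS)
                       (λ x∈ → let a , a∈S , e = ∈-map⁻ (_∙ b) x∈ in subst (_∈ S) (sym e) (All.lookup all a∈S)))
                     (≤-reflexive (sym (length-map (_∙ b) S)))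
    with a , a∈S , e ← ∈-map⁻ (_∙ b) (∈-resp-↭ p ε∈S) = ⊥-elim (neg a∈S (sym e))

  Sumset : List A → List A → A → Set
  Sumset S T c = ∃[ a ] ∃[ b ] (a ∈ S × b ∈ T × c ≡ a ∙ b)

  module Dyson {S T : List A} {a : A} (a∈S : a ∈ S) where

    S∪ T∩ : List A
    S∪ = S ++ filter (¬? ∘ (_∈? S)) (map (a ∙_) T)
    T∩ = filter (λ t → (a ∙ t) ∈? S) T

    ∈T∩⁻ : ∀ {t} → t ∈ T∩ → t ∈ T × (a ∙ t) ∈ S
    ∈T∩⁻ = ∈-filter⁻ (λ t → (a ∙ t) ∈? S)

    ∈S∪⁻ : ∀ {x} → x ∈ S∪ → x ∈ S ⊎ ∃[ t ] (t ∈ T × x ≡ a ∙ t)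
    ∈S∪⁻ x∈ with ∈-++⁻ S x∈
    ... | inj₁ x∈S = inj₁ x∈S
    ... | inj₂ x∈ʳ = inj₂ (∈-map⁻ (a ∙_) (proj₁ (∈-filter⁻ (¬? ∘ (_∈? S)) {xs = map (a ∙_) T} x∈ʳ)))

    length-S∪-T∩ : length S∪ + length T∩ ≡ length S + length T
    length-S∪-T∩ = trans (cong (_+ length T∩) (length-++ S)) (trans (+-assoc (length S) _ _)
      (cong (length S +_) (length-filter-split (_∈? S) (a ∙_) T)))

    Unique-S∪ : Unique S → Unique T → Unique S∪
    Unique-S∪ uS uT = Uniqueₚ.++⁺ uS (Uniqueₚ.filter⁺ (¬? ∘ (_∈? S)) (map-∙-Unique a uT))
      (λ (x∈S , x∈) → proj₂ (∈-filter⁻ (¬? ∘ (_∈? S)) {xs = map (a ∙_) T} x∈) x∈S)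

    Unique-T∩ : Unique T → Unique T∩
    Unique-T∩ = Uniqueₚ.filter⁺ (λ t → (a ∙ t) ∈? S)

    ε∈T∩ : ε ∈ T → ε ∈ T∩
    ε∈T∩ ε∈T = ∈-filter⁺ (λ t → (a ∙ t) ∈? S) ε∈T (subst (_∈ S) (sym (identityʳ a)) a∈S)

    length-T∩ : ∀ {b} → Unique T → b ∈ T → (a ∙ b) ∉ S → suc (length T∩) ≤ length T
    length-T∩ uT b∈T ab∉S = ⊑-length (Unique⇒⊑ (∉⇒Unique-∷ (ab∉S ∘ proj₂ ∘ ∈T∩⁻) (Unique-T∩ uT))
      (λ { (here refl) → b∈T ; (there t∈) → proj₁ (∈T∩⁻ t∈) }))

    regroup : ∀ t y → (a ∙ t) ∙ y ≡ (a ∙ y) ∙ t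
    regroup = solve 3 (λ a t y → (a ⊕ t) ⊕ y ⊜ (a ⊕ y) ⊕ t) refl a

    -- For an added element `a ∙ t` the factor `a` changes sides, `(a ∙ t) ∙ y = (a ∙ y) ∙ t`, and
    -- `a ∙ y ∈ S` is exactly the condition under which `y` survives in `T∩`.
    Sumset-S∪-T∩ : ∀ {c} → Sumset S∪ T∩ c → Sumset S T c
    Sumset-S∪-T∩ (x , y , x∈ , y∈ , e) with ∈S∪⁻ x∈ | ∈T∩⁻ y∈
    ... | inj₁ x∈S | y∈T , _ = x , y , x∈S , y∈T , e
    ... | inj₂ (t , t∈T , refl) | _ , ay∈S = a ∙ y , t , ay∈S , t∈T , trans e (regroup t y)

    trivial-S∪-T∩ : (∀ {x y} → x ∈ S → y ∈ T → x ∙ y ≡ ε → x ≡ ε × y ≡ ε) →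
      ∀ {x y} → x ∈ S∪ → y ∈ T∩ → x ∙ y ≡ ε → x ≡ ε × y ≡ ε
    trivial-S∪-T∩ triv {y = y} x∈ y∈ e with ∈S∪⁻ x∈ | ∈T∩⁻ y∈
    ... | inj₁ x∈S | y∈T , _ = triv x∈S y∈T e
    ... | inj₂ (t , t∈T , refl) | y∈T , ay∈S
      -- The hypothesis serves twice: for `(a ∙ y) ∙ t` it gives `a ∙ y = ε` and `t = ε`, and then
      -- it applies to `a ∙ y` itself.
      with ay≡ε , refl ← triv ay∈S t∈T (trans (sym (regroup t y)) e)
      with a≡ε , y≡ε ← triv a∈S y∈T ay≡ε = trans (identityʳ a) a≡ε , y≡ε

  -- The Moser–Scherk theorem, by the Dyson transform (S , T) ↦ (S ∪ (a + T) , T ∩ (S − a)).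
  scherk : ∀ S T → Unique S → Unique T → ε ∈ S → ε ∈ T →
    (∀ {x y} → x ∈ S → y ∈ T → x ∙ y ≡ ε → x ≡ ε × y ≡ ε) →
    ∃[ C ] (Unique C × ε ∈ C × length S + length T ≤ suc (length C) × All (Sumset S T) C)
  scherk S T = go (length T) S T ≤-refl
    where
    go : ∀ k S T → length T ≤ k → Unique S → Unique T → ε ∈ S → ε ∈ T →
      (∀ {x y} → x ∈ S → y ∈ T → x ∙ y ≡ ε → x ≡ ε × y ≡ ε) →
      ∃[ C ] (Unique C × ε ∈ C × length S + length T ≤ suc (length C) × All (Sumset S T) C)
    go zero S (_ ∷ _) () _ _ _ _ _
    go (suc k) S T T≤k uS uT ε∈S ε∈T triv with ∈⇒↭ ε∈T
    -- `T` consists of `ε` alone, and `C = S` attains the bound with equality.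
    ... | [] , p = S , uS , ε∈S , ≤-reflexive (trans (cong (length S +_) (↭-length p)) (+-comm _ 1)) ,
                   All.tabulate (λ {a} a∈S → a , ε , a∈S , ε∈T , sym (identityʳ a))
    ... | b ∷ T₀ , p
      -- A second element `b` of `T` is different from `ε`; a pivot `a` with `a ∙ b ∉ S` removes it,
      -- so the length of `T` decreases.
      with b∈T ← ∈-resp-↭ (↭-sym p) (there (here refl))
      with b≢ε ← (λ e → Uniqueₚ.Unique[x∷xs]⇒x∉xs (Unique-resp-↭ p uT) (here (sym e)))
      with a , a∈S , ab∉S ← translate-proper b≢ε uS ε∈S (λ a∈S e → b≢ε (proj₂ (triv a∈S b∈T e)))
      =
      let module D = Dyson {T = T} a∈S
          C , uC , ε∈C , lC , sC = go k D.S∪ D.T∩ (≤-pred (≤-trans (D.length-T∩ uT b∈T ab∉S) T≤k))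
            (D.Unique-S∪ uS uT) (D.Unique-T∩ uT) (∈-++⁺ˡ ε∈S) (D.ε∈T∩ ε∈T) (D.trivial-S∪-T∩ triv)
      in C , uC , ε∈C , ≤-trans (≤-reflexive (sym D.length-S∪-T∩)) lC , All.map D.Sumset-S∪-T∩ sC

-- The class group F₂³

V : Set
V = Bool × Bool × Bool

infixl 6 _⊞_
_⊞_ : V → V → V
(a , b , c) ⊞ (a' , b' , c') = a xor a' , b xor b' , c xor c'

0V : V
0V = false , false , false

_≟V_ : DecidableEquality V
_≟V_ = ≡-dec Boolₚ._≟_ (≡-dec Boolₚ._≟_ Boolₚ._≟_)

×-≡ : ∀ {a b c a' b' c' : Bool} → a ≡ a' → b ≡ b' → c ≡ c' → (a , b , c) ≡ (a' , b' , c')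
×-≡ refl refl refl = refl

⊞-self : ∀ v → v ⊞ v ≡ 0V
⊞-self (a , b , c) = ×-≡ (Boolₚ.xor-same a) (Boolₚ.xor-same b) (Boolₚ.xor-same c)

⊞-isAbelianGroup : IsAbelianGroup _≡_ _⊞_ 0V id
⊞-isAbelianGroup = record
  { isGroup = record
    { isMonoid = record
      { isSemigroup = record
        { isMagma = record { isEquivalence = isEquivalence ; ∙-cong = cong₂ _⊞_ }
        ; assoc = λ (a , b , c) (a' , b' , c') (a'' , b'' , c'') →
            ×-≡ (Boolₚ.xor-assoc a a' a'') (Boolₚ.xor-assoc b b' b'') (Boolₚ.xor-assoc c c' c'') }
      ; identity = (λ _ → refl) , (λ (a , b , c) → ×-≡ (Boolₚ.xor-identityʳ a) (Boolₚ.xor-identityʳ b) (Boolₚ.xor-identityʳ c)) }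
    ; inverse = ⊞-self , ⊞-self
    ; ⁻¹-cong = id }
  ; comm = λ (a , b , c) (a' , b' , c') → ×-≡ (Boolₚ.xor-comm a a') (Boolₚ.xor-comm b b') (Boolₚ.xor-comm c c') }

module V = FinAbGroup _⊞_ 0V id ⊞-isAbelianGroup _≟V_

allV : List V
allV = cartesianProduct bools (cartesianProduct bools bools)
  where bools = false ∷ true ∷ []

∈-allV : ∀ v → v ∈ allV
∈-allV (a , b , c) = ∈-cartesianProduct⁺ (∈-bools a) (∈-cartesianProduct⁺ (∈-bools b) (∈-bools c))
  where
  ∈-bools : ∀ b → b ∈ false ∷ true ∷ []
  ∈-bools false = here refl
  ∈-bools true = there (here refl)

Unique-decided : (X : List V) {_ : True (DecUnique.unique? _≟V_ X)} → Unique X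
Unique-decided X {u} = toWitness u

Unique-allV : Unique allV
Unique-allV = Unique-decided allV

Unique-V⇒↭ : ∀ {X} → Unique X → length X ≡ 8 → allV ↭ X
Unique-V⇒↭ u e = ⊑-full (Unique⇒⊑ u (λ {v} _ → ∈-allV v)) (≤-reflexive (sym e))

-- The three cosets of `⟨w⟩` other than `⟨w⟩`, each as a pair with sum `w`, for `w`, `s`, `t`
-- independent. After translation they become the three pairs of leftovers; any two of the pairs
-- form an affine plane.
sixfold : V → V → V → List V
sixfold w s t = s ∷ (w ⊞ s) ∷ t ∷ (w ⊞ t) ∷ (s ⊞ t) ∷ (w ⊞ (s ⊞ t)) ∷ []

unit₁ unit₂ unit₃ : V
unit₁ = true , false , false
unit₂ = false , true , false
unit₃ = false , false , true

-- Two unit vectors complete `w` to a basis. Which two depends on the coordinates of `w`; that the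
-- eight points are distinct is verified by computation.
complete-basis : ∀ w → w ≢ 0V → ∃[ s ] ∃[ t ] Unique (0V ∷ w ∷ sixfold w s t)
complete-basis w@(true , false , false) _ = unit₂ , unit₃ , Unique-decided (0V ∷ w ∷ sixfold w unit₂ unit₃)
complete-basis w@(true , false , true) _ = unit₂ , unit₃ , Unique-decided (0V ∷ w ∷ sixfold w unit₂ unit₃)
complete-basis w@(true , true , false) _ = unit₂ , unit₃ , Unique-decided (0V ∷ w ∷ sixfold w unit₂ unit₃)
complete-basis w@(true , true , true) _ = unit₂ , unit₃ , Unique-decided (0V ∷ w ∷ sixfold w unit₂ unit₃)
complete-basis w@(false , true , false) _ = unit₁ , unit₃ , Unique-decided (0V ∷ w ∷ sixfold w unit₁ unit₃)
complete-basis w@(false , true , true) _ = unit₁ , unit₃ , Unique-decided (0V ∷ w ∷ sixfold w unit₁ unit₃)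
complete-basis w@(false , false , true) _ = unit₁ , unit₂ , Unique-decided (0V ∷ w ∷ sixfold w unit₁ unit₂)
complete-basis (false , false , false) w≢0 = ⊥-elim (w≢0 refl)

allV-decomposition : ∀ u w → w ≢ 0V → ∃[ s ] ∃[ t ] allV ↭ map (u ⊞_) (0V ∷ w ∷ sixfold w s t)
allV-decomposition u w w≢0 = let s , t , unique = complete-basis w w≢0 in
  s , t , Unique-V⇒↭ (V.map-∙-Unique u unique) refl

infixr 7 _⋆_
_⋆_ : Bool → V → V
true ⋆ v = v
false ⋆ v = 0V

⋆-⊞ : ∀ b u v → b ⋆ (u ⊞ v) ≡ b ⋆ u ⊞ b ⋆ v
⋆-⊞ true u v = refl
⋆-⊞ false u v = refl

⋆-∧ : ∀ b b' v → b ⋆ (b' ⋆ v) ≡ (b ∧ b') ⋆ v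
⋆-∧ true b' v = refl
⋆-∧ false b' v = refl

⋆-xor : ∀ b b' v → (b xor b') ⋆ v ≡ b ⋆ v ⊞ b' ⋆ v
⋆-xor false b' v = sym (V.identityˡ (b' ⋆ v))
⋆-xor true false v = sym (V.identityʳ v)
⋆-xor true true v = sym (⊞-self v)

combination : V → V → V → Bool → Bool → Bool → V
combination u v w a b c = a ⋆ u ⊞ (b ⋆ v ⊞ c ⋆ w)

LinearlyIndependent : V → V → V → Set
LinearlyIndependent u v w = ∀ a b c → combination u v w a b c ≡ 0V → a ≡ false × b ≡ false × c ≡ false

LI-swap : ∀ {u v w} → LinearlyIndependent u v w → LinearlyIndependent v u w
LI-swap {u} {v} {w} li a b c e = let b≡ , a≡ , c≡ = li b a c (trans (exchange (b ⋆ u) (a ⋆ v) (c ⋆ w)) e) in a≡ , b≡ , c≡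
  where
  exchange : ∀ x y z → x ⊞ (y ⊞ z) ≡ y ⊞ (x ⊞ z)
  exchange = solve 3 (λ x y z → x ⊕ (y ⊕ z) ⊜ y ⊕ (x ⊕ z)) refl
    where open V.∙-Solver using (solve; _⊕_; _⊜_)

LI-add₂₃ : ∀ {u v w} → LinearlyIndependent u v w → LinearlyIndependent u v (v ⊞ w)
LI-add₂₃ {u} {v} {w} li a b c e =
  let a≡ , bc≡ , c≡ = li a (b xor c) c (trans same e)
  in a≡ , trans (sym (Boolₚ.xor-identityʳ b)) (subst (λ x → b xor x ≡ false) c≡ bc≡) , c≡
  where
  open ≡-Reasoning
  same : combination u v w a (b xor c) c ≡ combination u v (v ⊞ w) a b c
  same = begin
    a ⋆ u ⊞ ((b xor c) ⋆ v ⊞ c ⋆ w) ≡⟨ cong (λ x → a ⋆ u ⊞ (x ⊞ c ⋆ w)) (⋆-xor b c v) ⟩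
    a ⋆ u ⊞ ((b ⋆ v ⊞ c ⋆ v) ⊞ c ⋆ w) ≡⟨ cong (a ⋆ u ⊞_) (V.assoc (b ⋆ v) (c ⋆ v) (c ⋆ w)) ⟩
    a ⋆ u ⊞ (b ⋆ v ⊞ (c ⋆ v ⊞ c ⋆ w)) ≡⟨ cong (λ x → a ⋆ u ⊞ (b ⋆ v ⊞ x)) (⋆-⊞ c v w) ⟨
    a ⋆ u ⊞ (b ⋆ v ⊞ c ⋆ (v ⊞ w)) ∎

-- Used to pass from an element `z` to `z - a f₃`: on classes the multiple of `f₃` counts only
-- through the parity `i` of `a`.
LI-add₃₁ : ∀ {u v w} i → LinearlyIndependent u v w → LinearlyIndependent (i ⋆ w ⊞ u) v w
LI-add₃₁ {u} {v} {w} i li a b c e =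
  let a≡ , b≡ , c≡ = li a b ((a ∧ i) xor c) (trans same e)
  in a≡ , b≡ , subst (λ x → (x ∧ i) xor c ≡ false) a≡ c≡
  where
  regroup : ∀ x y z t → x ⊞ (y ⊞ (z ⊞ t)) ≡ (z ⊞ x) ⊞ (y ⊞ t)
  regroup = solve 4 (λ x y z t → x ⊕ (y ⊕ (z ⊕ t)) ⊜ (z ⊕ x) ⊕ (y ⊕ t)) refl
    where open V.∙-Solver using (solve; _⊕_; _⊜_)
  open ≡-Reasoning
  same : combination u v w a b ((a ∧ i) xor c) ≡ combination (i ⋆ w ⊞ u) v w a b c
  same = begin
    a ⋆ u ⊞ (b ⋆ v ⊞ ((a ∧ i) xor c) ⋆ w) ≡⟨ cong (λ x → a ⋆ u ⊞ (b ⋆ v ⊞ x)) (⋆-xor (a ∧ i) c w) ⟩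
    a ⋆ u ⊞ (b ⋆ v ⊞ ((a ∧ i) ⋆ w ⊞ c ⋆ w)) ≡⟨ regroup (a ⋆ u) (b ⋆ v) ((a ∧ i) ⋆ w) (c ⋆ w) ⟩
    ((a ∧ i) ⋆ w ⊞ a ⋆ u) ⊞ (b ⋆ v ⊞ c ⋆ w) ≡⟨ cong (λ x → (x ⊞ a ⋆ u) ⊞ (b ⋆ v ⊞ c ⋆ w)) (⋆-∧ a i w) ⟨
    (a ⋆ (i ⋆ w) ⊞ a ⋆ u) ⊞ (b ⋆ v ⊞ c ⋆ w) ≡⟨ cong (_⊞ (b ⋆ v ⊞ c ⋆ w)) (⋆-⊞ a (i ⋆ w) u) ⟨
    a ⋆ (i ⋆ w ⊞ u) ⊞ (b ⋆ v ⊞ c ⋆ w) ∎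

-- A relation between `u`, `v` and `w` would make `w` zero or identify two of the cosets `⟨w⟩`,
-- `u + ⟨w⟩`, `v + ⟨w⟩`, and the six points listed exclude both.
distinct⇒LI : ∀ {u v w} → Unique (0V ∷ w ∷ u ∷ (u ⊞ w) ∷ v ∷ (v ⊞ w) ∷ []) → LinearlyIndependent u v w
distinct⇒LI {u} {v} {w} ((0≢w ∷ 0≢u ∷ 0≢uw ∷ 0≢v ∷ 0≢vw ∷ []) ∷ _ ∷ (_ ∷ u≢v ∷ u≢vw ∷ []) ∷ _) = li
  where
  li : LinearlyIndependent u v w
  li false false false _ = refl , refl , refl
  li false false true e = ⊥-elim (0≢w (sym e))
  li true false false e = ⊥-elim (0≢u (sym (trans (sym (V.identityʳ u)) e)))
  li true false true e = ⊥-elim (0≢uw (sym e))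
  li false true false e = ⊥-elim (0≢v (sym (trans (sym (V.identityʳ v)) e)))
  li false true true e = ⊥-elim (0≢vw (sym e))
  li true true false e = ⊥-elim (u≢v (V.inverseˡ-unique u v (trans (cong (u ⊞_) (sym (V.identityʳ v))) e)))
  li true true true e = ⊥-elim (u≢vw (V.inverseˡ-unique u (v ⊞ w) e))

-- Parity, spanning in the class group, and small inequalities.

parity : ℕ → Bool
parity zero = false
parity (suc m) = true xor parity m

parity-+ : ∀ i j → parity (i + j) ≡ parity i xor parity j
parity-+ zero j = refl
parity-+ (suc i) j = trans (cong (true xor_) (parity-+ i j)) (sym (Boolₚ.xor-assoc true (parity i) (parity j)))

parity-double : ∀ j → parity (j + j) ≡ false
parity-double j = trans (parity-+ j j) (Boolₚ.xor-same (parity j))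

parity≡false⇒double : ∀ m → parity m ≡ false → ∃[ j ] m ≡ j + j
parity≡false⇒double zero _ = 0 , refl
parity≡false⇒double (suc (suc m)) e =
  let j , e′ = parity≡false⇒double m (trans (sym (Boolₚ.not-involutive (parity m))) e) in suc j , cong suc (trans (cong suc e′) (sym (+-suc j j)))

bit : Bool → ℕ
bit false = 0
bit true = 1

parity-bit : ∀ b → parity (bit b) ≡ b
parity-bit false = refl
parity-bit true = refl

-- Independence makes the additive map `comb` injective on the eight points, hence onto by counting.
LI-spans : ∀ {u v w} → LinearlyIndependent u v w → ∀ x → ∃[ a ] ∃[ b ] ∃[ c ] x ≡ combination u v w a b c
LI-spans {u} {v} {w} li x =
  let (a , b , c) , _ , e = ∈-map⁻ comb {xs = allV} (∈-resp-↭ onto (∈-allV x)) in a , b , c , e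
  where
  comb : V → V
  comb (a , b , c) = combination u v w a b c
  comb-⊞ : ∀ y z → comb (y ⊞ z) ≡ comb y ⊞ comb z
  comb-⊞ (a , b , c) (a′ , b′ , c′) = trans
    (cong₂ _⊞_ (⋆-xor a a′ u) (cong₂ _⊞_ (⋆-xor b b′ v) (⋆-xor c c′ w)))
    (trans (cong ((a ⋆ u ⊞ a′ ⋆ u) ⊞_) (V.∙-interchange (b ⋆ v) (b′ ⋆ v) (c ⋆ w) (c′ ⋆ w)))
      (V.∙-interchange (a ⋆ u) (a′ ⋆ u) (b ⋆ v ⊞ c ⋆ w) (b′ ⋆ v ⊞ c′ ⋆ w)))
  comb-injective : ∀ {y z : V} → comb y ≡ comb z → y ≡ z
  comb-injective {y@(a , b , c)} {z@(a′ , b′ , c′)} e =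
    let a≡ , b≡ , c≡ = li (a xor a′) (b xor b′) (c xor c′) (trans (comb-⊞ y z) (trans (cong (_⊞ comb z) e) (⊞-self (comb z))))
    in V.inverseˡ-unique y z (×-≡ a≡ b≡ c≡)
  onto : allV ↭ map comb allV
  onto = Unique-V⇒↭ {map comb allV} (Uniqueₚ.map⁺ (λ {y} {z} → comb-injective {y} {z}) Unique-allV) refl

parity-+-even : ∀ i j → parity (i + j) ≡ false → parity i ≡ parity j
parity-+-even i j e = same (parity i) (parity j) (trans (sym (parity-+ i j)) e)
  where
  same : ∀ a b → a xor b ≡ false → a ≡ b
  same true true _ = refl
  same false false _ = refl

parity-suc-double : ∀ j → parity (suc (j + j)) ≡ true
parity-suc-double j = cong (true xor_) (parity-double j)

-- Shows that a subsequence as long as two blocks together takes every copy in them, in particular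
-- an odd number from each odd block.
saturated : ∀ {i j I J} → i ≤ I → j ≤ J → I + J ≤ i + j → j ≡ J
saturated {i} {j} {I} {J} i≤I j≤J e = ≤-antisym j≤J (+-cancelˡ-≤ I J j (≤-trans e (+-monoˡ-≤ j i≤I)))

even≤odd⇒≤ : ∀ t α → parity t ≡ false → t ≤ suc (α + α) → t ≤ α + α
even≤odd⇒≤ t α e t≤ with m≤n⇒m<n∨m≡n t≤
... | inj₁ t< = ≤-pred t<
... | inj₂ refl with () ← trans (sym e) (parity-suc-double α)

-- Multiplicities and sums of few terms.

module ZeroSumTheory {A : Set} (_∙_ : A → A → A) (ε : A) (_⁻¹ : A → A)
  (isAbelianGroup : IsAbelianGroup _≡_ _∙_ ε _⁻¹) (_≟_ : DecidableEquality A) where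

  open FinAbGroup _∙_ ε _⁻¹ isAbelianGroup _≟_

  count : A → List A → ℕ
  count x S = length (filter (x ≟_) S)

  count-↭ : ∀ x {S T} → S ↭ T → count x S ≡ count x T
  count-↭ x p = ↭-length (filter-↭ (x ≟_) p)

  count-++ : ∀ x S T → count x (S ++ T) ≡ count x S + count x T
  count-++ x S T = trans (cong length (filter-++ (x ≟_) S T)) (length-++ (filter (x ≟_) S))

  count-⊑ : ∀ x {S T} → S ⊑ T → count x S ≤ count x T
  count-⊑ x {S} (R , p) = ≤-trans (m≤m+n _ _) (≤-reflexive (sym (trans (count-↭ x p) (count-++ x S R))))

  ∈⇒0<count : ∀ {x S} → x ∈ S → 0 < count x S
  ∈⇒0<count {x} {y ∷ S} x∈ with x ≟ y | x∈
  ... | yes _ | _ = s≤s z≤n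
  ... | no x≢y | here x≡y = ⊥-elim (x≢y x≡y)
  ... | no _ | there x∈S = ∈⇒0<count x∈S

  ∉⇒count≡0 : ∀ {x S} → x ∉ S → count x S ≡ 0
  ∉⇒count≡0 {x} {S} x∉S = cong length (filter-none (x ≟_) (Allₚ.¬Any⇒All¬ S x∉S))

  count-replicate : ∀ k x → count x (replicate k x) ≡ k
  count-replicate k x = trans (cong length (filter-all (x ≟_) (Allₚ.replicate⁺ k refl))) (length-replicate k)

  split-count : ∀ x S → ∃[ T ] (S ↭ replicate (count x S) x ++ T × x ∉ T)
  split-count x [] = [] , refl , λ ()
  split-count x (y ∷ S) with T , p , x∉T ← split-count x S with x ≟ y
  ... | yes refl = T , prep x p , x∉T
  ... | no x≢y = y ∷ T , ↭-trans (prep y p) (↭-sym (shift y _ T)) , λ { (here e) → x≢y e ; (there q) → x∉T q }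

  -- One copy of every value. If no value occurs more than `h` times, `h` successive layers exhaust
  -- the sequence, which is the induction behind `short-sums`.
  layer : ∀ S → ∃[ T ] ∃[ R ] (S ↭ T ++ R × Unique T × (∀ {x} → x ∈ S → x ∈ T))
  layer [] = [] , [] , refl , [] , λ ()
  layer (x ∷ S) with T , R , p , uT , sub ← layer S with x ∈? T
  ... | yes x∈T = T , x ∷ R , ↭-trans (prep x p) (↭-sym (shift x T R)) , uT , λ { (here refl) → x∈T ; (there q) → sub q }
  ... | no x∉T = x ∷ T , R , prep x p , ∉⇒Unique-∷ x∉T uT , λ { (here e) → here e ; (there q) → there (sub q) }

  NoShortZeroSum : ℕ → List A → Set
  NoShortZeroSum h S = ∀ T → T ⊑ S → 0 < length T → length T ≤ h → sum T ≢ ε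

  ShortSum : ℕ → List A → A → Set
  ShortSum h S x = ∃[ T ] (T ⊑ S × length T ≤ h × sum T ≡ x)

  -- Induction on `h`, splitting off one layer `T`. For the set `X` of short sums of the rest, the
  -- pair `X`, `ε ∷ T` satisfies the hypothesis of `scherk`: a relation `x ∙ y = ε` with `y ∈ T`
  -- would be a zero-sum subsequence of at most `suc h` terms. So each layer adds its full length to
  -- the number of distinct sums.
  short-sums : ∀ h S → (∀ x → count x S ≤ h) → NoShortZeroSum h S →
    ∃[ X ] (Unique X × ε ∈ X × length S < length X × All (ShortSum h S) X)
  short-sums zero [] _ _ = ε ∷ [] , [] ∷ [] , here refl , s≤s z≤n , ([] , []⊑ , z≤n , refl) ∷ []
  short-sums zero (x ∷ S) c≤0 _ = ⊥-elim (<-irrefl refl (≤-trans (∈⇒0<count {x} (here refl)) (c≤0 x)))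
  short-sums (suc h) S c≤ free =
    let T , R , p , uT , sub = layer S
        R⊑S = ⊑-respʳ-↭ (↭-sym p) (⊑-++ʳ T R)
        X , uX , ε∈X , lX , sX = short-sums h R (count-R p sub)
           (λ U U⊑R 0<U U≤h → free U (⊑-trans U⊑R R⊑S) 0<U (m≤n⇒m≤1+n U≤h))
        T∌ε = λ ε∈T → free (ε ∷ []) (∈⇒↭ (∈-resp-↭ (↭-sym p) (∈-++⁺ˡ ε∈T))) (s≤s z≤n) (s≤s z≤n) (identityʳ ε)
        C , uC , ε∈C , lC , sC = scherk X (ε ∷ T) uX (∉⇒Unique-∷ T∌ε uT) ε∈X (here refl)
           (λ x∈X y∈ e → triv p (All.lookup sX x∈X) y∈ e)
    in C , uC , ε∈C ,
       ≤-pred (begin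
         suc (suc (length S)) ≡⟨ cong (suc ∘ suc) (trans (↭-length p) (trans (length-++ T) (+-comm (length T) _))) ⟩
         suc (suc (length R + length T)) ≡⟨ cong suc (+-suc (length R) (length T)) ⟨
         suc (length R) + suc (length T) ≤⟨ +-monoˡ-≤ (suc (length T)) lX ⟩
         length X + suc (length T) ≤⟨ lC ⟩
         suc (length C) ∎) ,
       All.map (λ (x , y , x∈X , y∈ , e) → combine p (All.lookup sX x∈X) y∈ e) sC
    where
    open ≤-Reasoning
    count-R : ∀ {T R} → S ↭ T ++ R → (∀ {x} → x ∈ S → x ∈ T) → ∀ x → count x R ≤ h
    count-R {T} {R} p sub x with x ∈? R
    ... | no x∉R = ≤-trans (≤-reflexive (∉⇒count≡0 x∉R)) z≤n
    ... | yes x∈R = ≤-pred (≤-trans (+-monoˡ-≤ (count x R) (∈⇒0<count (sub (∈-resp-↭ (↭-sym p) (∈-++⁺ʳ T x∈R)))))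
                      (≤-trans (≤-reflexive (sym (trans (count-↭ x p) (count-++ x T R)))) (c≤ x)))

    append : ∀ {T R U y} → S ↭ T ++ R → U ⊑ R → y ∈ T → y ∷ U ⊑ S
    append p U⊑R y∈T = ⊑-respʳ-↭ (↭-sym p) (⊑-++⁺ (∈⇒↭ y∈T) U⊑R)

    combine : ∀ {T R x y c} → S ↭ T ++ R → ShortSum h R x → y ∈ ε ∷ T → c ≡ x ∙ y → ShortSum (suc h) S c
    combine {T} {R} p (U , U⊑R , U≤h , refl) (here refl) refl =
      U , ⊑-trans U⊑R (⊑-respʳ-↭ (↭-sym p) (⊑-++ʳ T R)) , m≤n⇒m≤1+n U≤h , sym (identityʳ _)
    combine p (U , U⊑R , U≤h , refl) (there y∈T) refl = _ ∷ U , append p U⊑R y∈T , s≤s U≤h , comm _ _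

    triv : ∀ {T R x y} → S ↭ T ++ R → ShortSum h R x → y ∈ ε ∷ T → x ∙ y ≡ ε → x ≡ ε × y ≡ ε
    triv p _ (here refl) e = trans (sym (identityʳ _)) e , refl
    triv p (U , U⊑R , U≤h , refl) (there y∈T) e =
      ⊥-elim (free (_ ∷ U) (append p U⊑R y∈T) (s≤s z≤n) (s≤s U≤h) (trans (comm _ _) e))

  noShortZeroSum? : ∀ h S → NoShortZeroSum h S ⊎ ∃[ T ] (T ⊑ S × 0 < length T × length T ≤ h × sum T ≡ ε)
  noShortZeroSum? h S with any-⊆? (λ T → (0 <? length T) ×-dec (length T ≤? h) ×-dec (sum T ≟ ε)) S
  ... | yes (T , T⊆S , 0<T , T≤h , e) = inj₂ (T , ⊆⇒⊑ T⊆S , 0<T , T≤h , e)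
  ... | no none = inj₁ λ T T⊑S 0<T T≤h e → let T' , p , T'⊆S = ⊑⇒⊆ T⊑S in
    none (T' , T'⊆S , subst (0 <_) (↭-length p) 0<T , subst (_≤ h) (↭-length p) T≤h , trans (sym (sum-↭ p)) e)

  Fillable : ℕ → List A → Set
  Fillable h U = ∀ l → l ≤ h + length U → ∃[ Z ] (Z ⊑ replicate h ε ++ U × length Z ≡ l × sum Z ≡ ε)

  Fillable-replicate : ∀ {h l} U → l ≤ h → ∃[ Z ] (Z ⊑ replicate h ε ++ U × length Z ≡ l × sum Z ≡ ε)
  Fillable-replicate {h} {l} U l≤h = replicate l ε , ⊑-trans (⊑-replicate l≤h) (⊑-++ˡ _ U) , length-replicate l ,
    trans (sum-replicate l ε) (•-ε l)

  -- Zero-sum pieces of length at most `h` are split off until none is left. Lengths up to `h` are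
  -- filled by copies of `ε` alone; for a larger `l` the newest piece `T` fits as a whole, and the
  -- remaining `l - |T|` terms are filled recursively.
  extract : ∀ h S → ∃[ U ] ∃[ R ] (S ↭ U ++ R × NoShortZeroSum h R × Fillable h U)
  extract h S = go (length S) S ≤-refl
    where
    go : ∀ f S → length S ≤ f → ∃[ U ] ∃[ R ] (S ↭ U ++ R × NoShortZeroSum h R × Fillable h U)
    go f S S≤f with noShortZeroSum? h S
    ... | inj₁ free = [] , S , refl , free , λ l l≤ → Fillable-replicate [] (subst (l ≤_) (+-identityʳ h) l≤)
    go zero [] z≤n | inj₂ (T , T⊑S , 0<T , _) = ⊥-elim (<-irrefl refl (≤-trans 0<T (⊑-length T⊑S)))
    go (suc f) S S≤f | inj₂ (T , (S' , p) , 0<T , T≤h , e)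
      with U , R , q , free , fill ← go f S' (≤-pred (≤-trans (≤-trans (+-monoˡ-≤ (length S') 0<T)
             (≤-reflexive (trans (sym (length-++ T)) (sym (↭-length p))))) S≤f)) =
      T ++ U , R , ↭-trans p (↭-trans (↭-++⁺ˡ T q) (↭-reflexive (sym (++-assoc T U R)))) , free , fill'
      where
      fill' : Fillable h (T ++ U)
      fill' l l≤ with l ≤? h
      ... | yes l≤h = Fillable-replicate (T ++ U) l≤h
      ... | no l≰h with T≤l ← ≤-trans T≤h (<⇒≤ (≰⇒> l≰h))
        with Z , Z⊑ , lZ , eZ ← fill (l ∸ length T) (≤-trans (∸-monoˡ-≤ (length T) l≤)
               (≤-reflexive (trans (cong (λ j → h + j ∸ length T) (trans (length-++ T) (+-comm (length T) _)))
                 (trans (cong (_∸ length T) (sym (+-assoc h _ _))) (m+n∸n≡m _ (length T)))))) =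
        T ++ Z , ⊑-respʳ-↭ (assemble T (replicate h ε) U) (⊑-++⁺ ⊑-refl Z⊑) ,
        trans (length-++ T) (trans (cong (length T +_) lZ) (m+[n∸m]≡n T≤l)) ,
        trans (sum-++ T Z) (trans (cong₂ _∙_ e eZ) (identityʳ ε))
        where
        assemble : (T V U : List A) → T ++ (V ++ U) ↭ V ++ (T ++ U)
        assemble = ++-Solver.solve 3 (λ T V U → T ++-Solver.⊕ (V ++-Solver.⊕ U) ++-Solver.⊜ V ++-Solver.⊕ (T ++-Solver.⊕ U)) refl

  -- The Erdős–Ginzburg–Ziv theorem and its inverse in the kernel

  •-difference : ∀ {i j} x → i ≤ j → i • x ≡ j • x → (j ∸ i) • x ≡ ε
  •-difference {i} {j} x i≤j e = ∙-cancelˡ (i • x) _ _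
    (trans (trans (sym (•-+ i (j ∸ i) x)) (cong (_• x) (m+[n∸m]≡n i≤j))) (trans (sym e) (sym (identityʳ _))))

  ZeroSumFree : List A → Set
  ZeroSumFree S = ∀ T → T ⊑ S → 0 < length T → sum T ≢ ε

  ZeroSumFree-⊑ : ∀ {S T} → T ⊑ S → ZeroSumFree S → ZeroSumFree T
  ZeroSumFree-⊑ T⊑S free U U⊑T = free U (⊑-trans U⊑T T⊑S)

  partialSums : List A → List A
  partialSums [] = ε ∷ []
  partialSums (x ∷ S) = ε ∷ map (x ∙_) (partialSums S)

  length-partialSums : ∀ S → length (partialSums S) ≡ suc (length S)
  length-partialSums [] = refl
  length-partialSums (x ∷ S) = cong suc (trans (length-map (x ∙_) (partialSums S)) (length-partialSums S))

  partialSums-⊑ : ∀ S → All (λ y → ∃[ T ] (T ⊑ S × sum T ≡ y)) (partialSums S)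
  partialSums-⊑ [] = ([] , []⊑ , refl) ∷ []
  partialSums-⊑ (x ∷ S) = ([] , []⊑ , refl) ∷ Allₚ.map⁺ (All.map (λ { (T , (R , p) , refl) → x ∷ T , (R , prep x p) , refl }) (partialSums-⊑ S))

  tailSum-≢ε : ∀ {x S} → ZeroSumFree (x ∷ S) → ∀ {y} → y ∈ partialSums S → x ∙ y ≢ ε
  tailSum-≢ε {x} {S} free y∈ e with T , (R , p) , refl ← All.lookup (partialSums-⊑ S) y∈ =
    free (x ∷ T) (R , prep x p) (s≤s z≤n) e

  -- A coincidence of two initial sums would leave a nonempty block with sum `ε` between them.
  Unique-partialSums : ∀ {S} → ZeroSumFree S → Unique (partialSums S)
  Unique-partialSums {[]} _ = [] ∷ []
  Unique-partialSums {x ∷ S} free = ∉⇒Unique-∷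
    (λ ε∈ → let y , y∈ , e = ∈-map⁻ (x ∙_) ε∈ in tailSum-≢ε free y∈ (sym e))
    (map-∙-Unique x (Unique-partialSums (ZeroSumFree-⊑ (⊑-++ʳ (x ∷ []) S) free)))

  -- The decomposition of a sequence whose most frequent term is `ε`: `h` copies of `ε`, padding `U`
  -- assembled from zero-sum pieces, and a core `R` with multiplicities at most `h`, as `short-sums`
  -- demands.
  record Maximal (S : List A) : Set where
    field
      {h} : ℕ
      {U R} : List A
      split : S ↭ replicate h ε ++ (U ++ R)
      count-R : ∀ x → count x R ≤ h
      noShort : NoShortZeroSum h R
      fill : Fillable h U
      ε∉U : ε ∉ U

    length-split : length S ≡ (h + length U) + length R
    length-split = begin
      length S ≡⟨ ↭-length split ⟩
      length (replicate h ε ++ (U ++ R)) ≡⟨ length-++ (replicate h ε) ⟩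
      length (replicate h ε) + length (U ++ R) ≡⟨ cong₂ _+_ (length-replicate h) (length-++ U) ⟩
      h + (length U + length R) ≡⟨ +-assoc h _ _ ⟨
      (h + length U) + length R ∎
      where open ≡-Reasoning

    R⊑S : R ⊑ S
    R⊑S = ⊑-respʳ-↭ (↭-sym split) (⊑-trans (⊑-++ʳ U R) (⊑-++ʳ (replicate h ε) (U ++ R)))

    pad : ∀ {T} → T ⊑ R → ∀ l → length T ≤ l → l ∸ length T ≤ h + length U →
      ∃[ T' ] (T' ⊑ S × length T' ≡ l × sum T' ≡ sum T)
    pad {T} T⊑R l T≤l d≤ with Z , Z⊑ , lZ , eZ ← fill (l ∸ length T) d≤ = Z ++ T ,
      ⊑-respʳ-↭ (↭-trans (↭-reflexive (++-assoc (replicate h ε) U R)) (↭-sym split)) (⊑-++⁺ Z⊑ T⊑R) ,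
      trans (length-++ Z) (trans (cong (_+ length T) lZ) (m∸n+n≡m T≤l)) ,
      trans (sum-++ Z T) (trans (cong (_∙ sum T) eZ) (identityˡ _))

  maximal : ∀ S → (∀ x → count x S ≤ count ε S) → Maximal S
  maximal S c≤ with T , p , ε∉T ← split-count ε S
    with U , R , q , free , fill ← extract (count ε S) T = record
    { split = p'
    ; count-R = λ x → ≤-trans (count-⊑ x (⊑-respʳ-↭ (↭-sym p') (⊑-trans (⊑-++ʳ U R) (⊑-++ʳ (replicate (count ε S) ε) (U ++ R))))) (c≤ x)
    ; noShort = free
    ; fill = fill
    ; ε∉U = λ ε∈U → ε∉T (∈-resp-↭ (↭-sym q) (∈-++⁺ˡ ε∈U))
    }
    where p' = ↭-trans p (↭-++⁺ˡ (replicate (count ε S) ε) q)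

  count-map-∙ : ∀ z x S → count x S ≡ count (z ∙ x) (map (z ∙_) S)
  count-map-∙ z x [] = refl
  count-map-∙ z x (y ∷ S) with x ≟ y | (z ∙ x) ≟ (z ∙ y)
  ... | yes _ | yes _ = cong suc (count-map-∙ z x S)
  ... | no _ | no _ = count-map-∙ z x S
  ... | yes refl | no ne = ⊥-elim (ne refl)
  ... | no ne | yes e = ⊥-elim (ne (∙-cancelˡ z _ _ e))

  translate-max : ∀ x S → ∃[ z ] (z ∈ x ∷ S × ∀ y → count y (map ((z ⁻¹) ∙_) (x ∷ S)) ≤ count ε (map ((z ⁻¹) ∙_) (x ∷ S)))
  translate-max x S with z , max ← argmax (λ z → count z (x ∷ S)) x S = z , z∈ , λ y → begin
      count y (map ((z ⁻¹) ∙_) (x ∷ S)) ≡⟨ cong (λ w → count w (map ((z ⁻¹) ∙_) (x ∷ S))) (⁻¹-∙-cancelˡ z y) ⟨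
      count ((z ⁻¹) ∙ (z ∙ y)) (map ((z ⁻¹) ∙_) (x ∷ S)) ≡⟨ count-map-∙ (z ⁻¹) (z ∙ y) (x ∷ S) ⟨
      count (z ∙ y) (x ∷ S) ≤⟨ bound (z ∙ y) ⟩
      count z (x ∷ S) ≡⟨ count-map-∙ (z ⁻¹) z (x ∷ S) ⟩
      count ((z ⁻¹) ∙ z) (map ((z ⁻¹) ∙_) (x ∷ S)) ≡⟨ cong (λ w → count w (map ((z ⁻¹) ∙_) (x ∷ S))) (inverseˡ z) ⟩
      count ε (map ((z ⁻¹) ∙_) (x ∷ S)) ∎
    where
    open ≤-Reasoning
    bound : ∀ y → count y (x ∷ S) ≤ count z (x ∷ S)
    bound y with y ∈? (x ∷ S)
    ... | yes y∈ = All.lookup max y∈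
    ... | no y∉ = ≤-trans (≤-reflexive (∉⇒count≡0 {y} {x ∷ S} y∉)) z≤n
    z∈ : z ∈ x ∷ S
    z∈ with z ∈? (x ∷ S)
    ... | yes z∈S = z∈S
    ... | no z∉ = ⊥-elim (<-irrefl refl (≤-trans (∈⇒0<count {x} (here refl)) (≤-trans (bound x) (≤-reflexive (∉⇒count≡0 {z} {x ∷ S} z∉)))))

  -- `K` is a subgroup with at most `n = k + 2` elements, killed by `n`. The offset is chosen so
  -- that `k = n - 2` is the number of pairs that complete a quadruple to `2n` terms.
  module Bounded (k : ℕ) (K : A → Set) (K-ε : K ε) (K-∙ : ∀ {x y} → K x → K y → K (x ∙ y)) (K-⁻¹ : ∀ {x} → K x → K (x ⁻¹))
    (bound : ∀ {S} → Unique S → All K S → length S ≤ suc (suc k))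
    (exponent : ∀ {x} → K x → suc (suc k) • x ≡ ε) where

    n : ℕ
    n = suc (suc k)

    K-sum : ∀ {S} → All K S → K (sum S)
    K-sum [] = K-ε
    K-sum (p ∷ ps) = K-∙ p (K-sum ps)

    K-• : ∀ i {x} → K x → K (i • x)
    K-• zero _ = K-ε
    K-• (suc i) Kx = K-∙ Kx (K-• i Kx)

    HasZeroSum : List A → Set
    HasZeroSum S = ∃[ T ] (T ⊑ S × length T ≡ n × sum T ≡ ε)

    K-ShortSum : ∀ {h S} → All K S → ∀ {x} → ShortSum h S x → K x
    K-ShortSum KS (T , T⊑S , _ , refl) = K-sum (⊑-All T⊑S KS)

    noShort⇒length< : ∀ {h S} → All K S → (∀ x → count x S ≤ h) → NoShortZeroSum h S → length S < n
    noShort⇒length< {h} {S} KS c≤ free with X , uX , _ , lX , sX ← short-sums h S c≤ free =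
      ≤-trans lX (bound uX (All.map (K-ShortSum KS) sX))

    HasZeroSum-translate : ∀ {z S} → K z → HasZeroSum (map (z ∙_) S) → HasZeroSum S
    HasZeroSum-translate {z} Kz (T , (R , p) , lT , eT) with T' , R' , q , refl , _ ← ↭-map-++⁻ (z ∙_) {T = T} p =
      T' , (R' , q) , lT' , (begin
        sum T' ≡⟨ identityˡ _ ⟨
        ε ∙ sum T' ≡⟨ cong (_∙ sum T') (exponent Kz) ⟨
        (n • z) ∙ sum T' ≡⟨ cong (λ l → (l • z) ∙ sum T') lT' ⟨
        (length T' • z) ∙ sum T' ≡⟨ sum-map-∙ z T' ⟨
        sum (map (z ∙_) T') ≡⟨ eT ⟩
        ε ∎)
      where
      open ≡-Reasoning
      lT' = trans (sym (length-map (z ∙_) T')) lT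

    All-K-translate : ∀ {z S} → K z → All K S → All K (map (z ∙_) S)
    All-K-translate Kz KS = Allₚ.map⁺ (All.map (K-∙ Kz) KS)

    module _ {S : List A} (KS : All K S) (M : Maximal S) where

      open Maximal M

      length-R : length R ≤ suc k
      length-R = ≤-pred (noShort⇒length< (⊑-All R⊑S KS) count-R noShort)

      long⇒HasZeroSum : n ≤ h + length U → HasZeroSum S
      long⇒HasZeroSum n≤ = pad []⊑ n z≤n n≤

    -- By `length-R` the core takes at most `n - 1` of the terms, so at least `n` belong to the
    -- copies of `ε` and to `U`, where zero sums of every length up to their number are available.
    erdős-ginzburg-ziv : ∀ S → All K S → n + n ≤ suc (length S) → HasZeroSum S
    erdős-ginzburg-ziv [] _ (s≤s ())
    erdős-ginzburg-ziv (x ∷ S) KS n+n≤ with z , z∈ , max ← translate-max x S =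
      HasZeroSum-translate Kz⁻¹ (long⇒HasZeroSum KS' M (+-cancelʳ-≤ (suc k) n _ (begin
        n + suc k ≤⟨ ≤-pred (≤-trans (≤-reflexive (sym (+-suc n (suc k)))) n+n≤) ⟩
        length (x ∷ S) ≡⟨ length-map ((z ⁻¹) ∙_) (x ∷ S) ⟨
        length (map ((z ⁻¹) ∙_) (x ∷ S)) ≡⟨ M.length-split ⟩
        (M.h + length M.U) + length M.R ≤⟨ +-monoʳ-≤ (M.h + length M.U) (length-R KS' M) ⟩
        (M.h + length M.U) + suc k ∎)))
      where
      open ≤-Reasoning
      Kz⁻¹ = K-⁻¹ (All.lookup KS z∈)
      KS' = All-K-translate Kz⁻¹ KS
      M = maximal _ max
      module M = Maximal M

    Missing : List A → A → Set
    Missing S m = ∀ T → T ⊑ S → length T ≡ k → sum T ≢ m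

    OrderN : A → Set
    OrderN g = ∀ i → 0 < i → i ≤ suc k → i • g ≢ ε

    -- The `n` distinct multiples of `g` leave no room in `K` for a further element.
    multiples-exhaust : ∀ {g} → K g → OrderN g → ∀ {x} → K x → ∃[ i ] (i ≤ suc k × x ≡ i • g)
    multiples-exhaust {g} Kg ord {x} Kx with x ∈? applyUpTo (_• g) n
    ... | yes x∈ with i , i<n , e ← ∈-applyUpTo⁻ (_• g) x∈ = i , ≤-pred i<n , e
    ... | no x∉ = ⊥-elim (<-irrefl refl (≤-trans (s≤s (≤-reflexive (sym (length-applyUpTo (_• g) n))))
        (bound (∉⇒Unique-∷ x∉ (Uniqueₚ.applyUpTo⁺₁ (_• g) n distinct))
          (Kx ∷ All.tabulate λ y∈ → let i , _ , e = ∈-applyUpTo⁻ (_• g) y∈ in subst K (sym e) (K-• i Kg)))))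
      where
      distinct : ∀ {i j} → i < j → j < n → i • g ≢ j • g
      distinct {i} {j} i<j j<n e = ord (j ∸ i) (m<n⇒0<n∸m i<j) (≤-trans (m∸n≤m j i) (≤-pred j<n)) (•-difference g (<⇒≤ i<j) e)

    -- The length `2n - 3` alone does not determine the shape. The missing sum `m₀` compensates: it
    -- is one more element of `K` outside the sums that are counted, which sharpens each bound by
    -- one. This pins down `|R| = k` and `h + |U| = k + 1`, and then makes `R` constant.
    module Critical {S : List A} {m₀ : A} (KS : All K S) (M : Maximal S)
      (length-S : length S ≡ suc (k + k)) (free : ¬ HasZeroSum S) (Km₀ : K m₀) (missing : Missing S m₀) where

      open Maximal M

      KR : All K R
      KR = ⊑-All R⊑S KS

      R≤1+k : length R ≤ suc k
      R≤1+k = ≤-pred (noShort⇒length< KR count-R noShort)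

      h+U≤1+k : h + length U ≤ suc k
      h+U≤1+k = ≮⇒≥ λ n≤ → free (pad []⊑ n z≤n n≤)

      k≤R : k ≤ length R
      k≤R = +-cancelˡ-≤ (suc k) k (length R) (≤-trans (≤-reflexive (trans (sym length-S) length-split)) (+-monoˡ-≤ (length R) h+U≤1+k))

      k≤h+U : k ≤ h + length U
      k≤h+U = +-cancelʳ-≤ (suc k) k (h + length U) (≤-trans (≤-reflexive (trans (+-suc k k) (trans (sym length-S) length-split)))
        (+-monoʳ-≤ (h + length U) R≤1+k))

      missing-R : ∀ {T} → T ⊑ R → length T ≤ k → sum T ≢ m₀
      missing-R {T} T⊑R T≤k e =
        let T' , T'⊑S , lT' , eT' = pad T⊑R k T≤k (≤-trans (m∸n≤m k (length T)) k≤h+U)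
        in missing T' T'⊑S lT' (trans eT' e)

      R≤k : length R ≤ k
      R≤k with h ≤? k
      -- A sum of at most `h ≤ k` terms of `R` can be padded to `k` terms, so `m₀` lies outside the
      -- more than `|R|` short sums.
      ... | yes h≤k = let X , uX , _ , lX , sX = short-sums h R count-R noShort in
        ≤-pred (≤-trans lX (≤-pred (bound {m₀ ∷ X}
          (∉⇒Unique-∷ (λ m₀∈X → let T , T⊑R , T≤h , e = All.lookup sX m₀∈X in missing-R T⊑R (≤-trans T≤h h≤k) e) uX)
          (Km₀ ∷ All.map (K-ShortSum KR) sX))))
      -- Here the copies of `ε` alone make up `k + 1` of the `2k + 1` terms.
      ... | no h≰k = +-cancelˡ-≤ (suc k) (length R) k (≤-trans (+-monoˡ-≤ (length R) (≤-trans (≰⇒> h≰k) (m≤m+n h _)))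
        (≤-reflexive (trans (sym length-split) length-S)))

      R≡k : length R ≡ k
      R≡k = ≤-antisym R≤k k≤R

      h+U≡1+k : h + length U ≡ suc k
      h+U≡1+k = +-cancelʳ-≡ k (h + length U) (suc k) (trans (cong (h + length U +_) (sym R≡k)) (trans (sym length-split) length-S))

      -- A nonempty `T` needs at most `n - 1` terms of padding to reach length `n`, and `n - 1` is
      -- the size `h + |U|` of the padding available.
      R-free : ZeroSumFree R
      R-free T T⊑R 0<T e = let T≤R = ⊑-length T⊑R
                               T' , T'⊑S , lT' , eT' = pad T⊑R n (≤-trans T≤R (≤-trans R≤k (≤-trans (n≤1+n k) (n≤1+n (suc k)))))
                                 (≤-trans (∸-monoʳ-≤ n 0<T) (≤-reflexive (sym h+U≡1+k)))
                           in free (T' , T'⊑S , lT' , trans eT' e)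

      -- For distinct `a` and `b`, the `k + 1` initial sums of `R` read in the order `a`, `b`, ...
      -- do not contain `b`, and none of these elements is `m₀`. That would be `k + 3` elements of
      -- `K`.
      R-constant : ∀ {a b R'} → R ↭ a ∷ b ∷ R' → b ≡ a
      R-constant {a} {b} {R'} p = decidable-stable (b ≟ a) λ b≢a →
        <-irrefl refl (≤-trans (s≤s (s≤s (s≤s (≤-reflexive (trans (sym R≡k) (↭-length p))))))
          (≤-trans (s≤s (s≤s (≤-reflexive (sym (length-partialSums (a ∷ b ∷ R')))))) (bound {m₀ ∷ b ∷ partialSums (a ∷ b ∷ R')}
            (∉⇒Unique-∷ m₀∉ (∉⇒Unique-∷ (b∉ b≢a) (Unique-partialSums free')))
            (Km₀ ∷ Kb ∷ All.map (λ { (T , T⊑ , refl) → K-sum (⊑-All (toR T⊑) KR) }) (partialSums-⊑ (a ∷ b ∷ R'))))))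
        where
        toR : ∀ {T} → T ⊑ a ∷ b ∷ R' → T ⊑ R
        toR = ⊑-respʳ-↭ (↭-sym p)
        free' = ZeroSumFree-⊑ (toR ⊑-refl) R-free
        b⊑ : b ∷ [] ⊑ a ∷ b ∷ R'
        b⊑ = a ∷ R' , swap a b refl
        Kb = All.head (⊑-All (toR b⊑) KR)
        m₀∉ : m₀ ∉ b ∷ partialSums (a ∷ b ∷ R')
        m₀∉ (here refl) = missing-R (toR b⊑) (≤-trans (⊑-length (toR b⊑)) R≤k) (identityʳ b)
        m₀∉ (there m₀∈) with T , T⊑ , e ← All.lookup (partialSums-⊑ (a ∷ b ∷ R')) m₀∈ =
          missing-R (toR T⊑) (≤-trans (⊑-length (toR T⊑)) R≤k) e
        b∉ : b ≢ a → b ∉ partialSums (a ∷ b ∷ R')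
        b∉ _ (here refl) = free' (b ∷ []) b⊑ (s≤s z≤n) (identityʳ b)
        b∉ b≢a (there b∈) with ∈-map⁻ (a ∙_) b∈
        ... | _ , here refl , e = b≢a (trans e (identityʳ a))
        ... | y , there y∈ , e with s , s∈ , refl ← ∈-map⁻ (b ∙_) y∈
          with T , (R'' , q) , refl ← All.lookup (partialSums-⊑ R') s∈ =
          free' (a ∷ T) (b ∷ R'' , prep a (↭-trans (prep b q) (↭-sym (shift b T R'')))) (s≤s z≤n)
            (∙-cancelˡ b _ _ (trans (solve 3 (λ a b s → b ⊕ (a ⊕ s) ⊜ a ⊕ (b ⊕ s)) refl a b (sum T)) (trans (sym e) (sym (identityʳ b)))))
          where open ∙-Solver using (solve; _⊕_; _⊜_)

      head-R : ∃[ g ] (K g × All (_≡ g) R × OrderN g × k ≤ h)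
      head-R = go R R≡k R-constant R-free KR count-R
        where
        go : ∀ R → length R ≡ k → (∀ {a b R'} → R ↭ a ∷ b ∷ R' → b ≡ a) → ZeroSumFree R → All K R → (∀ x → count x R ≤ h) →
          ∃[ g ] (K g × All (_≡ g) R × OrderN g × k ≤ h)
        -- For `n = 2` the core is empty and provides no `g`. The empty sum is a sum of `k = 0`
        -- terms, so `m₀` is not `ε` and its inverse can serve.
        go [] 0≡k _ _ _ _ = m₀ ⁻¹ , K-⁻¹ Km₀ , [] , ord , ≤-trans (≤-reflexive (sym 0≡k)) z≤n
          where
          ord : OrderN (m₀ ⁻¹)
          ord 1 _ _ e = missing [] []⊑ 0≡k (trans (sym (⁻¹-involutive ε)) (trans
            (cong _⁻¹ (trans (trans (sym (identityʳ (ε ⁻¹))) (trans (inverseˡ ε) (sym e))) (identityʳ (m₀ ⁻¹)))) (⁻¹-involutive m₀)))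
          ord (suc (suc i)) _ i≤ _ = <-irrefl refl (≤-trans (s≤s (s≤s z≤n)) (≤-trans i≤ (≤-reflexive (cong suc (sym 0≡k)))))
        go (g ∷ R') R≡k const free' (Kg ∷ _) c≤ = g , Kg , allg , ord , ≤-trans (≤-reflexive (trans (sym R≡k)
             (trans (sym (count-replicate _ g)) (cong (count g) (sym eqR))))) (c≤ g)
          where
          allg : All (_≡ g) (g ∷ R')
          allg = refl ∷ All.tabulate λ b∈ → let R'' , p = ∈⇒↭ b∈ in const (prep g p)
          eqR : g ∷ R' ≡ replicate (length (g ∷ R')) g
          eqR = All≡⇒replicate _ allg
          ord : OrderN g
          ord i 0<i i≤ e with m≤n⇒m<n∨m≡n i≤
          ... | inj₁ i<1+k = free' (replicate i g)
                  (⊑-respʳ-↭ (↭-reflexive (sym eqR)) (⊑-replicate (≤-trans (≤-pred i<1+k) (≤-reflexive (sym R≡k)))))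
                  (≤-trans 0<i (≤-reflexive (sym (length-replicate i)))) (trans (sum-replicate i g) e)
          -- From `(n - 1) • g = ε` and `n • g = ε` it follows that `g = ε`, a zero-sum subsequence
          -- of length one.
          ... | inj₂ refl = free' (g ∷ []) (R' , refl) (s≤s z≤n) (trans (cong (g ∙_) (sym e)) (exponent Kg))

      -- The alternative `h = k` leaves a single term in `U`. Filling the whole length `h + 1` uses
      -- this term, so it would have to be `ε`, which `ε∉U` forbids.
      h≡1+k : k ≤ h → h ≡ suc k
      h≡1+k k≤h with m≤n⇒m<n∨m≡n k≤h
      ... | inj₁ k<h = ≤-antisym (≤-trans (m≤m+n h _) h+U≤1+k) k<h
      ... | inj₂ k≡h = ⊥-elim (go U (+-cancelˡ-≡ k (length U) 1 (trans (cong (_+ length U) k≡h) (trans h+U≡1+k (+-comm 1 k)))) fill ε∉U)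
        where
        go : ∀ U → length U ≡ 1 → Fillable h U → ε ∉ U → ⊥
        go (u ∷ []) refl fill' ε∉ =
          let Z , Z⊑ , lZ , eZ = fill' (h + 1) ≤-refl
              p = ⊑-full Z⊑ (≤-reflexive (trans (trans (length-++ (replicate h ε)) (cong (_+ 1) (length-replicate h))) (sym lZ)))
          in ε∉ (here (begin
            ε ≡⟨ eZ ⟨
            sum Z ≡⟨ sum-↭ p ⟨
            sum (replicate h ε ++ u ∷ []) ≡⟨ sum-++ (replicate h ε) _ ⟩
            sum (replicate h ε) ∙ (u ∙ ε) ≡⟨ cong₂ _∙_ (trans (sum-replicate h ε) (•-ε h)) (identityʳ u) ⟩
            ε ∙ u ≡⟨ identityˡ u ⟩
            u ∎))
          where open ≡-Reasoning

      shape : ∃[ g ] (K g × S ↭ replicate (suc k) ε ++ replicate k g × OrderN g)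
      shape =
        let g , Kg , allg , ord , k≤h = head-R
            h≡ = h≡1+k k≤h
            U≡[] = length≡0 U (+-cancelˡ-≡ (suc k) (length U) 0
              (trans (cong (_+ length U) (sym h≡)) (trans h+U≡1+k (sym (+-identityʳ (suc k))))))
        in g , Kg ,
           ↭-trans split (↭-reflexive (cong₂ _++_ (cong (λ i → replicate i ε) h≡)
             (trans (cong (_++ R) U≡[]) (trans (All≡⇒replicate R allg) (cong (λ i → replicate i g) R≡k))))) , ord
        where
        length≡0 : ∀ U → length U ≡ 0 → U ≡ []
        length≡0 [] _ = refl

    -- The elements `i • g` with `i ≤ k` are sums of `k` terms, so among the `n` multiples of `g`
    -- only `(k + 1) • g`, the inverse of `g`, can be missing.
    Missing-shape : ∀ {S g m} → K g → OrderN g → S ↭ replicate (suc k) ε ++ replicate k g → K m → Missing S m → m ∙ g ≡ ε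
    Missing-shape {S} {g} {m} Kg ord p Km missing with multiples-exhaust Kg ord Km
    ... | i , i≤ , e with m≤n⇒m<n∨m≡n i≤
    ... | inj₂ refl = trans (cong (_∙ g) e) (trans (comm _ g) (exponent Kg))
    ... | inj₁ i<1+k = ⊥-elim (missing (replicate (k ∸ i) ε ++ replicate i g)
              (⊑-respʳ-↭ (↭-sym p) (⊑-++⁺ (⊑-replicate (≤-trans (m∸n≤m k i) (n≤1+n k))) (⊑-replicate i≤k)))
              (trans (length-++ (replicate (k ∸ i) ε)) (trans (cong₂ _+_ (length-replicate (k ∸ i)) (length-replicate i)) (m∸n+n≡m i≤k)))
              (trans (sum-++ (replicate (k ∸ i) ε) _) (trans (cong₂ _∙_ (trans (sum-replicate (k ∸ i) ε) (•-ε (k ∸ i))) (sum-replicate i g))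
                (trans (identityˡ _) (sym e)))))
      where i≤k = ≤-pred i<1+k

    -- The second value is stored as a difference `g`, because the order of `g` is what makes its
    -- multiples exhaust `K`. The field `missing⇒` is the source of the forced sums of quadruples.
    record TwoValued (S : List A) (j : ℕ) : Set where
      field
        {x g} : A
        Kx : K x
        Kg : K g
        order : OrderN g
        split : S ↭ replicate (suc k) x ++ replicate j (x ∙ g)
        missing⇒ : ∀ {m} → K m → Missing S m → m ∙ (x ∙ (x ∙ g)) ≡ ε

    map-translate-cancel : ∀ z S → map (z ∙_) (map ((z ⁻¹) ∙_) S) ≡ S
    map-translate-cancel z [] = refl
    map-translate-cancel z (x ∷ S) = cong₂ _∷_ (∙-⁻¹-cancelˡ z x) (map-translate-cancel z S)

    Missing-translate : ∀ {S m} z → Missing S m → Missing (map (z ∙_) S) ((k • z) ∙ m)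
    Missing-translate {S} {m} z missing T (R , p) lT e with T' , R' , q , refl , _ ← ↭-map-++⁻ (z ∙_) {T = T} p =
      missing T' (R' , q) lT' (∙-cancelˡ (k • z) _ _ (trans (cong (λ l → (l • z) ∙ sum T') (sym lT')) (trans (sym (sum-map-∙ z T')) e)))
      where lT' = trans (sym (length-map (z ∙_) T')) lT

    inverse-2n∸3 : ∀ S m₀ → All K S → length S ≡ suc (k + k) → ¬ HasZeroSum S → K m₀ → Missing S m₀ → TwoValued S k
    inverse-2n∸3 (x ∷ S) m₀ KS length-S free Km₀ missing
      = let
        z , z∈ , max = translate-max x S
        Kz = All.lookup KS z∈
        g , Kg , p , ord = Critical.shape (All-K-translate (K-⁻¹ Kz) KS) (maximal _ max) (trans (length-map ((z ⁻¹) ∙_) (x ∷ S)) length-S)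
             (free ∘ HasZeroSum-translate (K-⁻¹ Kz)) (K-∙ (K-• k (K-⁻¹ Kz)) Km₀) (Missing-translate (z ⁻¹) missing)
        in record
      { x = z ; g = g ; Kx = Kz ; Kg = Kg ; order = ord
      ; split = ↭-trans (↭-reflexive (sym (map-translate-cancel z (x ∷ S)))) (↭-trans (↭-map⁺ (z ∙_) p) (↭-reflexive
          (trans (map-++ (z ∙_) (replicate (suc k) ε) _) (cong₂ _++_
            (trans (map-replicate (z ∙_) (suc k) ε) (cong (replicate (suc k)) (identityʳ z))) (map-replicate (z ∙_) k g)))))
      -- Undoing the translation of `k` terms costs `k • z`; with the two copies of `z` in
      -- `z ∙ (z ∙ g)` this adds up to `n • z = ε`.
      ; missing⇒ = λ {m} Km missing-m → begin
          m ∙ (z ∙ (z ∙ g)) ≡⟨ solve 3 (λ m z g → m ⊕ (z ⊕ (z ⊕ g)) ⊜ (m ⊕ g) ⊕ (z ⊕ (z ⊕ id′))) refl m z g ⟩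
          (m ∙ g) ∙ (2 • z) ≡⟨ identityˡ _ ⟨
          ε ∙ ((m ∙ g) ∙ (2 • z)) ≡⟨ cong (_∙ ((m ∙ g) ∙ (2 • z))) (trans (sym (•-∙ k (z ⁻¹) z)) (trans (cong (k •_) (inverseˡ z)) (•-ε k))) ⟨
          ((k • (z ⁻¹)) ∙ (k • z)) ∙ ((m ∙ g) ∙ (2 • z)) ≡⟨ solve 5 (λ a b m g c → (a ⊕ b) ⊕ ((m ⊕ g) ⊕ c) ⊜ ((a ⊕ m) ⊕ g) ⊕ (b ⊕ c)) refl _ _ m g _ ⟩
          (((k • (z ⁻¹)) ∙ m) ∙ g) ∙ ((k • z) ∙ (2 • z)) ≡⟨ cong₂ _∙_ (Missing-shape Kg ord p (K-∙ (K-• k (K-⁻¹ Kz)) Km) (Missing-translate (z ⁻¹) missing-m))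
                                                                  (trans (sym (•-+ k 2 z)) (trans (cong (_• z) (+-comm k 2)) (exponent Kz))) ⟩
          ε ∙ ε ≡⟨ identityʳ ε ⟩
          ε ∎
      }
      where
      open ≡-Reasoning
      open ∙-Solver using (solve; _⊕_; _⊜_) renaming (id to id′)

    -- A sum of k terms equal to σ(p ∷ S) would leave p together with k + 1 terms of sum zero.
    sum-missing : ∀ p S → length S ≡ suc (k + k) → ¬ HasZeroSum (p ∷ S) → Missing S (p ∙ sum S)
    sum-missing p S length-S free T (R , q) lT e = free (p ∷ R , (T , prep p (↭-trans q (++-comm T R))) ,
      cong suc (+-cancelˡ-≡ k (length R) (suc k) (trans (cong (_+ length R) (sym lT)) (trans (sym (length-++ T))
        (trans (sym (↭-length q)) (trans length-S (sym (+-suc k k))))))) ,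
      ∙-cancelˡ (sum T) _ _ (trans (trans (solve 3 (λ t p r → t ⊕ (p ⊕ r) ⊜ p ⊕ (t ⊕ r)) refl (sum T) p (sum R))
        (trans (cong (p ∙_) (trans (sym (sum-++ T R)) (sym (sum-↭ q)))) (sym e))) (sym (identityʳ _))))
      where open ∙-Solver using (solve; _⊕_; _⊜_)

    -- Dropping `p` leaves `2n - 3` terms, for which `sum-missing` supplies the missing sum. With
    -- `k + 1` terms `x` and `k` terms `y` in `S`, the identity `p + σ(S) + x + y = 0` reduces to
    -- `p = y` by `n x = n y = 0`.
    inverse-EGZ : ∀ p S → All K (p ∷ S) → length S ≡ suc (k + k) → ¬ HasZeroSum (p ∷ S) →
      ∃[ V ] p ≡ TwoValued.x {S} {k} V ∙ TwoValued.g V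
    inverse-EGZ p S (Kp ∷ KS) length-S free
      = let V = inverse-2n∸3 S (p ∙ sum S) KS length-S
                 (λ (T , T⊑ , lT , eT) → free (T , ⊑-trans T⊑ (⊑-++ʳ (p ∷ []) S) , lT , eT)) (K-∙ Kp (K-sum KS)) (sum-missing p S length-S free)
        in V , (begin
          p ≡⟨ identityʳ p ⟨
          p ∙ ε ≡⟨ cong (p ∙_) (trans (cong₂ _∙_ (exponent (Kx V)) (exponent (Ky V))) (identityʳ ε)) ⟨
          p ∙ ((n • x V) ∙ (n • y V)) ≡⟨ solve 5 (λ p x X y Y → p ⊕ ((x ⊕ X) ⊕ (y ⊕ (y ⊕ Y))) ⊜ ((p ⊕ (X ⊕ Y)) ⊕ (x ⊕ y)) ⊕ y) refl p (x V) (suc k • x V) (y V) (k • y V) ⟩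
          ((p ∙ ((suc k • x V) ∙ (k • y V))) ∙ (x V ∙ y V)) ∙ y V ≡⟨ cong (λ s → ((p ∙ s) ∙ (x V ∙ y V)) ∙ y V) (sum-S V) ⟨
          ((p ∙ sum S) ∙ (x V ∙ y V)) ∙ y V ≡⟨ cong (_∙ y V) (missing⇒ V (K-∙ Kp (K-sum KS)) (sum-missing p S length-S free)) ⟩
          ε ∙ y V ≡⟨ identityˡ _ ⟩
          y V ∎)
      where
      open ≡-Reasoning
      open ∙-Solver using (solve; _⊕_; _⊜_)
      open TwoValued
      y : TwoValued S k → A
      y V = x V ∙ g V
      Ky : ∀ V → K (y V)
      Ky V = K-∙ (Kx V) (Kg V)
      sum-S : ∀ V → sum S ≡ (suc k • x V) ∙ (k • y V)
      sum-S V = trans (sum-↭ (split V)) (trans (sum-++ (replicate (suc k) (x V)) _) (cong₂ _∙_ (sum-replicate (suc k) (x V)) (sum-replicate k (y V))))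

  -- a, pᵢ, qᵢ stand for the points of F₂³ other than one point v; the seven quadruples are the affine planes missing v.
  seven-points : ∀ {a p₁ q₁ p₂ q₂ p₃ q₃ Q} →
    sum (p₁ ∷ q₁ ∷ p₂ ∷ q₂ ∷ []) ≡ Q → sum (p₁ ∷ q₁ ∷ p₃ ∷ q₃ ∷ []) ≡ Q → sum (p₂ ∷ q₂ ∷ p₃ ∷ q₃ ∷ []) ≡ Q →
    sum (a ∷ p₁ ∷ p₂ ∷ p₃ ∷ []) ≡ Q → sum (a ∷ p₁ ∷ q₂ ∷ q₃ ∷ []) ≡ Q →
    sum (a ∷ q₁ ∷ p₂ ∷ q₃ ∷ []) ≡ Q → sum (a ∷ q₁ ∷ q₂ ∷ p₃ ∷ []) ≡ Q →
    a ∙ a ≡ p₁ ∙ p₁ × Q ≡ (p₁ ∙ p₁) ∙ (p₁ ∙ p₁)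
  seven-points {a} {p₁} {q₁} {p₂} {q₂} {p₃} {q₃} {Q} e₁₂ e₁₃ e₂₃ a₀ a₁ a₂ a₃ = a²≡p₁² , Q≡p₁⁴
    where
    open ∙-Solver using (solve; _⊕_; _⊜_) renaming (id to id′)
    open ≡-Reasoning
    p₂p₃≡q₂q₃ : p₂ ∙ p₃ ≡ q₂ ∙ q₃
    p₂p₃≡q₂q₃ = ∙-cancelˡ (a ∙ p₁) _ _ (begin
      (a ∙ p₁) ∙ (p₂ ∙ p₃) ≡⟨ regroup a p₁ p₂ p₃ ⟩
      sum (a ∷ p₁ ∷ p₂ ∷ p₃ ∷ []) ≡⟨ trans a₀ (sym a₁) ⟩
      sum (a ∷ p₁ ∷ q₂ ∷ q₃ ∷ []) ≡⟨ regroup a p₁ q₂ q₃ ⟨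
      (a ∙ p₁) ∙ (q₂ ∙ q₃) ∎)
      where
      regroup : ∀ a b c d → (a ∙ b) ∙ (c ∙ d) ≡ sum (a ∷ b ∷ c ∷ d ∷ [])
      regroup = solve 4 (λ a b c d → (a ⊕ b) ⊕ (c ⊕ d) ⊜ a ⊕ (b ⊕ (c ⊕ (d ⊕ id′)))) refl
    p₁p₃≡q₁q₃ : p₁ ∙ p₃ ≡ q₁ ∙ q₃
    p₁p₃≡q₁q₃ = ∙-cancelˡ (a ∙ p₂) _ _ (begin
      (a ∙ p₂) ∙ (p₁ ∙ p₃) ≡⟨ solve 4 (λ a b c d → (a ⊕ b) ⊕ (c ⊕ d) ⊜ a ⊕ (c ⊕ (b ⊕ (d ⊕ id′)))) refl a p₂ p₁ p₃ ⟩
      sum (a ∷ p₁ ∷ p₂ ∷ p₃ ∷ []) ≡⟨ trans a₀ (sym a₂) ⟩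
      sum (a ∷ q₁ ∷ p₂ ∷ q₃ ∷ []) ≡⟨ solve 4 (λ a b c d → (a ⊕ b) ⊕ (c ⊕ d) ⊜ a ⊕ (c ⊕ (b ⊕ (d ⊕ id′)))) refl a p₂ q₁ q₃ ⟨
      (a ∙ p₂) ∙ (q₁ ∙ q₃) ∎)
    p₁p₂≡q₁q₂ : p₁ ∙ p₂ ≡ q₁ ∙ q₂
    p₁p₂≡q₁q₂ = ∙-cancelˡ (a ∙ p₃) _ _ (begin
      (a ∙ p₃) ∙ (p₁ ∙ p₂) ≡⟨ solve 4 (λ a b c d → (a ⊕ b) ⊕ (c ⊕ d) ⊜ a ⊕ (c ⊕ (d ⊕ (b ⊕ id′)))) refl a p₃ p₁ p₂ ⟩
      sum (a ∷ p₁ ∷ p₂ ∷ p₃ ∷ []) ≡⟨ trans a₀ (sym a₃) ⟩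
      sum (a ∷ q₁ ∷ q₂ ∷ p₃ ∷ []) ≡⟨ solve 4 (λ a b c d → (a ⊕ b) ⊕ (c ⊕ d) ⊜ a ⊕ (c ⊕ (d ⊕ (b ⊕ id′)))) refl a p₃ q₁ q₂ ⟨
      (a ∙ p₃) ∙ (q₁ ∙ q₂) ∎)
    square : ∀ {a b c d} → a ∙ b ≡ c ∙ d → sum (a ∷ c ∷ b ∷ d ∷ []) ≡ Q → (a ∙ a) ∙ (b ∙ b) ≡ Q
    square {a} {b} {c} {d} e q = begin
      (a ∙ a) ∙ (b ∙ b) ≡⟨ ∙-interchange a a b b ⟩
      (a ∙ b) ∙ (a ∙ b) ≡⟨ cong ((a ∙ b) ∙_) e ⟩
      (a ∙ b) ∙ (c ∙ d) ≡⟨ solve 4 (λ a b c d → (a ⊕ b) ⊕ (c ⊕ d) ⊜ a ⊕ (c ⊕ (b ⊕ (d ⊕ id′)))) refl a b c d ⟩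
      sum (a ∷ c ∷ b ∷ d ∷ []) ≡⟨ q ⟩
      Q ∎
    s₂₃ = square p₂p₃≡q₂q₃ e₂₃
    s₁₃ = square p₁p₃≡q₁q₃ e₁₃
    s₁₂ = square p₁p₂≡q₁q₂ e₁₂
    p₁²≡p₂² : p₁ ∙ p₁ ≡ p₂ ∙ p₂
    p₁²≡p₂² = ∙-cancelʳ (p₃ ∙ p₃) _ _ (trans s₁₃ (sym s₂₃))
    Q≡p₁⁴ : Q ≡ (p₁ ∙ p₁) ∙ (p₁ ∙ p₁)
    Q≡p₁⁴ = trans (sym s₁₂) (cong ((p₁ ∙ p₁) ∙_) (sym p₁²≡p₂²))
    -- Doubling the plane `a, p₁, p₂, p₃` gives `2Q`. Cancelling `2p₂ + 2p₃ = Q` leaves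
    -- `2a + 2p₁ = Q = 4p₁`.
    a²≡p₁² : a ∙ a ≡ p₁ ∙ p₁
    a²≡p₁² = ∙-cancelʳ (p₁ ∙ p₁) _ _ (∙-cancelʳ Q _ _ (begin
      ((a ∙ a) ∙ (p₁ ∙ p₁)) ∙ Q ≡⟨ cong (((a ∙ a) ∙ (p₁ ∙ p₁)) ∙_) (sym s₂₃) ⟩
      ((a ∙ a) ∙ (p₁ ∙ p₁)) ∙ ((p₂ ∙ p₂) ∙ (p₃ ∙ p₃)) ≡⟨ solve 4 (λ a b c d → ((a ⊕ a) ⊕ (b ⊕ b)) ⊕ ((c ⊕ c) ⊕ (d ⊕ d)) ⊜
                                                                (a ⊕ (b ⊕ (c ⊕ (d ⊕ id′)))) ⊕ (a ⊕ (b ⊕ (c ⊕ (d ⊕ id′))))) refl a p₁ p₂ p₃ ⟩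
      sum (a ∷ p₁ ∷ p₂ ∷ p₃ ∷ []) ∙ sum (a ∷ p₁ ∷ p₂ ∷ p₃ ∷ []) ≡⟨ cong₂ _∙_ (trans a₀ Q≡p₁⁴) a₀ ⟩
      ((p₁ ∙ p₁) ∙ (p₁ ∙ p₁)) ∙ Q ∎))

  -- Sequences of pairs and their pair sums.

  flat : List (A × A) → List A
  flat [] = []
  flat ((a , b) ∷ P) = a ∷ b ∷ flat P

  pairSum : A × A → A
  pairSum (a , b) = a ∙ b

  flat-↭ : ∀ {P P'} → P ↭ P' → flat P ↭ flat P'
  flat-↭ refl = refl
  flat-↭ (prep (a , b) p) = prep a (prep b (flat-↭ p))
  flat-↭ (swap (a , b) (c , d) p) = ↭-trans (↭-++⁺ʳ _ (++-comm (a ∷ b ∷ []) (c ∷ d ∷ []))) (↭-++⁺ˡ (c ∷ d ∷ a ∷ b ∷ []) (flat-↭ p))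
  flat-↭ (↭-trans p p') = ↭-trans (flat-↭ p) (flat-↭ p')

  flat-++ : ∀ P P' → flat (P ++ P') ≡ flat P ++ flat P'
  flat-++ [] P' = refl
  flat-++ ((a , b) ∷ P) P' = cong (λ T → a ∷ b ∷ T) (flat-++ P P')

  flat-⊑ : ∀ {P P'} → P ⊑ P' → flat P ⊑ flat P'
  flat-⊑ {P} (R , p) = flat R , ↭-trans (flat-↭ p) (↭-reflexive (flat-++ P R))

  length-flat : ∀ P → length (flat P) ≡ length P + length P
  length-flat [] = refl
  length-flat (_ ∷ P) = cong suc (trans (cong suc (length-flat P)) (sym (+-suc (length P) (length P))))

  sum-flat : ∀ P → sum (flat P) ≡ sum (map pairSum P)
  sum-flat [] = refl
  sum-flat ((a , b) ∷ P) = trans (sym (assoc a b _)) (cong ((a ∙ b) ∙_) (sum-flat P))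

  -- The listed sequences have no zero-sum subsequence of length 2n

  module Converse (n : ℕ) {f₁ f₂ f₃ : A}
    (independent : ∀ a b c → ((a • f₁) ∙ (b • f₂)) ∙ (c • f₃) ≡ ε → a • f₁ ≡ ε × b • f₂ ≡ ε × c • f₃ ≡ ε)
    (f₁²≡ε : f₁ ∙ f₁ ≡ ε) (f₁≢ε : f₁ ≢ ε) (f₂²≡ε : f₂ ∙ f₂ ≡ ε) (f₂≢ε : f₂ ≢ ε)
    (order : ∀ m → 0 < m → m • f₃ ≡ ε → n + n ≤ m) where

    -- Coefficients are natural numbers and not residues: the `f₃`-coordinate then adds up without
    -- wrapping round and can be compared with the length `n + n`.
    Coordinates : A → ℕ → ℕ → ℕ → Set
    Coordinates x a b c = x ≡ ((a • f₁) ∙ (b • f₂)) ∙ (c • f₃)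

    coordinates-∙ : ∀ {x y a b c a′ b′ c′} → Coordinates x a b c → Coordinates y a′ b′ c′ → Coordinates (x ∙ y) (a + a′) (b + b′) (c + c′)
    coordinates-∙ {a = a} {b} {c} {a′} {b′} {c′} refl refl = begin
      (((a • f₁) ∙ (b • f₂)) ∙ (c • f₃)) ∙ (((a′ • f₁) ∙ (b′ • f₂)) ∙ (c′ • f₃))
        ≡⟨ ∙-interchange ((a • f₁) ∙ (b • f₂)) (c • f₃) ((a′ • f₁) ∙ (b′ • f₂)) (c′ • f₃) ⟩
      (((a • f₁) ∙ (b • f₂)) ∙ ((a′ • f₁) ∙ (b′ • f₂))) ∙ ((c • f₃) ∙ (c′ • f₃))
        ≡⟨ cong₂ _∙_ (trans (∙-interchange (a • f₁) (b • f₂) (a′ • f₁) (b′ • f₂)) (cong₂ _∙_ (sym (•-+ a a′ f₁)) (sym (•-+ b b′ f₂)))) (sym (•-+ c c′ f₃)) ⟩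
      (((a + a′) • f₁) ∙ ((b + b′) • f₂)) ∙ ((c + c′) • f₃) ∎
      where open ≡-Reasoning

    coordinates-ε : Coordinates ε 0 0 0
    coordinates-ε = sym (trans (identityʳ _) (identityʳ ε))

    coordinates₁ : ∀ j → Coordinates (j • f₁) j 0 0
    coordinates₁ j = sym (trans (identityʳ _) (identityʳ (j • f₁)))

    coordinates₂ : ∀ j → Coordinates (j • f₂) 0 j 0
    coordinates₂ j = sym (trans (identityʳ _) (identityˡ (j • f₂)))

    coordinates₃ : ∀ j → Coordinates (j • f₃) 0 0 j
    coordinates₃ j = sym (trans (cong (_∙ (j • f₃)) (identityʳ ε)) (identityˡ (j • f₃)))

    coordinates-f₁ : Coordinates f₁ 1 0 0
    coordinates-f₁ = trans (sym (identityʳ f₁)) (coordinates₁ 1)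

    coordinates-f₂ : Coordinates f₂ 0 1 0
    coordinates-f₂ = trans (sym (identityʳ f₂)) (coordinates₂ 1)

    coordinates-ε-replicate : ∀ j → Coordinates (sum (replicate j ε)) 0 0 0
    coordinates-ε-replicate j = trans (trans (sum-replicate j ε) (•-ε j)) coordinates-ε

    coordinates-++ : ∀ S T {a b c a′ b′ c′} → Coordinates (sum S) a b c → Coordinates (sum T) a′ b′ c′ →
      Coordinates (sum (S ++ T)) (a + a′) (b + b′) (c + c′)
    coordinates-++ S T {a} {b} {c} {a′} {b′} {c′} p q =
      trans (sum-++ S T) (coordinates-∙ {sum S} {sum T} {a} {b} {c} {a′} {b′} {c′} p q)

    multiple-even : ∀ {f} → f ∙ f ≡ ε → f ≢ ε → ∀ c → c • f ≡ ε → parity c ≡ false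
    multiple-even f² f≢ε 0 _ = refl
    multiple-even {f} f² f≢ε 1 e = ⊥-elim (f≢ε (trans (sym (identityʳ f)) e))
    multiple-even {f} f² f≢ε (suc (suc c)) e = trans (Boolₚ.not-involutive (parity c)) (multiple-even f² f≢ε c
      (trans (sym (identityˡ (c • f))) (trans (cong (_∙ (c • f)) (sym f²)) (trans (assoc f f (c • f)) e))))

    vanishing : ∀ {x a b c} → Coordinates x a b c → x ≡ ε → parity a ≡ false × parity b ≡ false × (c ≡ 0 ⊎ n + n ≤ c)
    vanishing {a = a} {b} {c} p e =
      let e₁ , e₂ , e₃ = independent a b c (trans (sym p) e)
      in multiple-even f₁²≡ε f₁≢ε a e₁ , multiple-even f₂²≡ε f₂≢ε b e₂ , multiple c e₃
      where
      multiple : ∀ c → c • f₃ ≡ ε → c ≡ 0 ⊎ n + n ≤ c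
      multiple zero _ = inj₁ refl
      multiple (suc c) e = inj₂ (order (suc c) (s≤s z≤n) e)

    data TailPair (x y : A) : List A → Set where
      none : TailPair x y []
      first : TailPair x y (x ∷ [])
      second : TailPair x y (y ∷ [])
      both : TailPair x y (x ∷ y ∷ [])

    tailPair : ∀ {x y U} → U ⊆ x ∷ y ∷ [] → TailPair x y U
    tailPair (_ ∷ʳ _ ∷ʳ []) = none
    tailPair (_ ∷ʳ (refl ∷ [])) = second
    tailPair (refl ∷ (_ ∷ʳ [])) = first
    tailPair (refl ∷ (refl ∷ [])) = both

    Avoids : List A → Set
    Avoids S = ∀ T → T ⊆ S → length T ≡ n + n → sum T ≢ ε

    multiple-plus : ∀ {x r} j a b → x ≡ j • f₃ → Coordinates r a b 0 → Coordinates (x ∙ r) a b j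
    multiple-plus j a b refl refl = trans (comm (j • f₃) _) (cong (_∙ (j • f₃)) (identityʳ ((a • f₁) ∙ (b • f₂))))

    pair-coordinates : ∀ {x y r s} a b → x ∙ y ≡ f₃ → Coordinates (r ∙ s) a b 0 → Coordinates ((x ∙ r) ∙ (y ∙ s)) a b 1
    pair-coordinates {x} {y} {r} {s} a b e p = trans (∙-interchange x r y s) (multiple-plus 1 a b (trans e (sym (identityʳ f₃))) p)

    coordinates₂₃ : ∀ j → Coordinates (j • (f₃ ∙ f₂)) 0 j j
    coordinates₂₃ j = trans (•-∙ j f₃ f₂) (trans (comm (j • f₃) (j • f₂)) (cong (_∙ (j • f₃)) (sym (identityˡ (j • f₂)))))

    coordinates-replicate : ∀ j {x} a b c → Coordinates (j • x) a b c → Coordinates (sum (replicate j x)) a b c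
    coordinates-replicate j {x} a b c p = trans (sum-replicate j x) p

    length-++-replicate : ∀ j {x : A} T → length (replicate j x ++ T) ≡ j + length T
    length-++-replicate j {x} T = trans (length-++ (replicate j x)) (cong (_+ length T) (length-replicate j))

    module _ {z z′ : A} {a c : ℕ} (cz : Coordinates z 1 0 a) (cz′ : Coordinates z′ 1 1 c) (czz′ : Coordinates (z ∙ z′) 2 1 1) where

      list₁ : ℕ → ℕ → ℕ → ℕ → List A
      list₁ α γ δ β = replicate (suc (α + α)) ε ++ replicate (suc (γ + γ)) f₂ ++
        replicate (suc (δ + δ)) f₃ ++ replicate (suc (β + β)) (f₃ ∙ f₂) ++ z ∷ z′ ∷ []

      sub₁ : ℕ → ℕ → ℕ → ℕ → List A → List A
      sub₁ t₁ t₂ t₃ t₄ U = replicate t₁ ε ++ replicate t₂ f₂ ++ replicate t₃ f₃ ++ replicate t₄ (f₃ ∙ f₂) ++ U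

      length-sub₁ : ∀ t₁ t₂ t₃ t₄ U → length (sub₁ t₁ t₂ t₃ t₄ U) ≡ t₁ + (t₂ + (t₃ + (t₄ + length U)))
      length-sub₁ t₁ t₂ t₃ t₄ U = trans (length-++-replicate t₁ _) (cong (t₁ +_) (trans (length-++-replicate t₂ _) (cong (t₂ +_)
        (trans (length-++-replicate t₃ _) (cong (t₃ +_) (length-++-replicate t₄ U))))))

      coordinates-sub₁ : ∀ t₁ t₂ t₃ t₄ U a b c → Coordinates (sum U) a b c → Coordinates (sum (sub₁ t₁ t₂ t₃ t₄ U)) a (t₂ + (t₄ + b)) (t₃ + (t₄ + c))
      coordinates-sub₁ t₁ t₂ t₃ t₄ U a b c p =
        coordinates-++ (replicate t₁ ε) _ {0} {0} {0} {a} {t₂ + (t₄ + b)} {t₃ + (t₄ + c)} (coordinates-ε-replicate t₁)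
          (coordinates-++ (replicate t₂ f₂) _ {0} {t₂} {0} {a} {t₄ + b} {t₃ + (t₄ + c)} (coordinates-replicate t₂ 0 t₂ 0 (coordinates₂ t₂))
            (coordinates-++ (replicate t₃ f₃) _ {0} {0} {t₃} {a} {t₄ + b} {t₄ + c} (coordinates-replicate t₃ 0 0 t₃ (coordinates₃ t₃))
              (coordinates-++ (replicate t₄ (f₃ ∙ f₂)) U {0} {t₄} {t₄} {a} {b} {c} (coordinates-replicate t₄ 0 t₄ t₄ (coordinates₂₃ t₄)) p)))

      module _ {α β γ δ : ℕ} (αγ : suc (α + α) + suc (γ + γ) ≡ n + n) (δβ : suc (δ + δ) + suc (β + β) ≡ n + n) where

        -- Exactly one of `z`, `z′` makes the `f₁`-coordinate odd. With neither, the `f₃`-coordinate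
        -- `t₃ + t₄` is `0` or `2n`; so the first two blocks or the last two are used up, and an odd
        -- multiplicity makes the `f₂`-coordinate odd. With both, the `f₃`-coordinate `t₃ + t₄ + 1`
        -- lies strictly between `0` and `2n`.
        sub₁-nonzero : ∀ t₁ t₂ t₃ t₄ {U} → t₁ ≤ suc (α + α) → t₂ ≤ suc (γ + γ) → t₃ ≤ suc (δ + δ) → t₄ ≤ suc (β + β) →
          TailPair z z′ U → t₁ + (t₂ + (t₃ + (t₄ + length U))) ≡ n + n → sum (sub₁ t₁ t₂ t₃ t₄ U) ≢ ε
        sub₁-nonzero t₁ t₂ t₃ t₄ t₁≤ t₂≤ t₃≤ t₄≤ none total e
          with vanishing {a = 0} {t₂ + (t₄ + 0)} {t₃ + (t₄ + 0)} (coordinates-sub₁ t₁ t₂ t₃ t₄ [] 0 0 0 coordinates-ε) e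
        ... | _ , even , inj₁ c≡0 = true≢false (begin
            true ≡⟨ parity-suc-double γ ⟨
            parity (suc (γ + γ)) ≡⟨ cong parity (saturated t₁≤ t₂≤ (≤-reflexive (trans αγ (trans (sym total)
                                             (cong (t₁ +_) (trans (cong (t₂ +_) c≡0) (+-identityʳ t₂))))))) ⟨
            parity t₂ ≡⟨ cong parity (trans (cong (t₂ +_) (m+n≡0⇒n≡0 t₃ c≡0)) (+-identityʳ t₂)) ⟨
            parity (t₂ + (t₄ + 0)) ≡⟨ even ⟩
            false ∎)
          where
          open ≡-Reasoning
          true≢false : true ≢ false
          true≢false ()
        ... | _ , even , inj₂ 2n≤ = true≢false (begin
            true ≡⟨ parity-suc-double β ⟨
            parity (suc (β + β)) ≡⟨ cong parity (saturated t₃≤ t₄≤ (≤-trans (≤-reflexive δβ) (≤-trans 2n≤ (≤-reflexive (cong (t₃ +_) (+-identityʳ t₄)))))) ⟨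
            parity t₄ ≡⟨ cong parity (trans (cong (_+ (t₄ + 0)) t₂≡0) (+-identityʳ t₄)) ⟨
            parity (t₂ + (t₄ + 0)) ≡⟨ even ⟩
            false ∎)
          where
          open ≡-Reasoning
          true≢false : true ≢ false
          true≢false ()
          t₂≡0 : t₂ ≡ 0
          t₂≡0 = n≤0⇒n≡0 (+-cancelʳ-≤ (t₃ + (t₄ + 0)) t₂ 0 (≤-trans (m≤n+m _ t₁) (≤-trans (≤-reflexive total) 2n≤)))
        sub₁-nonzero t₁ t₂ t₃ t₄ _ _ _ _ first _ e
          with () ← proj₁ (vanishing {a = 1} {t₂ + (t₄ + 0)} {t₃ + (t₄ + a)} (coordinates-sub₁ t₁ t₂ t₃ t₄ (z ∷ []) 1 0 a (trans (identityʳ z) cz)) e)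
        sub₁-nonzero t₁ t₂ t₃ t₄ _ _ _ _ second _ e
          with () ← proj₁ (vanishing {a = 1} {t₂ + (t₄ + 1)} {t₃ + (t₄ + c)} (coordinates-sub₁ t₁ t₂ t₃ t₄ (z′ ∷ []) 1 1 c (trans (identityʳ z′) cz′)) e)
        sub₁-nonzero t₁ t₂ t₃ t₄ _ _ _ _ both total e
          with vanishing {a = 2} {t₂ + (t₄ + 1)} {t₃ + (t₄ + 1)} (coordinates-sub₁ t₁ t₂ t₃ t₄ (z ∷ z′ ∷ []) 2 1 1 (trans (cong (z ∙_) (identityʳ z′)) czz′)) e
        ... | _ , _ , inj₁ c≡0 with () ← m+n≡0⇒n≡0 t₄ (m+n≡0⇒n≡0 t₃ c≡0)
        ... | _ , _ , inj₂ 2n≤ with s≤s () ← +-cancelˡ-≤ t₄ 2 1 (+-cancelˡ-≤ t₃ (t₄ + 2) (t₄ + 1)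
              (≤-trans (≤-trans (m≤n+m _ t₂) (m≤n+m _ t₁)) (≤-trans (≤-reflexive total) 2n≤)))

        avoids₁ : Avoids (list₁ α γ δ β)
        avoids₁ T T⊆ lT eT
          with T₁ , _ , refl , s₁ , r₁ ← ⊆-++⁻ (replicate (suc (α + α)) ε) _ T⊆
          with T₂ , _ , refl , s₂ , r₂ ← ⊆-++⁻ (replicate (suc (γ + γ)) f₂) _ r₁
          with T₃ , _ , refl , s₃ , r₃ ← ⊆-++⁻ (replicate (suc (δ + δ)) f₃) _ r₂
          with T₄ , U , refl , s₄ , r₄ ← ⊆-++⁻ (replicate (suc (β + β)) (f₃ ∙ f₂)) _ r₃
          with t₁ , t₁≤ , refl ← ⊆-replicate⁻ (suc (α + α)) s₁
          with t₂ , t₂≤ , refl ← ⊆-replicate⁻ (suc (γ + γ)) s₂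
          with t₃ , t₃≤ , refl ← ⊆-replicate⁻ (suc (δ + δ)) s₃
          with t₄ , t₄≤ , refl ← ⊆-replicate⁻ (suc (β + β)) s₄ =
          sub₁-nonzero t₁ t₂ t₃ t₄ t₁≤ t₂≤ t₃≤ t₄≤ (tailPair r₄) (trans (sym (length-sub₁ t₁ t₂ t₃ t₄ U)) lT) eT

    module _ {z₂ z₂′ z₁ z₁′ : A} {a₂ c₂ a₁ c₁ : ℕ}
      (cz₂ : Coordinates z₂ 0 1 a₂) (cz₂′ : Coordinates z₂′ 0 1 c₂) (czz₂ : Coordinates (z₂ ∙ z₂′) 0 2 1)
      (cz₁ : Coordinates z₁ 1 0 a₁) (cz₁′ : Coordinates z₁′ 1 0 c₁) (czz₁ : Coordinates (z₁ ∙ z₁′) 2 0 1) where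

      sub₂ : ℕ → ℕ → List A → List A → List A
      sub₂ t₁ t₃ U₂ U₁ = replicate t₁ ε ++ replicate t₃ f₃ ++ U₂ ++ U₁

      length-sub₂ : ∀ t₁ t₃ U₂ U₁ → length (sub₂ t₁ t₃ U₂ U₁) ≡ t₁ + (t₃ + (length U₂ + length U₁))
      length-sub₂ t₁ t₃ U₂ U₁ = trans (length-++-replicate t₁ _) (cong (t₁ +_) (trans (length-++-replicate t₃ _) (cong (t₃ +_) (length-++ U₂))))

      -- A whole pair {z, z′} contributes f₃ to the sum but 2 to the length.
      pair₂-coordinates : ∀ {U} → TailPair z₂ z₂′ U → ∃[ b ] ∃[ c ] (Coordinates (sum U) 0 b c × (parity b ≡ false → length U ≡ c + c))
      pair₂-coordinates none = 0 , 0 , coordinates-ε , λ _ → refl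
      pair₂-coordinates first = 1 , a₂ , trans (identityʳ z₂) cz₂ , λ ()
      pair₂-coordinates second = 1 , c₂ , trans (identityʳ z₂′) cz₂′ , λ ()
      pair₂-coordinates both = 2 , 1 , trans (cong (z₂ ∙_) (identityʳ z₂′)) czz₂ , λ _ → refl

      pair₁-coordinates : ∀ {U} → TailPair z₁ z₁′ U → ∃[ b ] ∃[ c ] (Coordinates (sum U) b 0 c × (parity b ≡ false → length U ≡ c + c))
      pair₁-coordinates none = 0 , 0 , coordinates-ε , λ _ → refl
      pair₁-coordinates first = 1 , a₁ , trans (identityʳ z₁) cz₁ , λ ()
      pair₁-coordinates second = 1 , c₁ , trans (identityʳ z₁′) cz₁′ , λ ()
      pair₁-coordinates both = 2 , 1 , trans (cong (z₁ ∙_) (identityʳ z₁′)) czz₁ , λ _ → refl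

      -- Here `d` counts the whole pairs used. The `f₃`-coordinate `0` would require `2n` copies of
      -- `ε`; a coordinate of at least `2n` would force `d = 0` and `2n` copies of `f₃`. Fewer are
      -- present.
      length-contradiction : ∀ {t₁ t₃ d} → t₁ < n + n → t₃ < n + n → t₁ + (t₃ + (d + d)) ≡ n + n → ¬ (t₃ + d ≡ 0 ⊎ n + n ≤ t₃ + d)
      length-contradiction {t₁} {t₃} {d} t₁< _ total (inj₁ c≡0)
        with refl ← m+n≡0⇒m≡0 t₃ c≡0 | refl ← m+n≡0⇒n≡0 t₃ c≡0 = <-irrefl (trans (sym (+-identityʳ t₁)) total) t₁<
      length-contradiction {t₁} {t₃} {d} _ t₃< total (inj₂ 2n≤) = <-irrefl refl (begin-strict
        t₃ <⟨ t₃< ⟩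
        n + n ≤⟨ 2n≤ ⟩
        t₃ + d ≡⟨ cong (t₃ +_) d≡0 ⟩
        t₃ + 0 ≡⟨ +-identityʳ t₃ ⟩
        t₃ ∎)
        where
        open ≤-Reasoning
        d≡0 : d ≡ 0
        d≡0 = n≤0⇒n≡0 (+-cancelʳ-≤ d d 0 (+-cancelˡ-≤ t₃ (d + d) d (≤-trans (m≤n+m (t₃ + (d + d)) t₁) (≤-trans (≤-reflexive total) 2n≤))))

      avoids₂ : ∀ M → suc M ≡ n + n → Avoids (replicate M ε ++ replicate M f₃ ++ z₂ ∷ z₂′ ∷ z₁ ∷ z₁′ ∷ [])
      avoids₂ M M< T T⊆ lT eT
        with T₁ , _ , refl , s₁ , r₁ ← ⊆-++⁻ (replicate M ε) _ T⊆
        with T₃ , _ , refl , s₃ , r₃ ← ⊆-++⁻ (replicate M f₃) _ r₁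
        with U₂ , U₁ , refl , u₂ , u₁ ← ⊆-++⁻ (z₂ ∷ z₂′ ∷ []) _ r₃
        with t₁ , t₁≤ , refl ← ⊆-replicate⁻ M s₁
        with t₃ , t₃≤ , refl ← ⊆-replicate⁻ M s₃ =
        let b₂ , d₂ , p₂ , v₂ = pair₂-coordinates (tailPair u₂)
            b₁ , d₁ , p₁ , v₁ = pair₁-coordinates (tailPair u₁)
            even₁ , even₂ , c = vanishing {a = b₁} {b₂ + 0} {t₃ + (d₂ + d₁)}
              (coordinates-++ (replicate t₁ ε) _ {0} {0} {0} {b₁} {b₂ + 0} {t₃ + (d₂ + d₁)} (coordinates-ε-replicate t₁)
                (coordinates-++ (replicate t₃ f₃) _ {0} {0} {t₃} {b₁} {b₂ + 0} {d₂ + d₁} (coordinates-replicate t₃ 0 0 t₃ (coordinates₃ t₃))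
                  (coordinates-++ U₂ U₁ {0} {b₂} {d₂} {b₁} {0} {d₁} p₂ p₁))) eT
            total = trans (sym (length-sub₂ t₁ t₃ U₂ U₁)) lT
        in length-contradiction {t₁} {t₃} {d₂ + d₁} (≤-trans (s≤s t₁≤) (≤-reflexive M<)) (≤-trans (s≤s t₃≤) (≤-reflexive M<))
             (trans (cong (λ l → t₁ + (t₃ + l)) (trans (interchange d₂ d₁) (sym (cong₂ _+_
               (v₂ (trans (cong parity (sym (+-identityʳ b₂))) even₂)) (v₁ even₁))))) total) c
        where
        interchange : ∀ i j → (i + j) + (i + j) ≡ (i + i) + (j + j)
        interchange = solve 2 (λ i j → (i :+ j) :+ (i :+ j) := (i :+ i) :+ (j :+ j)) refl
          where open +-*-Solver

    ⊆-map⁻ : ∀ (f : A → A) S {T} → T ⊆ map f S → ∃[ T′ ] (T′ ⊆ S × T ≡ map f T′)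
    ⊆-map⁻ f [] [] = [] , [] , refl
    ⊆-map⁻ f (x ∷ S) (_ ∷ʳ s) with T′ , s′ , refl ← ⊆-map⁻ f S s = T′ , x ∷ʳ s′ , refl
    ⊆-map⁻ f (x ∷ S) (refl ∷ s) with T′ , s′ , refl ← ⊆-map⁻ f S s = x ∷ T′ , refl ∷ s′ , refl

    coordinates-sum : ∀ d → All (λ x → ∃[ a ] ∃[ b ] Coordinates x a b 0) d → ∃[ a ] ∃[ b ] Coordinates (sum d) a b 0
    coordinates-sum [] _ = 0 , 0 , coordinates-ε
    coordinates-sum (x ∷ d) ((a , b , p) ∷ ps) = let a′ , b′ , q = coordinates-sum d ps in
      a + a′ , b + b′ , coordinates-∙ {x} {sum d} {a} {b} {0} {a′} {b′} {0} p q

    module _ {α β γ : ℕ} {d : List A} (αβγ : suc ((α + β) + γ) ≡ n) (length-d : length d ≡ suc (n + n))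
      (d∈ : All (λ x → ∃[ a ] ∃[ b ] Coordinates x a b 0) d) (σ∉ : sum d ∉ d) (2nf₃≡ε : (n + n) • f₃ ≡ ε) where

      -- The `f₃`-coordinate is `|D|`. If it is `0`, then `t₁`, `t₂`, `t₃` are even and stay below
      -- their odd bounds, which allows at most `2n - 2` terms. If it is `2n`, then `D` omits a
      -- single term `w` of `d` and has sum `ε`, so `sum d = w` would lie in `d`.
      sub₃-nonzero : ∀ t₁ t₂ t₃ D → t₁ ≤ suc (α + α) → t₂ ≤ suc (β + β) → t₃ ≤ suc (γ + γ) → D ⊆ d →
        t₁ + (t₂ + (t₃ + length D)) ≡ n + n → sum (replicate t₁ ε ++ replicate t₂ f₁ ++ replicate t₃ f₂ ++ map (f₃ ∙_) D) ≢ ε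
      sub₃-nonzero t₁ t₂ t₃ D t₁≤ t₂≤ t₃≤ D⊆d total e = cases D refl (proj₂ (proj₂ vanish))
        where
        D-coordinates = coordinates-sum D (All-resp-⊆ D⊆d d∈)
        x = proj₁ D-coordinates
        y = proj₁ (proj₂ D-coordinates)
        vanish : parity (t₂ + x) ≡ false × parity (t₃ + y) ≡ false × (length D ≡ 0 ⊎ n + n ≤ length D)
        vanish = subst (λ c → parity (t₂ + x) ≡ false × parity (t₃ + y) ≡ false × (c ≡ 0 ⊎ n + n ≤ c)) (+-identityʳ (length D))
          (vanishing {a = t₂ + x} {t₃ + y} {length D + 0}
            (coordinates-++ (replicate t₁ ε) _ {0} {0} {0} {t₂ + x} {t₃ + y} {length D + 0} (coordinates-ε-replicate t₁)
              (coordinates-++ (replicate t₂ f₁) _ {t₂} {0} {0} {x} {t₃ + y} {length D + 0} (coordinates-replicate t₂ t₂ 0 0 (coordinates₁ t₂))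
                (coordinates-++ (replicate t₃ f₂) _ {0} {t₃} {0} {x} {y} {length D + 0} (coordinates-replicate t₃ 0 t₃ 0 (coordinates₂ t₃))
                  (trans (sum-map-∙ f₃ D) (coordinates-∙ {length D • f₃} {sum D} {0} {0} {length D} {x} {y} {0}
                    (coordinates₃ (length D)) (proj₂ (proj₂ D-coordinates))))))) e)
        cases : ∀ D′ → D′ ≡ D → length D ≡ 0 ⊎ n + n ≤ length D → ⊥
        cases D′ D≡ (inj₂ 2n≤) = σ∉ (subst (_∈ d) (sym sum-d) w∈d)
          where
          rest-zero : t₁ + (t₂ + t₃) ≡ 0
          rest-zero = n≤0⇒n≡0 (+-cancelʳ-≤ (length D) (t₁ + (t₂ + t₃)) 0 (≤-trans (≤-reflexive (trans
            (trans (+-assoc t₁ (t₂ + t₃) (length D)) (cong (t₁ +_) (+-assoc t₂ t₃ (length D)))) total)) 2n≤))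
          t₁≡0 = m+n≡0⇒m≡0 t₁ rest-zero
          t₂≡0 = m+n≡0⇒m≡0 t₂ (m+n≡0⇒n≡0 t₁ rest-zero)
          t₃≡0 = m+n≡0⇒n≡0 t₂ (m+n≡0⇒n≡0 t₁ rest-zero)
          lD : length D ≡ n + n
          lD = trans (sym (cong₂ _+_ t₁≡0 (cong₂ _+_ t₂≡0 (cong (_+ length D) t₃≡0)))) total
          sum-D : sum D ≡ ε
          sum-D = begin
            sum D ≡⟨ identityˡ (sum D) ⟨
            ε ∙ sum D ≡⟨ cong (_∙ sum D) 2nf₃≡ε ⟨
            ((n + n) • f₃) ∙ sum D ≡⟨ cong (λ l → (l • f₃) ∙ sum D) lD ⟨
            (length D • f₃) ∙ sum D ≡⟨ sum-map-∙ f₃ D ⟨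
            sum (map (f₃ ∙_) D) ≡⟨ cong sum (cong₂ (λ i T → replicate i ε ++ T) t₁≡0 (cong₂ (λ i T → replicate i f₁ ++ T) t₂≡0
                                                   (cong (λ i → replicate i f₂ ++ map (f₃ ∙_) D) t₃≡0))) ⟨
            sum (replicate t₁ ε ++ replicate t₂ f₁ ++ replicate t₃ f₂ ++ map (f₃ ∙_) D) ≡⟨ e ⟩
            ε ∎
            where open ≡-Reasoning
          leftover : ∃[ w ] d ↭ D ++ w ∷ []
          leftover = one (⊆⇒⊑ D⊆d)
            where
            one : D ⊑ d → ∃[ w ] d ↭ D ++ w ∷ []
            one (R , p) = single R p (+-cancelˡ-≡ (n + n) (length R) 1 (trans (cong (_+ length R) (sym lD)) (trans (sym (length-++ D))
                (trans (sym (↭-length p)) (trans length-d (+-comm 1 (n + n)))))))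
              where
              single : ∀ R → d ↭ D ++ R → length R ≡ 1 → ∃[ w ] d ↭ D ++ w ∷ []
              single (w ∷ []) p refl = w , p
          w = proj₁ leftover
          w∈d : w ∈ d
          w∈d = ∈-resp-↭ (↭-sym (proj₂ leftover)) (∈-++⁺ʳ D (here refl))
          sum-d : sum d ≡ w
          sum-d = trans (sum-↭ (proj₂ leftover)) (trans (sum-++ D (w ∷ [])) (trans (cong₂ _∙_ sum-D (identityʳ w)) (identityˡ w)))
        cases (_ ∷ _) refl (inj₁ ())
        cases [] refl (inj₁ _) = <-irrefl refl (begin-strict
          n + n ≡⟨ total ⟨
          t₁ + (t₂ + (t₃ + 0)) ≤⟨ +-mono-≤ (even≤odd⇒≤ t₁ α even₁ t₁≤) (+-mono-≤ (even≤odd⇒≤ t₂ β even₂ t₂≤)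
                                                                 (+-monoˡ-≤ 0 (even≤odd⇒≤ t₃ γ even₃ t₃≤))) ⟩
          (α + α) + ((β + β) + ((γ + γ) + 0)) ≡⟨ solve 3 (λ α β γ → (α :+ α) :+ ((β :+ β) :+ ((γ :+ γ) :+ con 0)) :=
                                                                 ((α :+ β) :+ γ) :+ ((α :+ β) :+ γ)) refl α β γ ⟩
          ((α + β) + γ) + ((α + β) + γ) <⟨ +-mono-< (≤-reflexive αβγ) (≤-reflexive αβγ) ⟩
          n + n ∎)
          where
          open ≤-Reasoning
          open +-*-Solver
          even₂ : parity t₂ ≡ false
          even₂ = trans (cong parity (sym (+-identityʳ t₂))) (proj₁ vanish)
          even₃ : parity t₃ ≡ false
          even₃ = trans (cong parity (sym (+-identityʳ t₃))) (proj₁ (proj₂ vanish))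
          even₁ : parity t₁ ≡ false
          even₁ = trans (parity-+-even t₁ (t₂ + (t₃ + 0)) (trans (cong parity total) (parity-double n)))
            (trans (parity-+ t₂ (t₃ + 0)) (cong₂ _xor_ even₂ (trans (cong parity (+-identityʳ t₃)) even₃)))

      avoids₃ : Avoids (replicate (suc (α + α)) ε ++ replicate (suc (β + β)) f₁ ++ replicate (suc (γ + γ)) f₂ ++ map (f₃ ∙_) d)
      avoids₃ T T⊆ lT eT
        with T₁ , _ , refl , s₁ , r₁ ← ⊆-++⁻ (replicate (suc (α + α)) ε) _ T⊆
        with T₂ , _ , refl , s₂ , r₂ ← ⊆-++⁻ (replicate (suc (β + β)) f₁) _ r₁
        with T₃ , U , refl , s₃ , r₃ ← ⊆-++⁻ (replicate (suc (γ + γ)) f₂) _ r₂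
        with t₁ , t₁≤ , refl ← ⊆-replicate⁻ (suc (α + α)) s₁
        with t₂ , t₂≤ , refl ← ⊆-replicate⁻ (suc (β + β)) s₂
        with t₃ , t₃≤ , refl ← ⊆-replicate⁻ (suc (γ + γ)) s₃
        with D , D⊆d , refl ← ⊆-map⁻ (f₃ ∙_) d r₃ =
        sub₃-nonzero t₁ t₂ t₃ D t₁≤ t₂≤ t₃≤ D⊆d (trans (sym (trans (length-++-replicate t₁ _) (cong (t₁ +_)
          (trans (length-++-replicate t₂ _) (cong (t₂ +_) (trans (length-++-replicate t₃ _) (cong (t₃ +_) (length-map (f₃ ∙_) D)))))))) lT) eT

  -- Pairs of equal class and the leftover elements

  module Classes (k : ℕ) (cl : A → V) (cl-∙ : ∀ x y → cl (x ∙ y) ≡ cl x ⊞ cl y)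
    (bound : ∀ {S} → Unique S → All (λ x → cl x ≡ 0V) S → length S ≤ suc (suc k))
    (exponent : ∀ {x} → cl x ≡ 0V → suc (suc k) • x ≡ ε) where

    cl-ε : cl ε ≡ 0V
    cl-ε = V.identityˡ-unique (cl ε) (cl ε) (trans (sym (cl-∙ ε ε)) (cong cl (identityˡ ε)))

    cl-⁻¹ : ∀ x → cl (x ⁻¹) ≡ cl x
    cl-⁻¹ x = V.inverseˡ-unique (cl (x ⁻¹)) (cl x) (trans (sym (cl-∙ (x ⁻¹) x)) (trans (cong cl (inverseˡ x)) cl-ε))

    K : A → Set
    K x = cl x ≡ 0V

    K-∙ : ∀ {x y} → K x → K y → K (x ∙ y)
    K-∙ {x} {y} Kx Ky = trans (cl-∙ x y) (cong₂ _⊞_ Kx Ky)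

    open Bounded k K cl-ε K-∙ (λ {x} Kx → trans (cl-⁻¹ x) Kx) bound exponent public

    cl-sum : ∀ {X Y} → map cl X ≡ Y → cl (sum X) ≡ V.sum Y
    cl-sum {[]} refl = cl-ε
    cl-sum {x ∷ X} refl = trans (cl-∙ x (sum X)) (cong (cl x ⊞_) (cl-sum {X} refl))

    SameClass : A × A → Set
    SameClass (a , b) = cl a ≡ cl b

    -- Each new term is matched with a leftover of its class if there is one, so no class keeps two
    -- leftovers.
    pairUp : ∀ S → ∃[ P ] ∃[ L ] (S ↭ flat P ++ L × All SameClass P × Unique (map cl L))
    pairUp [] = [] , [] , refl , [] , []
    pairUp (x ∷ S) with P , L , p , sc , u ← pairUp S with cl x V.∈? map cl L
    ... | no x∉ = P , x ∷ L , ↭-trans (prep x p) (↭-sym (shift x (flat P) L)) , sc , ∉⇒Unique-∷ x∉ u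
    ... | yes x∈ with y , y∈L , e ← ∈-map⁻ cl x∈ with L' , q ← ∈⇒↭ y∈L =
      (x , y) ∷ P , L' , prep x (↭-trans p (↭-trans (↭-++⁺ˡ (flat P) q) (shift y (flat P) L'))) , e ∷ sc ,
      drop-head (Unique-resp-↭ (↭-map⁺ cl q) u)
      where
      drop-head : ∀ {X : List V} {v} → Unique (v ∷ X) → Unique X
      drop-head (_ ∷ u) = u

    Free : List A → Set
    Free S = ∀ T → T ⊑ S → length T ≡ n + n → sum T ≢ ε

    K-pairs : ∀ {P} → All SameClass P → All K (map pairSum P)
    K-pairs sc = Allₚ.map⁺ (All.map (λ { {a , b} e → trans (cl-∙ a b) (trans (cong (_⊞ cl b) e) (⊞-self (cl b))) }) sc)

    module _ {S : List A} (free : Free S) {P : List (A × A)} {L : List A} (split : S ↭ flat P ++ L) where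

      pairs-free : ¬ HasZeroSum (map pairSum P)
      pairs-free (T , (R , p) , lT , eT) =
        let P₁ , P₂ , q , eP₁ , _ = ↭-map-++⁻ pairSum {T = T} p
            lP₁ = trans (sym (length-map pairSum P₁)) (trans (cong length eP₁) lT)
        in free (flat P₁) (⊑-respʳ-↭ (↭-sym split) (⊑-trans (flat-⊑ (P₂ , q)) (⊑-++ˡ (flat P) L)))
             (trans (length-flat P₁) (cong₂ _+_ lP₁ lP₁))
             (trans (sum-flat P₁) (trans (cong sum eP₁) eT))

      -- The flattened `k` pairs and the quadruple together have `2k + 4 = 2n` terms.
      quad-missing : ∀ {X} → X ⊑ L → length X ≡ 4 → Missing (map pairSum P) (sum X ⁻¹)
      quad-missing {X} X⊑L lX T (R , p) lT eT =
        let P₁ , P₂ , q , eP₁ , _ = ↭-map-++⁻ pairSum {T = T} p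
            lP₁ = trans (sym (length-map pairSum P₁)) (trans (cong length eP₁) lT)
        in free (flat P₁ ++ X) (⊑-respʳ-↭ (↭-sym split) (⊑-++⁺ (flat-⊑ (P₂ , q)) X⊑L))
             (trans (length-++ (flat P₁)) (trans (cong₂ _+_ (trans (length-flat P₁) (cong₂ _+_ lP₁ lP₁)) lX)
               (solve 1 (λ k → (k :+ k) :+ con 4 := (con 2 :+ k) :+ (con 2 :+ k)) refl k)))
             (trans (sum-++ (flat P₁) X) (trans (cong (_∙ sum X) (trans (sum-flat P₁) (trans (cong sum eP₁) eT))) (inverseˡ (sum X))))
        where open +-*-Solver

      quad-sum : ∀ {j} (W : TwoValued (map pairSum P) j) {X} → X ⊑ L → length X ≡ 4 → K (sum X) →
        sum X ≡ TwoValued.x W ∙ (TwoValued.x W ∙ TwoValued.g W)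
      quad-sum W {X} X⊑L lX KX = ∙-cancelˡ (sum X ⁻¹) _ _ (trans (inverseˡ (sum X))
        (sym (TwoValued.missing⇒ W (trans (cl-⁻¹ (sum X)) KX) (quad-missing X⊑L lX))))

    -- For independent `w`, `s`, `t` the classes left out are `u` and `u ⊞ w`. The quadruples
    -- `quad₁₂`, `quad₁₃`, `quad₂₃` are the planes avoiding both; the other four pass through `u`
    -- and avoid `u ⊞ w`.
    record Hexad (u w s t : V) (p₁ q₁ p₂ q₂ p₃ q₃ : A) : Set where
      field
        cl-p₁ : cl p₁ ≡ u ⊞ s
        cl-q₁ : cl q₁ ≡ u ⊞ (w ⊞ s)
        cl-p₂ : cl p₂ ≡ u ⊞ t
        cl-q₂ : cl q₂ ≡ u ⊞ (w ⊞ t)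
        cl-p₃ : cl p₃ ≡ u ⊞ (s ⊞ t)
        cl-q₃ : cl q₃ ≡ u ⊞ (w ⊞ (s ⊞ t))

      private
        cl-quad : ∀ {a b c d a' b' c' d'} → cl a ≡ a' → cl b ≡ b' → cl c ≡ c' → cl d ≡ d' →
          cl (sum (a ∷ b ∷ c ∷ d ∷ [])) ≡ V.sum (a' ∷ b' ∷ c' ∷ d' ∷ [])
        cl-quad {a} {b} {c} {d} refl refl refl refl = cl-sum {a ∷ b ∷ c ∷ d ∷ []} refl

        open V.∙-Solver using (solve; _⊕_; _⊜_) renaming (id to id′)

      -- The solver handles commutative monoids only, so here and below the sum of classes is
      -- regrouped as `v ⊞ v` for a suitable `v`, which `⊞-self` cancels.
      quad₁₂ : K (sum (p₁ ∷ q₁ ∷ p₂ ∷ q₂ ∷ []))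
      quad₁₂ = trans (cl-quad cl-p₁ cl-q₁ cl-p₂ cl-q₂) (trans
        (solve 4 (λ u w s t → (u ⊕ s) ⊕ ((u ⊕ (w ⊕ s)) ⊕ ((u ⊕ t) ⊕ ((u ⊕ (w ⊕ t)) ⊕ id′))) ⊜
          ((u ⊕ u) ⊕ (w ⊕ (s ⊕ t))) ⊕ ((u ⊕ u) ⊕ (w ⊕ (s ⊕ t)))) refl u w s t) (⊞-self ((u ⊞ u) ⊞ (w ⊞ (s ⊞ t)))))

      quad₁₃ : K (sum (p₁ ∷ q₁ ∷ p₃ ∷ q₃ ∷ []))
      quad₁₃ = trans (cl-quad cl-p₁ cl-q₁ cl-p₃ cl-q₃) (trans
        (solve 4 (λ u w s t → (u ⊕ s) ⊕ ((u ⊕ (w ⊕ s)) ⊕ ((u ⊕ (s ⊕ t)) ⊕ ((u ⊕ (w ⊕ (s ⊕ t))) ⊕ id′))) ⊜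
          ((u ⊕ u) ⊕ (w ⊕ (s ⊕ (s ⊕ t)))) ⊕ ((u ⊕ u) ⊕ (w ⊕ (s ⊕ (s ⊕ t))))) refl u w s t) (⊞-self ((u ⊞ u) ⊞ (w ⊞ (s ⊞ (s ⊞ t))))))

      quad₂₃ : K (sum (p₂ ∷ q₂ ∷ p₃ ∷ q₃ ∷ []))
      quad₂₃ = trans (cl-quad cl-p₂ cl-q₂ cl-p₃ cl-q₃) (trans
        (solve 4 (λ u w s t → (u ⊕ t) ⊕ ((u ⊕ (w ⊕ t)) ⊕ ((u ⊕ (s ⊕ t)) ⊕ ((u ⊕ (w ⊕ (s ⊕ t))) ⊕ id′))) ⊜
          ((u ⊕ u) ⊕ (w ⊕ (s ⊕ (t ⊕ t)))) ⊕ ((u ⊕ u) ⊕ (w ⊕ (s ⊕ (t ⊕ t))))) refl u w s t) (⊞-self ((u ⊞ u) ⊞ (w ⊞ (s ⊞ (t ⊞ t))))))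

      module _ {a : A} (cl-a : cl a ≡ u) where

        quad-ppp : K (sum (a ∷ p₁ ∷ p₂ ∷ p₃ ∷ []))
        quad-ppp = trans (cl-quad cl-a cl-p₁ cl-p₂ cl-p₃) (trans
          (solve 3 (λ u s t → u ⊕ ((u ⊕ s) ⊕ ((u ⊕ t) ⊕ ((u ⊕ (s ⊕ t)) ⊕ id′))) ⊜
            ((u ⊕ u) ⊕ (s ⊕ t)) ⊕ ((u ⊕ u) ⊕ (s ⊕ t))) refl u s t) (⊞-self ((u ⊞ u) ⊞ (s ⊞ t))))

        quad-pqq : K (sum (a ∷ p₁ ∷ q₂ ∷ q₃ ∷ []))
        quad-pqq = trans (cl-quad cl-a cl-p₁ cl-q₂ cl-q₃) (trans
          (solve 4 (λ u w s t → u ⊕ ((u ⊕ s) ⊕ ((u ⊕ (w ⊕ t)) ⊕ ((u ⊕ (w ⊕ (s ⊕ t))) ⊕ id′))) ⊜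
            ((u ⊕ u) ⊕ (w ⊕ (s ⊕ t))) ⊕ ((u ⊕ u) ⊕ (w ⊕ (s ⊕ t)))) refl u w s t) (⊞-self ((u ⊞ u) ⊞ (w ⊞ (s ⊞ t)))))

        quad-qpq : K (sum (a ∷ q₁ ∷ p₂ ∷ q₃ ∷ []))
        quad-qpq = trans (cl-quad cl-a cl-q₁ cl-p₂ cl-q₃) (trans
          (solve 4 (λ u w s t → u ⊕ ((u ⊕ (w ⊕ s)) ⊕ ((u ⊕ t) ⊕ ((u ⊕ (w ⊕ (s ⊕ t))) ⊕ id′))) ⊜
            ((u ⊕ u) ⊕ (w ⊕ (s ⊕ t))) ⊕ ((u ⊕ u) ⊕ (w ⊕ (s ⊕ t)))) refl u w s t) (⊞-self ((u ⊞ u) ⊞ (w ⊞ (s ⊞ t)))))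

        quad-qqp : K (sum (a ∷ q₁ ∷ q₂ ∷ p₃ ∷ []))
        quad-qqp = trans (cl-quad cl-a cl-q₁ cl-q₂ cl-p₃) (trans
          (solve 4 (λ u w s t → u ⊕ ((u ⊕ (w ⊕ s)) ⊕ ((u ⊕ (w ⊕ t)) ⊕ ((u ⊕ (s ⊕ t)) ⊕ id′))) ⊜
            ((u ⊕ u) ⊕ (w ⊕ (s ⊕ t))) ⊕ ((u ⊕ u) ⊕ (w ⊕ (s ⊕ t)))) refl u w s t) (⊞-self ((u ⊞ u) ⊞ (w ⊞ (s ⊞ t)))))

    Hexad-swap : ∀ {u w s t p₁ q₁ p₂ q₂ p₃ q₃} → Hexad u w s t p₁ q₁ p₂ q₂ p₃ q₃ → Hexad (u ⊞ w) w s t q₁ p₁ q₂ p₂ q₃ p₃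
    Hexad-swap {u} {w} {s} {t} H = record
      { cl-p₁ = trans cl-q₁ (sym (V.assoc u w s)) ; cl-q₁ = trans cl-p₁ (cancel s)
      ; cl-p₂ = trans cl-q₂ (sym (V.assoc u w t)) ; cl-q₂ = trans cl-p₂ (cancel t)
      ; cl-p₃ = trans cl-q₃ (sym (V.assoc u w (s ⊞ t))) ; cl-q₃ = trans cl-p₃ (cancel (s ⊞ t)) }
      where
      open Hexad H
      cancel : ∀ r → u ⊞ r ≡ (u ⊞ w) ⊞ (w ⊞ r)
      cancel r = sym (trans (V.assoc u w (w ⊞ r)) (cong (u ⊞_) (V.∙-⁻¹-cancelˡ w r)))

    toHexad : ∀ {u w s t} Z → map cl Z ≡ map (u ⊞_) (sixfold w s t) →
      ∃[ p₁ ] ∃[ q₁ ] ∃[ p₂ ] ∃[ q₂ ] ∃[ p₃ ] ∃[ q₃ ]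
        (Z ≡ p₁ ∷ q₁ ∷ p₂ ∷ q₂ ∷ p₃ ∷ q₃ ∷ [] × Hexad u w s t p₁ q₁ p₂ q₂ p₃ q₃)
    toHexad (p₁ ∷ q₁ ∷ p₂ ∷ q₂ ∷ p₃ ∷ q₃ ∷ []) e =
      let e₁ , r₁ = ∷-injective e
          e₂ , r₂ = ∷-injective r₁
          e₃ , r₃ = ∷-injective r₂
          e₄ , r₄ = ∷-injective r₃
          e₅ , r₅ = ∷-injective r₄
          e₆ , _ = ∷-injective r₅
      in p₁ , q₁ , p₂ , q₂ , p₃ , q₃ , refl ,
         record { cl-p₁ = e₁ ; cl-q₁ = e₂ ; cl-p₂ = e₃ ; cl-q₂ = e₄ ; cl-p₃ = e₅ ; cl-q₃ = e₆ }

    -- Exchange arguments with affine planes.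

    value₂ : ∀ {S j} → TwoValued S j → A
    value₂ W = TwoValued.x W ∙ TwoValued.g W

    value₂≢ : ∀ {S j} (W : TwoValued S j) → TwoValued.x W ≢ value₂ W
    value₂≢ W e = TwoValued.order W 1 (s≤s z≤n) (s≤s z≤n)
      (∙-cancelˡ (TwoValued.x W) _ _ (trans (cong (TwoValued.x W ∙_) (identityʳ _)) (trans (sym e) (sym (identityʳ _)))))

    module _ {S : List A} (free : Free S) {u w s t : V} {p₁ q₁ p₂ q₂ p₃ q₃ : A} (H : Hexad u w s t p₁ q₁ p₂ q₂ p₃ q₃) where

      open Hexad H

      six : List A
      six = p₁ ∷ q₁ ∷ p₂ ∷ q₂ ∷ p₃ ∷ q₃ ∷ []

      -- The element `a` occupies the class `u`, so quadruples exist in all seven planes avoiding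
      -- `u ⊞ w`, and `quad-sum` gives them one common sum.
      seven-sums : ∀ {P L a j} → S ↭ flat P ++ L → (W : TwoValued (map pairSum P) j) → a ∷ six ⊑ L → cl a ≡ u →
        a ∙ a ≡ p₁ ∙ p₁ × TwoValued.x W ∙ value₂ W ≡ (p₁ ∙ p₁) ∙ (p₁ ∙ p₁) × sum (a ∷ p₁ ∷ p₂ ∷ p₃ ∷ []) ≡ TwoValued.x W ∙ value₂ W
      seven-sums {P} {L} {a} split W ⊑L cl-a =
        let q : ∀ {X} → X ⊆ a ∷ six → length X ≡ 4 → K (sum X) → sum X ≡ TwoValued.x W ∙ value₂ W
            q X⊆ lX KX = quad-sum free split W (⊑-trans (⊆⇒⊑ X⊆) ⊑L) lX KX
            ppp = q (refl ∷ refl ∷ _ ∷ʳ refl ∷ _ ∷ʳ refl ∷ _ ∷ʳ []) refl (quad-ppp cl-a)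
            e , e' = seven-points
              (q (_ ∷ʳ refl ∷ refl ∷ refl ∷ refl ∷ _ ∷ʳ _ ∷ʳ []) refl quad₁₂)
              (q (_ ∷ʳ refl ∷ refl ∷ _ ∷ʳ _ ∷ʳ refl ∷ refl ∷ []) refl quad₁₃)
              (q (_ ∷ʳ _ ∷ʳ _ ∷ʳ refl ∷ refl ∷ refl ∷ refl ∷ []) refl quad₂₃)
              ppp
              (q (refl ∷ refl ∷ _ ∷ʳ _ ∷ʳ refl ∷ _ ∷ʳ refl ∷ []) refl (quad-pqq cl-a))
              (q (refl ∷ _ ∷ʳ refl ∷ refl ∷ _ ∷ʳ _ ∷ʳ refl ∷ []) refl (quad-qpq cl-a))
              (q (refl ∷ _ ∷ʳ refl ∷ _ ∷ʳ refl ∷ refl ∷ _ ∷ʳ []) refl (quad-qqp cl-a))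
        in e , e' , ppp

      unpair : ∀ {b c P L} → S ↭ flat ((b , c) ∷ P) ++ L → S ↭ flat P ++ (b ∷ c ∷ L)
      unpair {b} {c} {P} {L} p = ↭-trans p (++-Solver.solve 3 (λ x y z → x ⊕ (y ⊕ z) ⊜ y ⊕ (x ⊕ z)) refl (b ∷ c ∷ []) (flat P) L)
        where open ++-Solver using (_⊕_; _⊜_)

      pairs-TwoValued : ∀ {b c P L} → S ↭ flat ((b , c) ∷ P) ++ L → All SameClass ((b , c) ∷ P) → length P ≡ suc (k + k) →
        ∃[ W ] b ∙ c ≡ value₂ {map pairSum P} {k} W
      pairs-TwoValued {b} {c} {P} split sc lP =
        inverse-EGZ (b ∙ c) (map pairSum P) (K-pairs sc) (trans (length-map pairSum P) lP) (pairs-free free split)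

      -- Once the pair is broken, either `b` or `c` can be the seventh point, so `2b = 2c = 2p₁` and
      -- `x + y = 4p₁ = 2(b + c)`. Since `inverse-EGZ` gives `b + c = y`, this would mean `x = y`.
      no-missing-class : ∀ {b c P} → S ↭ flat ((b , c) ∷ P) ++ six → All SameClass ((b , c) ∷ P) → length P ≡ suc (k + k) → cl b ≢ u
      no-missing-class {b} {c} {P} split sc@(cl-b≡cl-c ∷ _) lP cl-b =
        let W , e = pairs-TwoValued split sc lP
            b²≡ , Q≡ , _ = seven-sums (unpair split) W (⊆⇒⊑ (refl ∷ c ∷ʳ ⊆-refl)) cl-b
            c²≡ , _ = seven-sums (unpair split) W (⊆⇒⊑ (b ∷ʳ ⊆-refl)) (trans (sym cl-b≡cl-c) cl-b)
        in value₂≢ W (∙-cancelʳ (value₂ W) _ _ (begin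
             TwoValued.x W ∙ value₂ W ≡⟨ Q≡ ⟩
             (p₁ ∙ p₁) ∙ (p₁ ∙ p₁) ≡⟨ cong₂ _∙_ b²≡ c²≡ ⟨
             (b ∙ b) ∙ (c ∙ c) ≡⟨ ∙-interchange b b c c ⟩
             (b ∙ c) ∙ (b ∙ c) ≡⟨ cong₂ _∙_ e e ⟩
             value₂ W ∙ value₂ W ∎))
        where open ≡-Reasoning

      -- With only `2n - 3` pairs the missing sum has to come from a plane of leftovers. The last
      -- component expresses the sum through `p₁` alone, because `W` may change with the pairing
      -- while `p₁` stays.
      eight-sums : ∀ {b c P a a'} → S ↭ flat ((b , c) ∷ P) ++ (a ∷ a' ∷ six) → All SameClass ((b , c) ∷ P) →
        length P ≡ k + k → cl a ≡ u →
        ∃[ W ] (a ∙ a ≡ p₁ ∙ p₁ × TwoValued.x {map pairSum ((b , c) ∷ P)} {k} W ∙ value₂ W ≡ (p₁ ∙ p₁) ∙ (p₁ ∙ p₁)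
                × sum (a ∷ p₁ ∷ p₂ ∷ p₃ ∷ []) ≡ (p₁ ∙ p₁) ∙ (p₁ ∙ p₁))
      eight-sums {b} {c} {P} {a} {a'} split sc lP cl-a =
        let X = a ∷ p₁ ∷ p₂ ∷ p₃ ∷ []
            W = inverse-2n∸3 (map pairSum ((b , c) ∷ P)) (sum X ⁻¹) (K-pairs sc)
                  (cong suc (trans (length-map pairSum P) lP)) (pairs-free free split)
                  (trans (cl-⁻¹ (sum X)) (quad-ppp cl-a))
                  (quad-missing free split {X} (⊆⇒⊑ (refl ∷ a' ∷ʳ refl ∷ q₁ ∷ʳ refl ∷ q₂ ∷ʳ refl ∷ q₃ ∷ʳ [])) refl)
            a²≡ , Q≡ , X≡ = seven-sums split W (⊆⇒⊑ (refl ∷ a' ∷ʳ ⊆-refl)) cl-a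
        in W , a²≡ , Q≡ , trans X≡ Q≡

      -- If `a`, `b`, `c` shared the class `u`, they could be exchanged, and each would complete
      -- `p₁, p₂, p₃` to the sum `4p₁`; hence `a = b = c`. Then the pair sum `b + c = 2a = 2p₁`
      -- would be one of `x`, `y` and also satisfy `2(b + c) = x + y`, giving `x = y`.
      not-eight-classes : ∀ {b c P a a'} → S ↭ flat ((b , c) ∷ P) ++ (a ∷ a' ∷ six) → All SameClass ((b , c) ∷ P) →
        length P ≡ k + k → cl b ≡ u → cl a ≢ u
      not-eight-classes {b} {c} {P} {a} {a'} split (cl-b≡cl-c ∷ sc) lP cl-b cl-a =
        let cl-c = trans (sym cl-b≡cl-c) cl-b
            W , a²≡ , Q≡ , Xa = eight-sums split (cl-b≡cl-c ∷ sc) lP cl-a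
            _ , _ , _ , Xb = eight-sums {a} {c} {P} {b} {a'} (↭-trans split (exchange-b (flat P))) (trans cl-a (sym cl-c) ∷ sc) lP cl-b
            _ , _ , _ , Xc = eight-sums {b} {a} {P} {c} {a'} (↭-trans split (exchange-c (flat P))) (trans cl-b (sym cl-a) ∷ sc) lP cl-c
            b≡a = ∙-cancelʳ (sum (p₁ ∷ p₂ ∷ p₃ ∷ [])) b a (trans Xb (sym Xa))
            c≡a = ∙-cancelʳ (sum (p₁ ∷ p₂ ∷ p₃ ∷ [])) c a (trans Xc (sym Xa))
            bc≡ = trans (cong₂ _∙_ b≡a c≡a) a²≡
            Q≡' = trans Q≡ (sym (cong₂ _∙_ bc≡ bc≡))
        in absurd W Q≡' (∈-++⁻ (replicate (suc k) (TwoValued.x W)) (∈-resp-↭ (TwoValued.split W) (here refl)))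
        where
        open ++-Solver using (_⊕_; _⊜_)
        exchange-b : ∀ F → (b ∷ c ∷ F) ++ (a ∷ a' ∷ six) ↭ (a ∷ c ∷ F) ++ (b ∷ a' ∷ six)
        exchange-b F = ++-Solver.solve 5 (λ b c F a r → (b ⊕ (c ⊕ F)) ⊕ (a ⊕ r) ⊜ (a ⊕ (c ⊕ F)) ⊕ (b ⊕ r)) refl [ b ] [ c ] F [ a ] (a' ∷ six)
        exchange-c : ∀ F → (b ∷ c ∷ F) ++ (a ∷ a' ∷ six) ↭ (b ∷ a ∷ F) ++ (c ∷ a' ∷ six)
        exchange-c F = ++-Solver.solve 5 (λ b c F a r → (b ⊕ (c ⊕ F)) ⊕ (a ⊕ r) ⊜ (b ⊕ (a ⊕ F)) ⊕ (c ⊕ r)) refl [ b ] [ c ] F [ a ] (a' ∷ six)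
        absurd : ∀ (W : TwoValued (map pairSum ((b , c) ∷ P)) k) → TwoValued.x W ∙ value₂ W ≡ (b ∙ c) ∙ (b ∙ c) →
          b ∙ c ∈ replicate (suc k) (TwoValued.x W) ⊎ b ∙ c ∈ replicate k (value₂ W) → ⊥
        absurd W Q≡ (inj₁ ∈x) = let e = All.lookup (Allₚ.replicate⁺ {P = _≡ TwoValued.x W} (suc k) refl) ∈x in
          value₂≢ W (∙-cancelˡ (TwoValued.x W) _ _ (sym (trans Q≡ (cong₂ _∙_ e e))))
        absurd W Q≡ (inj₂ ∈y) = let e = All.lookup (Allₚ.replicate⁺ {P = _≡ value₂ W} k refl) ∈y in
          value₂≢ W (∙-cancelʳ (value₂ W) _ _ (trans Q≡ (cong₂ _∙_ e e)))

      quad-through : ∀ {p} → p ∈ six → ∃[ X ] (p ∷ X ⊑ six × length X ≡ 3 × K (sum (p ∷ X)))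
      quad-through p∈ = go p∈
        where
        through : ∀ {p X R} → X ⊆ six → length X ≡ 4 → K (sum X) → X ↭ p ∷ R → ∃[ X' ] (p ∷ X' ⊑ six × length X' ≡ 3 × K (sum (p ∷ X')))
        through {R = R} X⊆ lX KX p = R , ⊑-respˡ-↭ p (⊆⇒⊑ X⊆) , suc-injective (trans (sym (↭-length p)) lX) , trans (cong cl (sym (sum-↭ p))) KX
        s₁₂ : p₁ ∷ q₁ ∷ p₂ ∷ q₂ ∷ [] ⊆ six
        s₁₂ = refl ∷ refl ∷ refl ∷ refl ∷ _ ∷ʳ _ ∷ʳ []
        s₂₃ : p₂ ∷ q₂ ∷ p₃ ∷ q₃ ∷ [] ⊆ six
        s₂₃ = _ ∷ʳ _ ∷ʳ refl ∷ refl ∷ refl ∷ refl ∷ []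
        go : ∀ {p} → p ∈ six → ∃[ X ] (p ∷ X ⊑ six × length X ≡ 3 × K (sum (p ∷ X)))
        go (here refl) = through s₁₂ refl quad₁₂ refl
        go (there (here refl)) = through s₁₂ refl quad₁₂ (shift q₁ (p₁ ∷ []) _)
        go (there (there (here refl))) = through s₁₂ refl quad₁₂ (shift p₂ (p₁ ∷ q₁ ∷ []) _)
        go (there (there (there (here refl)))) = through s₁₂ refl quad₁₂ (shift q₂ (p₁ ∷ q₁ ∷ p₂ ∷ []) _)
        go (there (there (there (there (here refl))))) = through s₂₃ refl quad₂₃ (shift p₃ (p₂ ∷ q₂ ∷ []) _)
        go (there (there (there (there (there (here refl)))))) = through s₂₃ refl quad₂₃ (shift q₃ (p₂ ∷ q₂ ∷ p₃ ∷ []) _)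

      -- Both `b` and `c` can replace `p` in a quadruple through `p`, and the forced sum stays the
      -- same.
      pair-constant : ∀ {b c P p} → S ↭ flat ((b , c) ∷ P) ++ six → All SameClass ((b , c) ∷ P) → length P ≡ suc (k + k) →
        p ∈ six → cl b ≡ cl p → b ≡ p × c ≡ p
      pair-constant {b} {c} {P} {p} split sc@(cl-b≡cl-c ∷ _) lP p∈ cl-b =
        let W , _ = pairs-TwoValued split sc lP
            X , pX⊑ , lX , KpX = quad-through p∈
            X⊑ = ⊑-trans (⊑-++ʳ (p ∷ []) X) pX⊑
            Qp = quad-sum free (unpair split) W (⊑-trans pX⊑ (⊑-++ʳ (b ∷ c ∷ []) six)) (cong suc lX) KpX
            Qb = quad-sum free (unpair split) W (⊑-++⁺ (⊑-++ˡ (b ∷ []) (c ∷ [])) X⊑) (cong suc lX)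
                   (trans (trans (cl-∙ b (sum X)) (trans (cong (_⊞ cl (sum X)) cl-b) (sym (cl-∙ p (sum X))))) KpX)
            Qc = quad-sum free (unpair split) W (⊑-++⁺ (⊑-++ʳ (b ∷ []) (c ∷ [])) X⊑) (cong suc lX)
                   (trans (trans (cl-∙ c (sum X)) (trans (cong (_⊞ cl (sum X)) (trans (sym cl-b≡cl-c) cl-b)) (sym (cl-∙ p (sum X))))) KpX)
        in ∙-cancelʳ (sum X) b p (trans Qb (sym Qp)) , ∙-cancelʳ (sum X) c p (trans Qc (sym Qp))

    -- Every pair turns out to be a repeated element, so `X` and `Y` keep one member of each pair
    -- with sum `x` and `y` respectively. Their lengths are the `n - 1` of the inverse theorem.
    record Structure (S : List A) : Set where
      field
        {x g s} : A
        {p₁ q₁ p₂ q₂ p₃ q₃} : A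
        Kg : K g
        order : OrderN g
      y : A
      y = x ∙ g
      six′ : List A
      six′ = p₁ ∷ q₁ ∷ p₂ ∷ q₂ ∷ p₃ ∷ q₃ ∷ []
      field
        pair₁ : p₁ ∙ q₁ ≡ s
        pair₂ : p₂ ∙ q₂ ≡ s
        pair₃ : p₃ ∙ q₃ ≡ s
        double-s : s ∙ s ≡ x ∙ y
        distinct : Unique (map cl six′)
        {X Y} : List A
        split : S ↭ six′ ++ ((X ++ X) ++ (Y ++ Y))
        double-X : All (λ b → b ∈ six′ × b ∙ b ≡ x) X
        double-Y : All (λ b → b ∈ six′ × b ∙ b ≡ y) Y
        length-X : length X ≡ suc k
        length-Y : length Y ≡ suc k

    flat-diagonal : ∀ P → All (λ (b , c) → b ≡ c) P → flat P ↭ map proj₁ P ++ map proj₁ P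
    flat-diagonal [] [] = refl
    flat-diagonal ((b , _) ∷ P) (refl ∷ d) = prep b (↭-trans (prep b (flat-diagonal P d)) (↭-sym (shift b (map proj₁ P) (map proj₁ P))))

    equal-pair-sums : ∀ {a b c d e f Q} → sum (a ∷ b ∷ c ∷ d ∷ []) ≡ Q → sum (a ∷ b ∷ e ∷ f ∷ []) ≡ Q → sum (c ∷ d ∷ e ∷ f ∷ []) ≡ Q →
      c ∙ d ≡ a ∙ b × e ∙ f ≡ a ∙ b × (a ∙ b) ∙ (a ∙ b) ≡ Q
    equal-pair-sums {a} {b} {c} {d} {e} {f} {Q} e₁ e₂ e₃ = cd≡ab , ef≡ab , trans (cong ((a ∙ b) ∙_) (sym cd≡ab)) f₁
      where
      regroup : ∀ a b c d → (a ∙ b) ∙ (c ∙ d) ≡ sum (a ∷ b ∷ c ∷ d ∷ [])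
      regroup = solve 4 (λ a b c d → (a ⊕ b) ⊕ (c ⊕ d) ⊜ a ⊕ (b ⊕ (c ⊕ (d ⊕ id′)))) refl
        where open ∙-Solver using (solve; _⊕_; _⊜_) renaming (id to id′)
      f₁ = trans (regroup a b c d) e₁
      f₂ = trans (regroup a b e f) e₂
      f₃ = trans (regroup c d e f) e₃
      cd≡ab : c ∙ d ≡ a ∙ b
      cd≡ab = ∙-cancelʳ (e ∙ f) _ _ (trans f₃ (sym f₂))
      ef≡ab : e ∙ f ≡ a ∙ b
      ef≡ab = ∙-cancelˡ (c ∙ d) _ _ (trans f₃ (trans (sym f₁) (comm _ _)))

    -- The absent classes are excluded by `no-missing-class`, the second one after `Hexad-swap` has
    -- interchanged `u` and `u ⊞ w`; in every other class the pair repeats a leftover.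
    pair-cases : ∀ {u w s t p₁ q₁ p₂ q₂ p₃ q₃} {S} → Free S → Hexad u w s t p₁ q₁ p₂ q₂ p₃ q₃ →
      allV ↭ u ∷ (u ⊞ w) ∷ map cl (p₁ ∷ q₁ ∷ p₂ ∷ q₂ ∷ p₃ ∷ q₃ ∷ []) →
      ∀ {P b c} → S ↭ flat ((b , c) ∷ P) ++ (p₁ ∷ q₁ ∷ p₂ ∷ q₂ ∷ p₃ ∷ q₃ ∷ []) →
      All SameClass ((b , c) ∷ P) → length P ≡ suc (k + k) → b ≡ c × b ∈ p₁ ∷ q₁ ∷ p₂ ∷ q₂ ∷ p₃ ∷ q₃ ∷ []
    pair-cases {u} {w} {p₁ = p₁} {q₁} {p₂} {q₂} {p₃} {q₃} free H all {P} {b} {c} split sc lP = cases (∈-resp-↭ all (∈-allV (cl b)))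
      where
      six″ = p₁ ∷ q₁ ∷ p₂ ∷ q₂ ∷ p₃ ∷ q₃ ∷ []
      swapped : six″ ↭ q₁ ∷ p₁ ∷ q₂ ∷ p₂ ∷ q₃ ∷ p₃ ∷ []
      swapped = swap p₁ q₁ (swap p₂ q₂ (swap p₃ q₃ refl))
      cases : cl b ∈ u ∷ (u ⊞ w) ∷ map cl six″ → b ≡ c × b ∈ six″
      cases (here e) = ⊥-elim (no-missing-class free H split sc lP e)
      cases (there (here e)) = ⊥-elim (no-missing-class free (Hexad-swap H) (↭-trans split (↭-++⁺ˡ (flat ((b , c) ∷ P)) swapped)) sc lP e)
      cases (there (there cl-b∈)) =
        let p , p∈ , e = ∈-map⁻ cl {xs = six″} cl-b∈
            b≡p , c≡p = pair-constant free H split sc lP p∈ e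
        in trans b≡p (sym c≡p) , subst (_∈ six″) (sym b≡p) p∈

    structure₆ : ∀ {u w s t p₁ q₁ p₂ q₂ p₃ q₃} {S} → Free S → Hexad u w s t p₁ q₁ p₂ q₂ p₃ q₃ →
      allV ↭ u ∷ (u ⊞ w) ∷ map cl (p₁ ∷ q₁ ∷ p₂ ∷ q₂ ∷ p₃ ∷ q₃ ∷ []) → ∀ P →
      S ↭ flat P ++ (p₁ ∷ q₁ ∷ p₂ ∷ q₂ ∷ p₃ ∷ q₃ ∷ []) → All SameClass P → length P ≡ suc (suc (k + k)) → Structure S
    structure₆ {p₁ = p₁} {q₁} {p₂} {q₂} {p₃} {q₃} {S} free H all P₀@((b₀ , c₀) ∷ P) split sc lP =
      let W , e = pairs-TwoValued free H split sc (suc-injective lP)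
          q : ∀ {X} → X ⊆ six″ → length X ≡ 4 → K (sum X) → sum X ≡ TwoValued.x W ∙ value₂ W
          q X⊆ lX KX = quad-sum free (unpair free H split) W (⊑-trans (⊆⇒⊑ X⊆) (⊑-++ʳ (b₀ ∷ c₀ ∷ []) six″)) lX KX
          pair₂ , pair₃ , double = equal-pair-sums
            (q (refl ∷ refl ∷ refl ∷ refl ∷ _ ∷ʳ _ ∷ʳ []) refl (Hexad.quad₁₂ H))
            (q (refl ∷ refl ∷ _ ∷ʳ _ ∷ʳ refl ∷ refl ∷ []) refl (Hexad.quad₁₃ H))
            (q (_ ∷ʳ _ ∷ʳ refl ∷ refl ∷ refl ∷ refl ∷ []) refl (Hexad.quad₂₃ H))
          PX , PY , PXY , eX , eY = ↭-map-++⁻ pairSum {S = P₀} {T = replicate (suc k) (TwoValued.x W)} {R = replicate (suc k) (value₂ W)} (sums W e)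
          diag = All-resp-↭ PXY diagonal
          dX = Allₚ.++⁻ˡ PX diag
          dY = Allₚ.++⁻ʳ PX diag
      in record
        { x = TwoValued.x W ; g = TwoValued.g W ; s = p₁ ∙ q₁
        ; Kg = TwoValued.Kg W ; order = TwoValued.order W
        ; pair₁ = refl ; pair₂ = pair₂ ; pair₃ = pair₃ ; double-s = double
        ; distinct = drop₂ (Unique-resp-↭ all Unique-allV)
        ; X = map proj₁ PX ; Y = map proj₁ PY
        ; split = ↭-trans split (↭-trans (++-comm (flat P₀) six″) (↭-++⁺ˡ six″ (↭-trans (flat-↭ PXY) (↭-trans (↭-reflexive (flat-++ PX PY))
            (↭-++⁺ (flat-diagonal PX (All.map proj₁ dX)) (flat-diagonal PY (All.map proj₁ dY)))))))
        ; double-X = doubles PX dX (subst (All (_≡ TwoValued.x W)) (sym eX) (Allₚ.replicate⁺ (suc k) refl))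
        ; double-Y = doubles PY dY (subst (All (_≡ value₂ W)) (sym eY) (Allₚ.replicate⁺ (suc k) refl))
        ; length-X = length-proj₁ PX eX
        ; length-Y = length-proj₁ PY eY
        }
      where
      six″ = p₁ ∷ q₁ ∷ p₂ ∷ q₂ ∷ p₃ ∷ q₃ ∷ []
      Diagonal : A × A → Set
      Diagonal (b , c) = b ≡ c × b ∈ six″
      -- Any pair can be brought to the front, so the statement about the first pair covers all of
      -- them.
      diagonal : All Diagonal P₀
      diagonal = All.tabulate λ {(b , c)} bc∈ → let P' , p = ∈⇒↭ bc∈ in
        pair-cases free H all (↭-trans split (↭-++⁺ʳ six″ (flat-↭ p))) (All-resp-↭ p sc) (suc-injective (trans (sym (↭-length p)) lP))
      sums : (W : TwoValued (map pairSum P) k) → b₀ ∙ c₀ ≡ value₂ W →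
        map pairSum P₀ ↭ replicate (suc k) (TwoValued.x W) ++ replicate (suc k) (value₂ W)
      sums W e = ↭-trans (↭-reflexive (cong (_∷ map pairSum P) e)) (↭-trans (prep (value₂ W) (TwoValued.split W))
        (↭-sym (shift (value₂ W) (replicate (suc k) (TwoValued.x W)) (replicate k (value₂ W)))))
      doubles : ∀ {z} P → All Diagonal P → All (_≡ z) (map pairSum P) → All (λ b → b ∈ six″ × b ∙ b ≡ z) (map proj₁ P)
      doubles [] [] [] = []
      doubles ((b , _) ∷ P) ((refl , b∈) ∷ ds) (e ∷ es) = (b∈ , e) ∷ doubles P ds es
      length-proj₁ : ∀ {z} P → map pairSum P ≡ replicate (suc k) z → length (map proj₁ P) ≡ suc k
      length-proj₁ {z} P e = trans (length-map proj₁ P) (trans (sym (length-map pairSum P)) (trans (cong length e) (length-replicate (suc k))))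
      drop₂ : ∀ {a b} {X : List V} → Unique (a ∷ b ∷ X) → Unique X
      drop₂ (_ ∷ _ ∷ u) = u

    -- The two absent classes are named `u` and `u ⊞ w`; the six occupied ones are then the
    -- translate by `u` of a `sixfold`.
    six-leftovers : ∀ {S L P} → Free S → S ↭ flat P ++ L → All SameClass P → length P ≡ suc (suc (k + k)) →
      Unique (map cl L) → length L ≡ 6 → Structure S
    six-leftovers {S} {L} {P} free split sc lP uL lL = go (rest missing) (_⊑_.split missing)
        (+-cancelˡ-≡ 6 (length (rest missing)) 2 (trans (cong (_+ length (rest missing)) (trans (sym lL) (sym (length-map cl L))))
          (trans (sym (length-++ (map cl L))) (sym (↭-length (_⊑_.split missing))))))
      where
      open _⊑_ using (rest)
      missing : map cl L ⊑ allV
      missing = Unique⇒⊑ uL (λ {v} _ → ∈-allV v)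
      finish : ∀ u v w → w ≢ 0V → u ⊞ w ≡ v → allV ↭ u ∷ v ∷ map cl L → Structure S
      finish u v w w≢0 refl uv-first =
        let s , t , q = allV-decomposition u w w≢0
            q' = ↭-trans q (↭-reflexive (cong (λ a → a ∷ (u ⊞ w) ∷ map (u ⊞_) (sixfold w s t)) (V.identityʳ u)))
            Z , eZ , r = ↭-map-inv cl {xs = L} (drop-∷ (drop-∷ (↭-trans (↭-sym uv-first) q')))
            p₁ , q₁ , p₂ , q₂ , p₃ , q₃ , eZ' , H = toHexad {u} {w} {s} {t} Z (sym eZ)
            r' = ↭-trans r (↭-reflexive eZ')
        in structure₆ free H (↭-trans uv-first (prep u (prep (u ⊞ w) (↭-map⁺ cl r')))) P (↭-trans split (↭-++⁺ˡ (flat P) r')) sc lP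

      go : ∀ R → allV ↭ map cl L ++ R → length R ≡ 2 → Structure S
      go (u ∷ v ∷ []) p refl = finish u v (u ⊞ v) (λ e → u≢v (V.∙-cancelʳ v u v (trans e (sym (⊞-self v)))))
          (V.∙-⁻¹-cancelˡ u v) uv-first
        where
        uv-first : allV ↭ u ∷ v ∷ map cl L
        uv-first = ↭-trans p (++-comm (map cl L) (u ∷ v ∷ []))
        u≢v : u ≢ v
        u≢v e = Uniqueₚ.Unique[x∷xs]⇒x∉xs (Unique-resp-↭ uv-first Unique-allV) (here e)

    -- All classes are occupied, so `u` can be chosen as the class of the first pair, with a
    -- leftover `a` in the same class.
    not-eight-leftovers : ∀ {S L P} w → w ≢ 0V → Free S → S ↭ flat P ++ L → All SameClass P → length P ≡ suc (k + k) →
      Unique (map cl L) → length L ≢ 8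
    not-eight-leftovers {S} {L} {(b , c) ∷ P} w w≢0 free split sc lP uL lL =
      let s , t , q = allV-decomposition (cl b) w w≢0
          Z , eZ , r = ↭-map-inv cl {xs = L} (↭-trans (↭-sym (Unique-V⇒↭ uL (trans (length-map cl L) lL))) q)
          a , a' , Z' , eZ' , ea , eZ'' = head₂ Z (sym eZ)
          p₁ , q₁ , p₂ , q₂ , p₃ , q₃ , eZ‴ , H = toHexad {cl b} {w} {s} {t} Z' eZ''
      in not-eight-classes free H (↭-trans split (↭-++⁺ˡ (flat ((b , c) ∷ P)) (↭-trans r (↭-reflexive (trans eZ' (cong (λ z → a ∷ a' ∷ z) eZ‴))))))
           sc (suc-injective lP) refl (trans ea (V.identityʳ (cl b)))
      where
      head₂ : ∀ {v v' X} Z → map cl Z ≡ v ∷ v' ∷ X → ∃[ a ] ∃[ a' ] ∃[ Z' ] (Z ≡ a ∷ a' ∷ Z' × cl a ≡ v × map cl Z' ≡ X)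
      head₂ (a ∷ a' ∷ Z') e = let e₁ , e₂ = ∷-injective e ; _ , e₃ = ∷-injective e₂ in a , a' , Z' , refl , e₁ , e₃

    -- In `2|P| + |L| = 4n + 2` the bounds `|P| ≤ 2n - 2`, from `erdős-ginzburg-ziv`, and `|L| ≤ 8`
    -- leave only six or eight leftovers.
    structure : ∀ {S} → Free S → length S ≡ ((n + n) + (n + n)) + 2 → Structure S
    structure {S} free lS = let P , L , split , sc , uL = pairUp S in cases P L split sc uL
      where
      cases : ∀ P L → S ↭ flat P ++ L → All SameClass P → Unique (map cl L) → Structure S
      cases P L split sc uL = by-size (m≤n⇒m<n∨m≡n P≤)
        where
        open +-*-Solver
        total : (length P + length P) + length L ≡ ((n + n) + (n + n)) + 2
        total = trans (trans (cong (_+ length L) (sym (length-flat P))) (sym (length-++ (flat P)))) (trans (sym (↭-length split)) lS)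
        P≤ : length P ≤ suc (suc (k + k))
        P≤ = ≮⇒≥ λ P> → pairs-free free split (erdős-ginzburg-ziv (map pairSum P) (K-pairs sc)
               (≤-trans (≤-reflexive (cong suc (cong suc (trans (+-suc k (suc k)) (cong suc (+-suc k k))))))
                 (s≤s (≤-trans P> (≤-reflexive (sym (length-map pairSum P)))))))
        L≤8 : length L ≤ 8
        L≤8 = ≤-trans (≤-reflexive (sym (length-map cl L))) (⊑-length (Unique⇒⊑ uL (λ {v} _ → ∈-allV v)))
        leftover : ∀ {j l} → length P ≡ j → (j + j) + l ≡ ((n + n) + (n + n)) + 2 → length L ≡ l
        leftover {j} {l} refl e = +-cancelˡ-≡ (j + j) (length L) l (trans total (sym e))
        by-size : length P < suc (suc (k + k)) ⊎ length P ≡ suc (suc (k + k)) → Structure S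
        by-size (inj₂ P≡) = six-leftovers free split sc P≡ uL (leftover P≡
          (solve 1 (λ k → ((con 2 :+ (k :+ k)) :+ (con 2 :+ (k :+ k))) :+ con 6 :=
                          (((con 2 :+ k) :+ (con 2 :+ k)) :+ ((con 2 :+ k) :+ (con 2 :+ k))) :+ con 2) refl k))
        by-size (inj₁ P<) with m≤n⇒m<n∨m≡n (≤-pred P<)
        ... | inj₂ P≡ = ⊥-elim (not-eight-leftovers unit₁ (λ ()) free split sc P≡ uL (leftover P≡
          (solve 1 (λ k → ((con 1 :+ (k :+ k)) :+ (con 1 :+ (k :+ k))) :+ con 8 :=
                          (((con 2 :+ k) :+ (con 2 :+ k)) :+ ((con 2 :+ k) :+ (con 2 :+ k))) :+ con 2) refl k)))
        ... | inj₁ P<' = ⊥-elim (<-irrefl total (begin-strict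
          (length P + length P) + length L ≤⟨ +-mono-≤ (+-mono-≤ (≤-pred P<') (≤-pred P<')) L≤8 ⟩
          ((k + k) + (k + k)) + 8 <⟨ n<1+n _ ⟩
          suc (((k + k) + (k + k)) + 8) <⟨ n<1+n _ ⟩
          suc (suc (((k + k) + (k + k)) + 8)) ≡⟨ solve 1 (λ k → con 2 :+ (((k :+ k) :+ (k :+ k)) :+ con 8) :=
                          (((con 2 :+ k) :+ (con 2 :+ k)) :+ ((con 2 :+ k) :+ (con 2 :+ k))) :+ con 2) refl k ⟩
          ((n + n) + (n + n)) + 2 ∎))
          where open ≤-Reasoning

    -- Adapted bases and the three forms.

    cl-• : ∀ m f → cl (m • f) ≡ parity m ⋆ cl f
    cl-• zero f = cl-ε
    cl-• (suc m) f = trans (cl-∙ f (m • f)) (trans (cong (cl f ⊞_) (cl-• m f)) (sym (⋆-xor true (parity m) (cl f))))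

    -- Conditions that can be checked on classes instead of integer relations; `independent⇒`,
    -- `generates` and `order-f₃` recover the basis and the order `2n` from them.
    record AdaptedBasis (f₁ f₂ f₃ : A) : Set where
      field
        square₁ : f₁ ∙ f₁ ≡ ε
        square₂ : f₂ ∙ f₂ ≡ ε
        K-square₃ : K (f₃ ∙ f₃)
        order₃ : OrderN (f₃ ∙ f₃)
        independent : LinearlyIndependent (cl f₁) (cl f₂) (cl f₃)

    -- The forms avoid integers and truncated subtraction: `z′≡` stands for
    -- `z′ = (1 - a) f₃ + f₂ + f₁`, and the odd exponents are `suc (α + α)` and the like, with the
    -- complementary parameters `γ` and `δ` made explicit.
    record Form₁ (S : List A) : Set where
      field
        {f₁ f₂ f₃ z z′} : A
        basis : AdaptedBasis f₁ f₂ f₃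
        {a α β γ δ} : ℕ
        2≤a : 2 ≤ a
        a≤ : a ≤ suc k
        α+γ : α + γ ≡ suc k
        δ+β : δ + β ≡ suc k
        z≡ : z ≡ (a • f₃) ∙ f₁
        z′≡ : z′ ∙ (a • f₃) ≡ (f₃ ∙ f₂) ∙ f₁
        split : S ↭ replicate (suc (α + α)) ε ++ replicate (suc (γ + γ)) f₂ ++
                    replicate (suc (δ + δ)) f₃ ++ replicate (suc (β + β)) (f₃ ∙ f₂) ++ z ∷ z′ ∷ []

    record Form₂ (S : List A) : Set where
      field
        {f₁ f₂ f₃ z₂ z₂′ z₁ z₁′} : A
        basis : AdaptedBasis f₁ f₂ f₃
        {a b} : ℕ
        2≤a : 2 ≤ a
        a≤ : a ≤ suc k
        2≤b : 2 ≤ b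
        b≤ : b ≤ suc k
        z₂≡ : z₂ ≡ (a • f₃) ∙ f₂
        z₂′≡ : z₂′ ∙ (a • f₃) ≡ f₃ ∙ f₂
        z₁≡ : z₁ ≡ (b • f₃) ∙ f₁
        z₁′≡ : z₁′ ∙ (b • f₃) ≡ f₃ ∙ f₁
        split : S ↭ replicate (suc (suc k + suc k)) ε ++ replicate (suc (suc k + suc k)) f₃ ++ z₂ ∷ z₂′ ∷ z₁ ∷ z₁′ ∷ []

    record Form₃ (S : List A) : Set where
      field
        {f₁ f₂ f₃} : A
        basis : AdaptedBasis f₁ f₂ f₃
        {α β γ} : ℕ
        {d} : List A
        α+β+γ : (α + β) + γ ≡ suc k
        length-d : length d ≡ suc (n + n)
        d∈ : All (λ b → b ≡ ε ⊎ b ≡ f₁ ⊎ b ≡ f₂) d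
        sum∉ : sum d ∉ d
        split : S ↭ replicate (suc (α + α)) ε ++ replicate (suc (β + β)) f₁ ++ replicate (suc (γ + γ)) f₂ ++ map (f₃ ∙_) d

    -- Classification by the number of torsion pairs

    -- A `Structure` translated so that `p₁ = ε` and `x = ε`; then `q₁` is the common pair sum `s`,
    -- and `y = g`.
    record Normalised (S : List A) : Set where
      field
        {g s p₂ q₂ p₃ q₃} : A
        Kg : K g
        order : OrderN g
      six″ : List A
      six″ = ε ∷ s ∷ p₂ ∷ q₂ ∷ p₃ ∷ q₃ ∷ []
      field
        pair₂ : p₂ ∙ q₂ ≡ s
        pair₃ : p₃ ∙ q₃ ≡ s
        double-s : s ∙ s ≡ g
        distinct : Unique (map cl six″)
        {X Y} : List A
        split : S ↭ six″ ++ ((X ++ X) ++ (Y ++ Y))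
        double-X : All (λ b → b ∈ six″ × b ∙ b ≡ ε) X
        double-Y : All (λ b → b ∈ six″ × b ∙ b ≡ g) Y
        length-X : length X ≡ suc k
        length-Y : length Y ≡ suc k

      g≢ε : g ≢ ε
      g≢ε e = order 1 (s≤s z≤n) (s≤s z≤n) (trans (identityʳ g) e)

      -- The doubles of repeated elements are `ε` and `g`, so a generic element of the six occurs
      -- only once in the sequence.
      Torsion Generic : A → Set
      Torsion p = p ∙ p ≡ ε
      Generic p = p ∙ p ≢ ε × p ∙ p ≢ g

      squares : ∀ {p q} → p ∙ q ≡ s → (p ∙ p) ∙ (q ∙ q) ≡ g
      squares {p} {q} e = trans (∙-interchange p p q q) (trans (cong₂ _∙_ e e) double-s)

      torsion-partner : ∀ {p q} → p ∙ q ≡ s → Torsion p → q ∙ q ≡ g × q ≡ s ∙ p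
      torsion-partner {p} {q} e p²≡ε = trans (trans (sym (identityˡ _)) (cong (_∙ (q ∙ q)) (sym p²≡ε))) (squares e) ,
        (begin
          q ≡⟨ identityˡ q ⟨
          ε ∙ q ≡⟨ cong (_∙ q) p²≡ε ⟨
          (p ∙ p) ∙ q ≡⟨ trans (assoc p p q) (comm p (p ∙ q)) ⟩
          (p ∙ q) ∙ p ≡⟨ cong (_∙ p) e ⟩
          s ∙ p ∎)
        where open ≡-Reasoning

      generic-partner : ∀ {p q} → p ∙ q ≡ s → Generic p → Generic q
      generic-partner {p} {q} e (p²≢ε , p²≢g) =
        (λ q²≡ε → p²≢g (trans (trans (sym (identityʳ _)) (cong ((p ∙ p) ∙_) (sym q²≡ε))) (squares e))) ,
        (λ q²≡g → p²≢ε (∙-cancelʳ g _ _ (trans (cong ((p ∙ p) ∙_) (sym q²≡g)) (trans (squares e) (sym (identityˡ g))))))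

      cl-partner : ∀ {p q} → p ∙ q ≡ s → cl q ≡ cl p ⊞ cl s
      cl-partner {p} {q} e = trans (sym (V.⁻¹-∙-cancelˡ (cl p) (cl q))) (cong (cl p ⊞_) (trans (sym (cl-∙ p q)) (cong cl e)))

      LI : LinearlyIndependent (cl p₂) (cl p₃) (cl s)
      LI = distinct⇒LI (subst Unique eq distinct)
        where
        eq : map cl six″ ≡ 0V ∷ cl s ∷ cl p₂ ∷ (cl p₂ ⊞ cl s) ∷ cl p₃ ∷ (cl p₃ ⊞ cl s) ∷ []
        eq = cong₂ (λ a r → a ∷ cl s ∷ cl p₂ ∷ r) cl-ε (cong₂ (λ b c → b ∷ cl p₃ ∷ c ∷ []) (cl-partner pair₂) (cl-partner pair₃))

      Type : A → Set
      Type p = Torsion p ⊎ Generic p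

      -- The doubles of `pᵢ` and `qᵢ` add up to `g`, so the type of `pᵢ` decides which of them may
      -- occur in `X`; `∈Y⇒` is the counterpart for the double `g`.
      ∈X⇒ : Type p₂ → Type p₃ → ∀ {b} → b ∈ six″ → b ∙ b ≡ ε → b ≡ ε ⊎ (Torsion p₂ × b ≡ p₂) ⊎ (Torsion p₃ × b ≡ p₃)
      ∈X⇒ _ _ (here e) _ = inj₁ e
      ∈X⇒ _ _ (there (here refl)) e = ⊥-elim (g≢ε (trans (sym double-s) e))
      ∈X⇒ _ _ (there (there (here refl))) e = inj₂ (inj₁ (e , refl))
      ∈X⇒ (inj₁ t) _ (there (there (there (here refl)))) e = ⊥-elim (g≢ε (trans (sym (proj₁ (torsion-partner pair₂ t))) e))
      ∈X⇒ (inj₂ t) _ (there (there (there (here refl)))) e = ⊥-elim (proj₁ (generic-partner pair₂ t) e)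
      ∈X⇒ _ _ (there (there (there (there (here refl))))) e = inj₂ (inj₂ (e , refl))
      ∈X⇒ _ (inj₁ t) (there (there (there (there (there (here refl)))))) e = ⊥-elim (g≢ε (trans (sym (proj₁ (torsion-partner pair₃ t))) e))
      ∈X⇒ _ (inj₂ t) (there (there (there (there (there (here refl)))))) e = ⊥-elim (proj₁ (generic-partner pair₃ t) e)

      ∈Y⇒ : Type p₂ → Type p₃ → ∀ {b} → b ∈ six″ → b ∙ b ≡ g → b ≡ s ⊎ (Torsion p₂ × b ≡ q₂) ⊎ (Torsion p₃ × b ≡ q₃)
      ∈Y⇒ _ _ (here refl) e = ⊥-elim (g≢ε (trans (sym e) (identityʳ ε)))
      ∈Y⇒ _ _ (there (here e)) _ = inj₁ e
      ∈Y⇒ (inj₁ t) _ (there (there (here refl))) e = ⊥-elim (g≢ε (trans (sym e) t))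
      ∈Y⇒ (inj₂ t) _ (there (there (here refl))) e = ⊥-elim (proj₂ t e)
      ∈Y⇒ (inj₁ t) _ (there (there (there (here refl)))) _ = inj₂ (inj₁ (t , refl))
      ∈Y⇒ (inj₂ t) _ (there (there (there (here refl)))) e = ⊥-elim (proj₂ (generic-partner pair₂ t) e)
      ∈Y⇒ _ (inj₁ t) (there (there (there (there (here refl))))) e = ⊥-elim (g≢ε (trans (sym e) t))
      ∈Y⇒ _ (inj₂ t) (there (there (there (there (here refl))))) e = ⊥-elim (proj₂ t e)
      ∈Y⇒ _ (inj₁ t) (there (there (there (there (there (here refl)))))) _ = inj₂ (inj₂ (t , refl))
      ∈Y⇒ _ (inj₂ t) (there (there (there (there (there (here refl)))))) e = ⊥-elim (proj₂ (generic-partner pair₃ t) e)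

      cl-square : ∀ p → K (p ∙ p)
      cl-square p = trans (cl-∙ p p) (⊞-self (cl p))

      -- For generic z, z + z = a (f₃ + f₃) with 2 ≤ a ≤ n − 1, so that z − a f₃ is 2-torsion.
      generic-coordinate : ∀ {f₃ z} → f₃ ∙ f₃ ≡ g → Generic z →
        ∃[ a ] ∃[ f ] (2 ≤ a × a ≤ suc k × f ∙ f ≡ ε × z ≡ (a • f₃) ∙ f × cl f ≡ parity a ⋆ cl f₃ ⊞ cl z)
      generic-coordinate {f₃} {z} f₃²≡g (z²≢ε , z²≢g) with multiples-exhaust Kg order (cl-square z)
      ... | 0 , _ , e = ⊥-elim (z²≢ε e)
      ... | 1 , _ , e = ⊥-elim (z²≢g (trans e (identityʳ g)))
      ... | a@(suc (suc _)) , a≤ , e = a , f , s≤s (s≤s z≤n) , a≤ , f²≡ε , sym (∙-⁻¹-cancelˡ (a • f₃) z) ,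
            trans (cl-∙ ((a • f₃) ⁻¹) z) (cong (_⊞ cl z) (trans (cl-⁻¹ (a • f₃)) (cl-• a f₃)))
        where
        f = ((a • f₃) ⁻¹) ∙ z
        open ≡-Reasoning
        f²≡ε : f ∙ f ≡ ε
        f²≡ε = ∙-cancelˡ ((a • f₃) ∙ (a • f₃)) _ _ (begin
          ((a • f₃) ∙ (a • f₃)) ∙ (f ∙ f) ≡⟨ ∙-interchange (a • f₃) (a • f₃) f f ⟩
          ((a • f₃) ∙ f) ∙ ((a • f₃) ∙ f) ≡⟨ cong₂ _∙_ (∙-⁻¹-cancelˡ (a • f₃) z) (∙-⁻¹-cancelˡ (a • f₃) z) ⟩
          z ∙ z ≡⟨ e ⟩
          a • g ≡⟨ cong (a •_) f₃²≡g ⟨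
          a • (f₃ ∙ f₃) ≡⟨ •-∙ a f₃ f₃ ⟩
          (a • f₃) ∙ (a • f₃) ≡⟨ identityʳ _ ⟨
          ((a • f₃) ∙ (a • f₃)) ∙ ε ∎)

      partner-coordinate : ∀ {z z′ a f r f₃} → z ∙ z′ ≡ r → z ≡ (a • f₃) ∙ f → f ∙ f ≡ ε → z′ ∙ (a • f₃) ≡ r ∙ f
      partner-coordinate {z} {z′} {a} {f} {r} {f₃} e refl f²≡ε = begin
          z′ ∙ (a • f₃) ≡⟨ trans (sym (identityʳ _)) (cong ((z′ ∙ (a • f₃)) ∙_) (sym f²≡ε)) ⟩
          (z′ ∙ (a • f₃)) ∙ (f ∙ f) ≡⟨ solve 3 (λ z a f → (z ⊕ a) ⊕ (f ⊕ f) ⊜ ((a ⊕ f) ⊕ z) ⊕ f) refl z′ (a • f₃) f ⟩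
          (((a • f₃) ∙ f) ∙ z′) ∙ f ≡⟨ cong (_∙ f) e ⟩
          r ∙ f ∎
        where
        open ≡-Reasoning
        open ∙-Solver using (solve; _⊕_; _⊜_)

    double-replicate : ∀ j (b : A) → b ∷ (replicate j b ++ replicate j b) ≡ replicate (suc (j + j)) b
    double-replicate j b = cong (b ∷_) (replicate-+ j j)

    sum-square : ∀ S → All (λ b → b ∙ b ≡ ε) S → sum S ∙ sum S ≡ ε
    sum-square [] [] = identityʳ ε
    sum-square (b ∷ S) (e ∷ es) = trans (∙-interchange b (sum S) b (sum S)) (trans (cong₂ _∙_ e (sum-square S es)) (identityʳ ε))

    two-values : ∀ {b c : A} (T : List A) → All (λ t → t ≡ b ⊎ t ≡ c) T → ∃[ i ] ∃[ j ] (T ↭ replicate i b ++ replicate j c × i + j ≡ length T)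
    two-values {b} {c} T t∈ =
      let U , V , p , u , v = All⊎⇒↭-++ T t∈
      in length U , length V , ↭-trans p (↭-reflexive (cong₂ _++_ (All≡⇒replicate U u) (All≡⇒replicate V v))) ,
         trans (sym (length-++ U)) (sym (↭-length p))

    three-values : ∀ {b c d : A} (T : List A) → All (λ t → t ≡ b ⊎ t ≡ c ⊎ t ≡ d) T →
      ∃[ i ] ∃[ j ] ∃[ l ] (T ↭ replicate i b ++ replicate j c ++ replicate l d × (i + j) + l ≡ length T)
    three-values {b} {c} {d} T t∈ =
      let U , V , p , u , v = All⊎⇒↭-++ T t∈
          j , l , q , e = two-values V v
      in length U , j , l , ↭-trans p (↭-++⁺ (↭-reflexive (All≡⇒replicate U u)) q) ,
         trans (+-assoc (length U) j l) (trans (cong (length U +_) e) (trans (sym (length-++ U)) (sym (↭-length p))))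

    module _ {S : List A} (N : Normalised S) where

      open Normalised N

      -- The basis is `p₂`, `p₃`, `s`, and `q₂ = s + p₂`, `q₃ = s + p₃`. Subtracting `s` from the
      -- terms with double `g` gives one copy each of `ε`, `p₂`, `p₃` and twice a list `D` of
      -- torsion elements. The doubled part has sum `ε`, so `sum d = p₂ + p₃`, which independence
      -- keeps apart from `ε`, `p₂` and `p₃`.
      form₃ : Torsion p₂ → Torsion p₃ → Form₃ S
      form₃ t₂ t₃ =
        let α , β , γ , pX , e = three-values X (All.map (λ (b∈ , b²) → X-value (∈X⇒ (inj₁ t₂) (inj₁ t₃) b∈ b²)) double-X)
        in record
        { basis = record { square₁ = t₂ ; square₂ = t₃ ; K-square₃ = cl-square s ; order₃ = subst OrderN (sym double-s) order ; independent = LI }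
        ; α = α ; β = β ; γ = γ ; d = d ; α+β+γ = trans e length-X
        ; length-d = cong (suc ∘ suc ∘ suc) (trans (length-++ D) (trans (cong₂ _+_ length-D length-D) (sym (+-suc k (suc k)))))
        ; d∈ = d∈
        ; sum∉ = λ σ∈ → sum-d≢ (All.lookup d∈ σ∈)
        ; split = ↭-trans split (↭-trans (rearrange α β γ pX) (↭-reflexive (cong₂ _++_ (double-replicate α ε) (cong₂ _++_ (double-replicate β p₂)
            (cong₂ _++_ (double-replicate γ p₃) (sym map-d))))))
        }
        where
        X-value : ∀ {b} → b ≡ ε ⊎ (Torsion p₂ × b ≡ p₂) ⊎ (Torsion p₃ × b ≡ p₃) → b ≡ ε ⊎ b ≡ p₂ ⊎ b ≡ p₃
        X-value (inj₁ e) = inj₁ e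
        X-value (inj₂ (inj₁ (_ , e))) = inj₂ (inj₁ e)
        X-value (inj₂ (inj₂ (_ , e))) = inj₂ (inj₂ e)
        q₂≡ = proj₂ (torsion-partner pair₂ t₂)
        q₃≡ = proj₂ (torsion-partner pair₃ t₃)
        D d : List A
        D = map ((s ⁻¹) ∙_) Y
        d = ε ∷ p₂ ∷ p₃ ∷ (D ++ D)
        length-D : length D ≡ suc k
        length-D = trans (length-map ((s ⁻¹) ∙_) Y) length-Y
        Y-value : ∀ {b} → b ≡ s ⊎ (Torsion p₂ × b ≡ q₂) ⊎ (Torsion p₃ × b ≡ q₃) → (s ⁻¹) ∙ b ≡ ε ⊎ (s ⁻¹) ∙ b ≡ p₂ ⊎ (s ⁻¹) ∙ b ≡ p₃
        Y-value (inj₁ refl) = inj₁ (inverseˡ s)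
        Y-value (inj₂ (inj₁ (_ , refl))) = inj₂ (inj₁ (trans (cong ((s ⁻¹) ∙_) q₂≡) (⁻¹-∙-cancelˡ s p₂)))
        Y-value (inj₂ (inj₂ (_ , refl))) = inj₂ (inj₂ (trans (cong ((s ⁻¹) ∙_) q₃≡) (⁻¹-∙-cancelˡ s p₃)))
        D∈ : All (λ b → b ≡ ε ⊎ b ≡ p₂ ⊎ b ≡ p₃) D
        D∈ = Allₚ.map⁺ (All.map (λ (b∈ , b²) → Y-value (∈Y⇒ (inj₁ t₂) (inj₁ t₃) b∈ b²)) double-Y)
        d∈ : All (λ b → b ≡ ε ⊎ b ≡ p₂ ⊎ b ≡ p₃) d
        d∈ = inj₁ refl ∷ inj₂ (inj₁ refl) ∷ inj₂ (inj₂ refl) ∷ Allₚ.++⁺ D∈ D∈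
        torsion : ∀ {b} → b ≡ ε ⊎ b ≡ p₂ ⊎ b ≡ p₃ → b ∙ b ≡ ε
        torsion (inj₁ refl) = identityʳ ε
        torsion (inj₂ (inj₁ refl)) = t₂
        torsion (inj₂ (inj₂ refl)) = t₃
        sum-d : sum d ≡ p₂ ∙ p₃
        sum-d = trans (identityˡ _) (cong (p₂ ∙_) (trans (cong (p₃ ∙_)
          (trans (sum-++ D D) (sum-square D (All.map torsion D∈)))) (identityʳ p₃)))
        cl-ε′ : ∀ {b} → b ≡ ε → cl b ≡ 0V
        cl-ε′ e = trans (cong cl e) cl-ε
        sum-d≢ : ¬ (sum d ≡ ε ⊎ sum d ≡ p₂ ⊎ sum d ≡ p₃)
        sum-d≢ (inj₁ e) with () ← proj₁ (LI true true false (trans (cong (cl p₂ ⊞_) (V.identityʳ (cl p₃)))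
          (trans (sym (cl-∙ p₂ p₃)) (cl-ε′ (trans (sym sum-d) e)))))
        sum-d≢ (inj₂ (inj₁ e)) with () ← proj₁ (proj₂ (LI false true false (trans (V.identityʳ (cl p₃))
          (cl-ε′ (identityʳ-unique p₂ p₃ (trans (sym sum-d) e))))))
        sum-d≢ (inj₂ (inj₂ e)) with () ← proj₁ (LI true false false (trans (V.identityʳ (cl p₂))
          (cl-ε′ (identityˡ-unique p₂ p₃ (trans (sym sum-d) e)))))
        map-d : map (s ∙_) d ≡ s ∷ q₂ ∷ q₃ ∷ (Y ++ Y)
        map-d = cong₂ _∷_ (identityʳ s) (cong₂ _∷_ (sym q₂≡) (cong₂ _∷_ (sym q₃≡)
          (trans (map-++ (s ∙_) D D) (cong₂ _++_ (map-translate-cancel s Y) (map-translate-cancel s Y)))))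
        rearrange : ∀ α β γ → X ↭ replicate α ε ++ replicate β p₂ ++ replicate γ p₃ →
          six″ ++ ((X ++ X) ++ (Y ++ Y)) ↭
            (ε ∷ (replicate α ε ++ replicate α ε)) ++ (p₂ ∷ (replicate β p₂ ++ replicate β p₂)) ++
            (p₃ ∷ (replicate γ p₃ ++ replicate γ p₃)) ++ (s ∷ q₂ ∷ q₃ ∷ (Y ++ Y))
        rearrange α β γ p = ↭-trans (↭-++⁺ˡ six″ (↭-++⁺ʳ (Y ++ Y) (↭-++⁺ p p)))
          (solve 10 (λ e s p q p′ q′ A B C Y →
              (e ⊕ (s ⊕ (p ⊕ (q ⊕ (p′ ⊕ q′))))) ⊕ (((A ⊕ (B ⊕ C)) ⊕ (A ⊕ (B ⊕ C))) ⊕ (Y ⊕ Y)) ⊜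
              (e ⊕ (A ⊕ A)) ⊕ ((p ⊕ (B ⊕ B)) ⊕ ((p′ ⊕ (C ⊕ C)) ⊕ (s ⊕ (q ⊕ (q′ ⊕ (Y ⊕ Y)))))))
            refl [ ε ] [ s ] [ p₂ ] [ q₂ ] [ p₃ ] [ q₃ ] (replicate α ε) (replicate β p₂) (replicate γ p₃) Y)
          where open ++-Solver using (solve; _⊕_; _⊜_)

      -- In (s1) the last two terms have sum `f₃ + f₂`, and here the generic pair has sum `s`. This
      -- dictates `f₂ = p₂` and `f₃ = q₂` with `s = f₃ + f₂`; `f₁` is the torsion part of `p₃`.
      form₁ : Torsion p₂ → Generic p₃ → Form₁ S
      form₁ t₂ g₃ =
        let a , f₁ , 2≤a , a≤ , f₁²≡ε , z≡ , cl-f₁ = generic-coordinate q₂²≡g g₃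
            α , γ , pX , eX = two-values X (All.map (λ (b∈ , b²) → X-value (∈X⇒ (inj₁ t₂) (inj₂ g₃) b∈ b²)) double-X)
            β , δ , pY , eY = two-values Y (All.map (λ (b∈ , b²) → Y-value (∈Y⇒ (inj₁ t₂) (inj₂ g₃) b∈ b²)) double-Y)
        in record
        { basis = record
          { square₁ = f₁²≡ε ; square₂ = t₂
          ; K-square₃ = cl-square q₂
          ; order₃ = subst OrderN (sym q₂²≡g) order
          ; independent = subst (λ c → LinearlyIndependent c (cl p₂) (cl q₂)) (sym cl-f₁) (LI-add₃₁ (parity a) LI′)
          }
        ; a = a ; α = α ; β = β ; γ = γ ; δ = δ ; 2≤a = 2≤a ; a≤ = a≤
        ; α+γ = trans eX length-X
        ; δ+β = trans (+-comm δ β) (trans eY length-Y)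
        ; z≡ = z≡
        ; z′≡ = partner-coordinate {a = a} (trans pair₃ s≡) z≡ f₁²≡ε
        ; split = ↭-trans split (↭-trans (rearrange α γ β δ pX pY) (↭-reflexive (cong₂ _++_ (double-replicate α ε) (cong₂ _++_ (double-replicate γ p₂)
            (cong₂ _++_ (double-replicate δ q₂) (cong₂ _++_ (trans (cong (λ b → b ∷ (replicate β b ++ replicate β b)) s≡) (double-replicate β (q₂ ∙ p₂))) refl))))))
        }
        where
        q₂²≡g = proj₁ (torsion-partner pair₂ t₂)
        s≡ : s ≡ q₂ ∙ p₂
        s≡ = trans (sym pair₂) (comm p₂ q₂)
        LI′ : LinearlyIndependent (cl p₃) (cl p₂) (cl q₂)
        LI′ = subst (LinearlyIndependent (cl p₃) (cl p₂)) (sym (cl-partner pair₂)) (LI-add₂₃ (LI-swap LI))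
        X-value : ∀ {b} → b ≡ ε ⊎ (Torsion p₂ × b ≡ p₂) ⊎ (Torsion p₃ × b ≡ p₃) → b ≡ ε ⊎ b ≡ p₂
        X-value (inj₁ e) = inj₁ e
        X-value (inj₂ (inj₁ (_ , e))) = inj₂ e
        X-value (inj₂ (inj₂ (t , _))) = ⊥-elim (proj₁ g₃ t)
        Y-value : ∀ {b} → b ≡ s ⊎ (Torsion p₂ × b ≡ q₂) ⊎ (Torsion p₃ × b ≡ q₃) → b ≡ s ⊎ b ≡ q₂
        Y-value (inj₁ e) = inj₁ e
        Y-value (inj₂ (inj₁ (_ , e))) = inj₂ e
        Y-value (inj₂ (inj₂ (t , _))) = ⊥-elim (proj₁ g₃ t)
        rearrange : ∀ α γ β δ → X ↭ replicate α ε ++ replicate γ p₂ → Y ↭ replicate β s ++ replicate δ q₂ →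
          six″ ++ ((X ++ X) ++ (Y ++ Y)) ↭
            (ε ∷ (replicate α ε ++ replicate α ε)) ++ (p₂ ∷ (replicate γ p₂ ++ replicate γ p₂)) ++
            (q₂ ∷ (replicate δ q₂ ++ replicate δ q₂)) ++ (s ∷ (replicate β s ++ replicate β s)) ++ p₃ ∷ q₃ ∷ []
        rearrange α γ β δ p p′ = ↭-trans (↭-++⁺ˡ six″ (↭-++⁺ (↭-++⁺ p p) (↭-++⁺ p′ p′)))
          (solve 10 (λ e s p q p′ q′ A B C D →
              (e ⊕ (s ⊕ (p ⊕ (q ⊕ (p′ ⊕ q′))))) ⊕ (((A ⊕ B) ⊕ (A ⊕ B)) ⊕ ((C ⊕ D) ⊕ (C ⊕ D))) ⊜
              (e ⊕ (A ⊕ A)) ⊕ ((p ⊕ (B ⊕ B)) ⊕ ((q ⊕ (D ⊕ D)) ⊕ ((s ⊕ (C ⊕ C)) ⊕ (p′ ⊕ q′)))))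
            refl [ ε ] [ s ] [ p₂ ] [ q₂ ] [ p₃ ] [ q₃ ] (replicate α ε) (replicate γ p₂) (replicate β s) (replicate δ q₂))
          where open ++-Solver using (solve; _⊕_; _⊜_)

      -- No generic element is repeated, so `X` contains only `ε` and `Y` only `s`, which becomes
      -- `f₃`. The torsion parts of `p₂` and `p₃` are `f₂` and `f₁`.
      form₂ : Generic p₂ → Generic p₃ → Form₂ S
      form₂ g₂ g₃ =
        let a , f₂ , 2≤a , a≤ , f₂²≡ε , z₂≡ , cl-f₂ = generic-coordinate double-s g₂
            b , f₁ , 2≤b , b≤ , f₁²≡ε , z₁≡ , cl-f₁ = generic-coordinate double-s g₃
        in record
        { basis = record
          { square₁ = f₁²≡ε ; square₂ = f₂²≡ε
          ; K-square₃ = cl-square s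
          ; order₃ = subst OrderN (sym double-s) order
          ; independent = subst (λ c → LinearlyIndependent c (cl f₂) (cl s)) (sym cl-f₁) (LI-add₃₁ (parity b) (LI-swap
              (subst (λ c → LinearlyIndependent c (cl p₃) (cl s)) (sym cl-f₂) (LI-add₃₁ (parity a) LI))))
          }
        ; a = a ; b = b ; 2≤a = 2≤a ; a≤ = a≤ ; 2≤b = 2≤b ; b≤ = b≤
        ; z₂≡ = z₂≡
        ; z₂′≡ = partner-coordinate {a = a} pair₂ z₂≡ f₂²≡ε
        ; z₁≡ = z₁≡
        ; z₁′≡ = partner-coordinate {a = b} pair₃ z₁≡ f₁²≡ε
        ; split = ↭-trans split (↭-trans rearrange (↭-reflexive (cong₂ _++_
            (trans (cong (λ T → ε ∷ (T ++ T)) X≡) (double-replicate (suc k) ε))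
            (cong₂ _++_ (trans (cong (λ T → s ∷ (T ++ T)) Y≡) (double-replicate (suc k) s)) refl))))
        }
        where
        X-value : ∀ {b} → b ≡ ε ⊎ (Torsion p₂ × b ≡ p₂) ⊎ (Torsion p₃ × b ≡ p₃) → b ≡ ε
        X-value (inj₁ e) = e
        X-value (inj₂ (inj₁ (t , _))) = ⊥-elim (proj₁ g₂ t)
        X-value (inj₂ (inj₂ (t , _))) = ⊥-elim (proj₁ g₃ t)
        Y-value : ∀ {b} → b ≡ s ⊎ (Torsion p₂ × b ≡ q₂) ⊎ (Torsion p₃ × b ≡ q₃) → b ≡ s
        Y-value (inj₁ e) = e
        Y-value (inj₂ (inj₁ (t , _))) = ⊥-elim (proj₁ g₂ t)
        Y-value (inj₂ (inj₂ (t , _))) = ⊥-elim (proj₁ g₃ t)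
        X≡ : X ≡ replicate (suc k) ε
        X≡ = trans (All≡⇒replicate X (All.map (λ (b∈ , b²) → X-value (∈X⇒ (inj₂ g₂) (inj₂ g₃) b∈ b²)) double-X))
          (cong (λ j → replicate j ε) length-X)
        Y≡ : Y ≡ replicate (suc k) s
        Y≡ = trans (All≡⇒replicate Y (All.map (λ (b∈ , b²) → Y-value (∈Y⇒ (inj₂ g₂) (inj₂ g₃) b∈ b²)) double-Y))
          (cong (λ j → replicate j s) length-Y)
        rearrange : six″ ++ ((X ++ X) ++ (Y ++ Y)) ↭ (ε ∷ (X ++ X)) ++ (s ∷ (Y ++ Y)) ++ p₂ ∷ q₂ ∷ p₃ ∷ q₃ ∷ []
        rearrange = solve 5 (λ e s r X Y → (e ⊕ (s ⊕ r)) ⊕ ((X ⊕ X) ⊕ (Y ⊕ Y)) ⊜ (e ⊕ (X ⊕ X)) ⊕ ((s ⊕ (Y ⊕ Y)) ⊕ r))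
            refl [ ε ] [ s ] (p₂ ∷ q₂ ∷ p₃ ∷ q₃ ∷ []) X Y
          where open ++-Solver using (solve; _⊕_; _⊜_)

      permute : ∀ p₂′ q₂′ p₃′ q₃′ → p₂ ∷ q₂ ∷ p₃ ∷ q₃ ∷ [] ↭ p₂′ ∷ q₂′ ∷ p₃′ ∷ q₃′ ∷ [] → p₂′ ∙ q₂′ ≡ s → p₃′ ∙ q₃′ ≡ s → Normalised S
      permute p₂′ q₂′ p₃′ q₃′ p e₂ e₃ = record
        { g = g ; s = s ; p₂ = p₂′ ; q₂ = q₂′ ; p₃ = p₃′ ; q₃ = q₃′ ; Kg = Kg ; order = order ; pair₂ = e₂ ; pair₃ = e₃ ; double-s = double-s
        ; distinct = Unique-resp-↭ (↭-map⁺ cl p₆) distinct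
        ; X = X ; Y = Y
        ; split = ↭-trans split (↭-++⁺ʳ _ p₆)
        ; double-X = All.map (λ (b∈ , e) → ∈-resp-↭ p₆ b∈ , e) double-X
        ; double-Y = All.map (λ (b∈ , e) → ∈-resp-↭ p₆ b∈ , e) double-Y
        ; length-X = length-X ; length-Y = length-Y }
        where
        p₆ = prep ε (prep s p)

      swap₂ swap₃ exchange : Normalised S
      swap₂ = permute q₂ p₂ p₃ q₃ (swap p₂ q₂ refl) (trans (comm q₂ p₂) pair₂) pair₃
      swap₃ = permute p₂ q₂ q₃ p₃ (prep p₂ (prep q₂ (swap p₃ q₃ refl))) pair₂ (trans (comm q₃ p₃) pair₃)
      exchange = permute p₃ q₃ p₂ q₂ (++-comm (p₂ ∷ q₂ ∷ []) (p₃ ∷ q₃ ∷ [])) pair₃ pair₂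

      -- If `2p = g` then `2q = ε`, so a pair without torsion elements has a generic first member;
      -- otherwise the pair can be turned so that its first member is torsion.
      torsion? : ∀ {p q} → p ∙ q ≡ s → Type p ⊎ Torsion q
      torsion? {p} {q} e with (p ∙ p) ≟ ε | (q ∙ q) ≟ ε
      ... | yes t | _ = inj₁ (inj₁ t)
      ... | no _ | yes t = inj₂ t
      ... | no ¬t | no ¬t′ = inj₁ (inj₂ (¬t , λ p²≡g → ¬t′ (∙-cancelˡ g _ _
                (trans (cong (_∙ (q ∙ q)) (sym p²≡g)) (trans (squares e) (sym (identityʳ g)))))))

    Forms : List A → Set
    Forms S = Form₁ S ⊎ Form₂ S ⊎ Form₃ S

    classify-typed : ∀ {S} (N : Normalised S) → Normalised.Type N (Normalised.p₂ N) → Normalised.Type N (Normalised.p₃ N) → Forms S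
    classify-typed N (inj₁ t₂) (inj₁ t₃) = inj₂ (inj₂ (form₃ N t₂ t₃))
    classify-typed N (inj₁ t₂) (inj₂ g₃) = inj₁ (form₁ N t₂ g₃)
    classify-typed N (inj₂ g₂) (inj₁ t₃) = inj₁ (form₁ (exchange N) t₃ g₂)
    classify-typed N (inj₂ g₂) (inj₂ g₃) = inj₂ (inj₁ (form₂ N g₂ g₃))

    classify : ∀ {S} → Normalised S → Forms S
    classify N with torsion? N (Normalised.pair₂ N) | torsion? N (Normalised.pair₃ N)
    ... | inj₁ t₂ | inj₁ t₃ = classify-typed N t₂ t₃
    ... | inj₂ t₂ | inj₁ t₃ = classify-typed (swap₂ N) (inj₁ t₂) t₃
    ... | inj₁ t₂ | inj₂ t₃ = classify-typed (swap₃ N) t₂ (inj₁ t₃)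
    ... | inj₂ t₂ | inj₂ t₃ = classify-typed (swap₃ (swap₂ N)) (inj₁ t₂) (inj₁ t₃)

    -- Translation to normalised position.

    map-cl-translate : ∀ z T → map (cl z ⊞_) (map cl T) ≡ map cl (map (z ∙_) T)
    map-cl-translate z [] = refl
    map-cl-translate z (b ∷ T) = cong₂ _∷_ (sym (cl-∙ z b)) (map-cl-translate z T)

    module _ {S : List A} (St : Structure S) where

      open Structure St

      -- Translation by −p₁, where p₁ + p₁ = x, turns the two pair sums x and x + g into 0 and g.
      normalise : ∀ {p₁ q₁ p₂ q₂ p₃ q₃} → six′ ↭ p₁ ∷ q₁ ∷ p₂ ∷ q₂ ∷ p₃ ∷ q₃ ∷ [] →
        p₁ ∙ q₁ ≡ s → p₂ ∙ q₂ ≡ s → p₃ ∙ q₃ ≡ s → p₁ ∙ p₁ ≡ x → Normalised (map ((p₁ ⁻¹) ∙_) S)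
      normalise {p₁} {q₁} {p₂} {q₂} {p₃} {q₃} perm e₁ e₂ e₃ p₁²≡x = record
        { g = g ; s = τ q₁ ; p₂ = τ p₂ ; q₂ = τ q₂ ; p₃ = τ p₃ ; q₃ = τ q₃ ; Kg = Kg ; order = order
        ; pair₂ = τ-pair e₂ ; pair₃ = τ-pair e₃
        ; double-s = trans (τ-square q₁) (trans (cong ((z ∙ z) ∙_) q₁²≡y) zzy)
        ; distinct = Unique-resp-↭ (↭-map⁺ cl τ-six) (subst Unique (map-cl-translate z six′)
            (V.map-∙-Unique (cl z) distinct))
        ; X = map τ X ; Y = map τ Y
        ; split = ↭-trans (↭-map⁺ τ split) (↭-trans (↭-reflexive map-split) (↭-++⁺ʳ _ τ-six))
        ; double-X = Allₚ.map⁺ (All.map (λ {b} (b∈ , e) → ∈-resp-↭ τ-six (∈-map⁺ τ b∈) , trans (τ-square b) (trans (cong ((z ∙ z) ∙_) e) zzx)) double-X)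
        ; double-Y = Allₚ.map⁺ (All.map (λ {b} (b∈ , e) → ∈-resp-↭ τ-six (∈-map⁺ τ b∈) , trans (τ-square b) (trans (cong ((z ∙ z) ∙_) e) zzy)) double-Y)
        ; length-X = trans (length-map τ X) length-X ; length-Y = trans (length-map τ Y) length-Y
        }
        where
        z = p₁ ⁻¹
        τ : A → A
        τ b = z ∙ b
        τ-square : ∀ b → τ b ∙ τ b ≡ (z ∙ z) ∙ (b ∙ b)
        τ-square b = ∙-interchange z b z b
        zzx : (z ∙ z) ∙ x ≡ ε
        zzx = trans (cong ((z ∙ z) ∙_) (sym p₁²≡x)) (trans (∙-interchange z z p₁ p₁) (trans (cong₂ _∙_ (inverseˡ p₁) (inverseˡ p₁)) (identityʳ ε)))
        zzy : (z ∙ z) ∙ y ≡ g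
        zzy = trans (sym (assoc (z ∙ z) x g)) (trans (cong (_∙ g) zzx) (identityˡ g))
        q₁²≡y : q₁ ∙ q₁ ≡ y
        q₁²≡y = ∙-cancelˡ x _ _ (trans (cong (_∙ (q₁ ∙ q₁)) (sym p₁²≡x)) (trans (∙-interchange p₁ p₁ q₁ q₁) (trans (cong₂ _∙_ e₁ e₁) double-s)))
        τ-pair : ∀ {p q} → p ∙ q ≡ s → τ p ∙ τ q ≡ τ q₁
        τ-pair {p} {q} e = trans (∙-interchange z p z q) (trans (cong ((z ∙ z) ∙_) (trans e (sym e₁)))
          (trans (∙-interchange z z p₁ q₁) (trans (cong (_∙ τ q₁) (inverseˡ p₁)) (identityˡ _))))
        τ-six : map τ six′ ↭ ε ∷ τ q₁ ∷ τ p₂ ∷ τ q₂ ∷ τ p₃ ∷ τ q₃ ∷ []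
        τ-six = ↭-trans (↭-map⁺ τ perm) (↭-reflexive (cong (_∷ τ q₁ ∷ τ p₂ ∷ τ q₂ ∷ τ p₃ ∷ τ q₃ ∷ []) (inverseˡ p₁)))
        map-split : map τ (six′ ++ ((X ++ X) ++ (Y ++ Y))) ≡ map τ six′ ++ ((map τ X ++ map τ X) ++ (map τ Y ++ map τ Y))
        map-split = trans (map-++ τ six′ _) (cong (map τ six′ ++_) (trans (map-++ τ (X ++ X) (Y ++ Y)) (cong₂ _++_ (map-++ τ X X) (map-++ τ Y Y))))

      -- As `X` has `n - 1` entries it is nonempty, so one of the six has double `x`. The cases move
      -- it and its partner to the front.
      normalise-some : ∃[ f ] Normalised (map ((f ⁻¹) ∙_) S)
      normalise-some = go X length-X double-X
        where
        reversed : ∀ {p q} → p ∙ q ≡ s → q ∙ p ≡ s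
        reversed {p} {q} e = trans (comm q p) e
        first-pair : List A
        first-pair = p₁ ∷ q₁ ∷ []
        base : ∀ {b} → b ∈ six′ → b ∙ b ≡ x → ∃[ f ] Normalised (map ((f ⁻¹) ∙_) S)
        base (here refl) e = p₁ , normalise refl pair₁ pair₂ pair₃ e
        base (there (here refl)) e = q₁ , normalise (swap p₁ q₁ refl) (reversed pair₁) pair₂ pair₃ e
        base (there (there (here refl))) e = p₂ , normalise (↭-++⁺ʳ (p₃ ∷ q₃ ∷ []) (++-comm first-pair (p₂ ∷ q₂ ∷ []))) pair₂ pair₁ pair₃ e
        base (there (there (there (here refl)))) e = q₂ , normalise
          (↭-trans (↭-++⁺ʳ (p₃ ∷ q₃ ∷ []) (++-comm first-pair (p₂ ∷ q₂ ∷ []))) (swap p₂ q₂ refl)) (reversed pair₂) pair₁ pair₃ e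
        base (there (there (there (there (here refl))))) e = p₃ , normalise (++-comm (p₁ ∷ q₁ ∷ p₂ ∷ q₂ ∷ []) (p₃ ∷ q₃ ∷ [])) pair₃ pair₁ pair₂ e
        base (there (there (there (there (there (here refl)))))) e = q₃ , normalise
          (↭-trans (++-comm (p₁ ∷ q₁ ∷ p₂ ∷ q₂ ∷ []) (p₃ ∷ q₃ ∷ [])) (swap p₃ q₃ refl)) (reversed pair₃) pair₁ pair₂ e
        go : ∀ X → length X ≡ suc k → All (λ b → b ∈ six′ × b ∙ b ≡ x) X → ∃[ f ] Normalised (map ((f ⁻¹) ∙_) S)
        go (_ ∷ _) _ ((b∈ , e) ∷ _) = base b∈ e

    forms : ∀ {S} → Free S → length S ≡ ((n + n) + (n + n)) + 2 → ∃[ f ] Forms (map ((f ⁻¹) ∙_) S)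
    forms free lS = let f , N = normalise-some (structure free lS) in f , classify N

    -- Bases and orders from independent classes.

    infixr 8 _⊛_
    _⊛_ : ℤ → A → A
    (ℤ.+ m) ⊛ f = m • f
    -[1+ m ] ⊛ f = (suc m • f) ⁻¹

    cl-⊛ : ∀ a f → cl (a ⊛ f) ≡ parity ∣ a ∣ ⋆ cl f
    cl-⊛ (ℤ.+ m) f = cl-• m f
    cl-⊛ -[1+ m ] f = trans (cl-⁻¹ (suc m • f)) (cl-• (suc m) f)

    even-• : ∀ m {f} → f ∙ f ≡ ε → parity m ≡ false → m • f ≡ ε
    even-• m {f} f²≡ε e = let j , m≡ = parity≡false⇒double m e in
      trans (cong (_• f) m≡) (trans (•-+ j j f) (trans (sym (•-∙ j f f)) (trans (cong (j •_) f²≡ε) (•-ε j))))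

    even-⊛ : ∀ a {f} → f ∙ f ≡ ε → parity ∣ a ∣ ≡ false → a ⊛ f ≡ ε
    even-⊛ (ℤ.+ m) f²≡ε e = even-• m f²≡ε e
    even-⊛ -[1+ m ] {f} f²≡ε e = trans (sym (identityʳ _)) (trans (cong (((suc m • f) ⁻¹) ∙_) (sym (even-• (suc m) f²≡ε e))) (inverseˡ (suc m • f)))

    module _ {f₁ f₂ f₃ : A} (B : AdaptedBasis f₁ f₂ f₃) where

      open AdaptedBasis B

      cl-combination : ∀ {x₁ x₂ x₃} a b c → cl x₁ ≡ a ⋆ cl f₁ → cl x₂ ≡ b ⋆ cl f₂ → cl x₃ ≡ c ⋆ cl f₃ →
        cl ((x₁ ∙ x₂) ∙ x₃) ≡ combination (cl f₁) (cl f₂) (cl f₃) a b c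
      cl-combination {x₁} {x₂} {x₃} a b c e₁ e₂ e₃ = trans (cong cl (assoc x₁ x₂ x₃)) (trans (cl-∙ x₁ (x₂ ∙ x₃))
        (cong₂ _⊞_ e₁ (trans (cl-∙ x₂ x₃) (cong₂ _⊞_ e₂ e₃))))

      -- On classes the relation makes `a` and `b` even; the two torsion terms vanish, and the third
      -- vanishes with them.
      independent⇒ : ∀ a b c → ((a ⊛ f₁) ∙ (b ⊛ f₂)) ∙ (c ⊛ f₃) ≡ ε → a ⊛ f₁ ≡ ε × b ⊛ f₂ ≡ ε × c ⊛ f₃ ≡ ε
      independent⇒ a b c e =
        let a≡ , b≡ , _ = independent (parity ∣ a ∣) (parity ∣ b ∣) (parity ∣ c ∣)
              (trans (sym (cl-combination {a ⊛ f₁} {b ⊛ f₂} {c ⊛ f₃} (parity ∣ a ∣) (parity ∣ b ∣) (parity ∣ c ∣) (cl-⊛ a f₁) (cl-⊛ b f₂) (cl-⊛ c f₃)))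
                (trans (cong cl e) cl-ε))
            e₁ = even-⊛ a square₁ a≡
            e₂ = even-⊛ b square₂ b≡
        in e₁ , e₂ , trans (sym (trans (cong (_∙ (c ⊛ f₃)) (trans (cong₂ _∙_ e₁ e₂) (identityʳ ε))) (identityˡ _))) e

      -- A combination `h` with coefficients 0 and 1 has the class of `x`; the difference lies in
      -- `K`, which is exhausted by the multiples of `f₃ ∙ f₃`.
      generates : ∀ x → ∃[ a ] ∃[ b ] ∃[ c ] x ≡ ((a • f₁) ∙ (b • f₂)) ∙ (c • f₃)
      generates x = let a , b , c , e = LI-spans independent (cl x) in from-class a b c e
        where
        open ≡-Reasoning
        from-class : ∀ a b c → cl x ≡ combination (cl f₁) (cl f₂) (cl f₃) a b c →
          ∃[ a ] ∃[ b ] ∃[ c ] x ≡ ((a • f₁) ∙ (b • f₂)) ∙ (c • f₃)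
        from-class a b c e = let i , _ , e′ = multiples-exhaust K-square₃ order₃ K-rest in bit a , bit b , bit c + (i + i) , (begin
          x ≡⟨ ∙-⁻¹-cancelˡ h x ⟨
          h ∙ ((h ⁻¹) ∙ x) ≡⟨ cong (h ∙_) (trans e′ (trans (•-∙ i f₃ f₃) (sym (•-+ i i f₃)))) ⟩
          h ∙ ((i + i) • f₃) ≡⟨ assoc ((bit a • f₁) ∙ (bit b • f₂)) (bit c • f₃) ((i + i) • f₃) ⟩
          ((bit a • f₁) ∙ (bit b • f₂)) ∙ ((bit c • f₃) ∙ ((i + i) • f₃)) ≡⟨ cong (((bit a • f₁) ∙ (bit b • f₂)) ∙_) (•-+ (bit c) (i + i) f₃) ⟨
          ((bit a • f₁) ∙ (bit b • f₂)) ∙ ((bit c + (i + i)) • f₃) ∎)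
          where
          h = ((bit a • f₁) ∙ (bit b • f₂)) ∙ (bit c • f₃)
          cl-bit : ∀ d f → cl (bit d • f) ≡ d ⋆ cl f
          cl-bit d f = trans (cl-• (bit d) f) (cong (_⋆ cl f) (parity-bit d))
          cl-h : cl h ≡ cl x
          cl-h = trans (cl-combination {bit a • f₁} {bit b • f₂} {bit c • f₃} a b c (cl-bit a f₁) (cl-bit b f₂) (cl-bit c f₃)) (sym e)
          K-rest : K ((h ⁻¹) ∙ x)
          K-rest = trans (cl-∙ (h ⁻¹) x) (trans (cong (_⊞ cl x) (trans (cl-⁻¹ h) cl-h)) (⊞-self (cl x)))

      cl-f₁≢0 : cl f₁ ≢ 0V
      cl-f₁≢0 e with () ← proj₁ (independent true false false (trans (V.identityʳ (cl f₁)) e))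

      cl-f₂≢0 : cl f₂ ≢ 0V
      cl-f₂≢0 e with () ← proj₁ (proj₂ (independent false true false (trans (V.identityʳ (cl f₂)) e)))

      cl-f₃≢0 : cl f₃ ≢ 0V
      cl-f₃≢0 e with () ← proj₂ (proj₂ (independent false false true e))

      -- The non-zero class of `f₃` forces `m` to be even, and half of `m` annihilates `f₃ ∙ f₃`,
      -- whose order is `n`.
      order-f₃ : ∀ m → 0 < m → m • f₃ ≡ ε → n + n ≤ m
      order-f₃ m 0<m e = double (parity≡false⇒double m (even (parity m) refl))
        where
        even : ∀ b → parity m ≡ b → parity m ≡ false
        even false p = p
        even true p = ⊥-elim (cl-f₃≢0 (trans (cong (_⋆ cl f₃) (sym p)) (trans (sym (cl-• m f₃)) (trans (cong cl e) cl-ε))))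
        double : ∃[ j ] m ≡ j + j → n + n ≤ m
        double (zero , m≡) = ⊥-elim (<-irrefl (sym m≡) 0<m)
        double (suc j , m≡) = ≤-trans (+-mono-≤ n≤ n≤) (≤-reflexive (sym m≡))
          where
          n≤ : n ≤ suc j
          n≤ = ≮⇒≥ λ j<n → order₃ (suc j) (s≤s z≤n) (≤-pred j<n)
            (trans (•-∙ (suc j) f₃ f₃) (trans (sym (•-+ (suc j) (suc j) f₃)) (trans (cong (_• f₃) (sym m≡)) e)))

      order-f₃′ : (n + n) • f₃ ≡ ε
      order-f₃′ = trans (•-+ n n f₃) (trans (sym (•-∙ n f₃ f₃)) (exponent K-square₃))

    order-torsion : ∀ {f} → cl f ≢ 0V → ∀ m → 0 < m → m • f ≡ ε → 2 ≤ m
    order-torsion {f} cl-f 1 _ e = ⊥-elim (cl-f (trans (cong cl (trans (sym (identityʳ f)) e)) cl-ε))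
    order-torsion _ (suc (suc m)) _ _ = s≤s (s≤s z≤n)

-- The group C₂ ⊕ C₂ ⊕ C₂ₙ

module _ {m : ℕ} where

  private N = suc m

  toℕ-addZ : ∀ (a b : Fin N) → toℕ (addZ a b) ≡ (toℕ a + toℕ b) % N
  toℕ-addZ a b = Finₚ.toℕ-fromℕ< (m%n<n (toℕ a + toℕ b) N)

  toℕ-negZ : ∀ (a : Fin N) → toℕ (negZ a) ≡ (N ∸ toℕ a) % N
  toℕ-negZ a = Finₚ.toℕ-fromℕ< (m%n<n (N ∸ toℕ a) N)

  toℕ-% : ∀ (a : Fin N) → toℕ a % N ≡ toℕ a
  toℕ-% a = m<n⇒m%n≡m (Finₚ.toℕ<n a)

  %-+-% : ∀ x y → (x % N + y) % N ≡ (x + y) % N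
  %-+-% x y = trans (%-distribˡ-+ (x % N) y N) (trans (cong (λ z → (z + y % N) % N) (m%n%n≡m%n x N)) (sym (%-distribˡ-+ x y N)))

  addZ-comm : ∀ (a b : Fin N) → addZ a b ≡ addZ b a
  addZ-comm a b = cong (_mod N) (+-comm (toℕ a) (toℕ b))

  addZ-assoc : ∀ (a b c : Fin N) → addZ (addZ a b) c ≡ addZ a (addZ b c)
  addZ-assoc a b c = Finₚ.toℕ-injective (begin
    toℕ (addZ (addZ a b) c) ≡⟨ toℕ-addZ (addZ a b) c ⟩
    (toℕ (addZ a b) + toℕ c) % N ≡⟨ cong (λ z → (z + toℕ c) % N) (toℕ-addZ a b) ⟩
    ((toℕ a + toℕ b) % N + toℕ c) % N ≡⟨ %-+-% (toℕ a + toℕ b) (toℕ c) ⟩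
    ((toℕ a + toℕ b) + toℕ c) % N ≡⟨ cong (_% N) (trans (+-assoc (toℕ a) (toℕ b) (toℕ c)) (+-comm (toℕ a) (toℕ b + toℕ c))) ⟩
    ((toℕ b + toℕ c) + toℕ a) % N ≡⟨ %-+-% (toℕ b + toℕ c) (toℕ a) ⟨
    ((toℕ b + toℕ c) % N + toℕ a) % N ≡⟨ cong (λ z → (z + toℕ a) % N) (toℕ-addZ b c) ⟨
    (toℕ (addZ b c) + toℕ a) % N ≡⟨ cong (_% N) (+-comm (toℕ (addZ b c)) (toℕ a)) ⟩
    (toℕ a + toℕ (addZ b c)) % N ≡⟨ toℕ-addZ a (addZ b c) ⟨
    toℕ (addZ a (addZ b c)) ∎)
    where open ≡-Reasoning

  addZ-identityˡ : ∀ (a : Fin N) → addZ Fin.zero a ≡ a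
  addZ-identityˡ a = Finₚ.toℕ-injective (trans (toℕ-addZ Fin.zero a) (toℕ-% a))

  addZ-inverseʳ : ∀ (a : Fin N) → addZ a (negZ a) ≡ Fin.zero
  addZ-inverseʳ a = Finₚ.toℕ-injective (begin
    toℕ (addZ a (negZ a)) ≡⟨ toℕ-addZ a (negZ a) ⟩
    (toℕ a + toℕ (negZ a)) % N ≡⟨ cong (λ z → (toℕ a + z) % N) (toℕ-negZ a) ⟩
    (toℕ a + (N ∸ toℕ a) % N) % N ≡⟨ cong (_% N) (+-comm (toℕ a) ((N ∸ toℕ a) % N)) ⟩
    ((N ∸ toℕ a) % N + toℕ a) % N ≡⟨ %-+-% (N ∸ toℕ a) (toℕ a) ⟩
    ((N ∸ toℕ a) + toℕ a) % N ≡⟨ cong (_% N) (m∸n+n≡m (<⇒≤ (Finₚ.toℕ<n a))) ⟩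
    N % N ≡⟨ n%n≡0 N ⟩
    0 ∎)
    where open ≡-Reasoning

  -- Reduction by an even modulus keeps the parity, which makes `class` additive on residues.
  parity-% : parity N ≡ false → ∀ x → parity (x % N) ≡ parity x
  parity-% e x = sym (trans (cong parity (m≡m%n+[m/n]*n x N)) (trans (parity-+ (x % N) ((x / N) * N))
    (trans (cong (parity (x % N) xor_) (even-* (x / N))) (Boolₚ.xor-identityʳ (parity (x % N))))))
    where
    even-* : ∀ q → parity (q * N) ≡ false
    even-* zero = refl
    even-* (suc q) = trans (parity-+ N (q * N)) (cong₂ _xor_ e (even-* q))

  parity-addZ : parity N ≡ false → ∀ (a b : Fin N) → parity (toℕ (addZ a b)) ≡ parity (toℕ a) xor parity (toℕ b)
  parity-addZ e a b = trans (cong parity (toℕ-addZ a b)) (trans (parity-% e (toℕ a + toℕ b)) (parity-+ (toℕ a) (toℕ b)))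

  addZ-isAbelianGroup : IsAbelianGroup _≡_ (addZ {N}) Fin.zero negZ
  addZ-isAbelianGroup = record
    { isGroup = record
      { isMonoid = record
        { isSemigroup = record { isMagma = record { isEquivalence = isEquivalence ; ∙-cong = cong₂ addZ } ; assoc = addZ-assoc }
        ; identity = addZ-identityˡ , λ a → trans (addZ-comm a Fin.zero) (addZ-identityˡ a) }
      ; inverse = (λ a → trans (addZ-comm (negZ a) a) (addZ-inverseʳ a)) , addZ-inverseʳ
      ; ⁻¹-cong = cong negZ }
    ; comm = addZ-comm }

module Z (m : ℕ) = FinAbGroup (addZ {suc m}) Fin.zero negZ addZ-isAbelianGroup Finₚ._≟_

toℕ-• : ∀ {m} i (a : Fin (suc m)) → toℕ (Z._•_ m i a) ≡ (i * toℕ a) % suc m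
toℕ-• zero a = refl
toℕ-• {m} (suc i) a = trans (toℕ-addZ a (Z._•_ m i a)) (trans (cong (λ z → (toℕ a + z) % suc m) (toℕ-• i a))
  (trans (cong (_% suc m) (+-comm (toℕ a) ((i * toℕ a) % suc m))) (trans (%-+-% (i * toℕ a) (toℕ a)) (cong (_% suc m) (+-comm (i * toℕ a) (toℕ a))))))

module Concrete (k : ℕ) where

  private
    n = suc (suc k)
    -- The predecessor of `2 * n` in normal form, so that `Fin (2 * n)` is `Fin (suc m)` by
    -- computation.
    m = suc (k + suc (suc (k + 0)))


  ⟨⟩-≡ : ∀ {a a′ b b′ : Fin 2} {c c′ : Fin (2 * n)} → a ≡ a′ → b ≡ b′ → c ≡ c′ → ⟨_,_,_⟩ {n} a b c ≡ ⟨ a′ , b′ , c′ ⟩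
  ⟨⟩-≡ refl refl refl = refl

  G-isAbelianGroup : IsAbelianGroup _≡_ (_+G_ {n}) (0G {n}) -G_
  G-isAbelianGroup = record
    { isGroup = record
      { isMonoid = record
        { isSemigroup = record
          { isMagma = record { isEquivalence = isEquivalence ; ∙-cong = cong₂ _+G_ }
          ; assoc = λ { ⟨ a , b , c ⟩ ⟨ a′ , b′ , c′ ⟩ ⟨ a″ , b″ , c″ ⟩ → ⟨⟩-≡ (addZ-assoc a a′ a″) (addZ-assoc b b′ b″) (addZ-assoc c c′ c″) } }
        ; identity = idˡ , λ x → trans (+G-comm x 0G) (idˡ x) }
      ; inverse = (λ x → trans (+G-comm (-G x) x) (invʳ x)) , invʳ
      ; ⁻¹-cong = cong -G_ }
    ; comm = +G-comm }
    where
    +G-comm : ∀ (x y : G n) → x +G y ≡ y +G x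
    +G-comm ⟨ a , b , c ⟩ ⟨ a′ , b′ , c′ ⟩ = ⟨⟩-≡ (addZ-comm a a′) (addZ-comm b b′) (addZ-comm c c′)
    idˡ : ∀ (x : G n) → 0G +G x ≡ x
    idˡ ⟨ a , b , c ⟩ = ⟨⟩-≡ (addZ-identityˡ a) (addZ-identityˡ b) (addZ-identityˡ c)
    invʳ : ∀ (x : G n) → x +G (-G x) ≡ 0G
    invʳ ⟨ a , b , c ⟩ = ⟨⟩-≡ (addZ-inverseʳ a) (addZ-inverseʳ b) (addZ-inverseʳ c)

  _≟G_ : DecidableEquality (G n)
  ⟨ a , b , c ⟩ ≟G ⟨ a′ , b′ , c′ ⟩ with a Finₚ.≟ a′ | b Finₚ.≟ b′ | c Finₚ.≟ c′
  ... | yes refl | yes refl | yes refl = yes refl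
  ... | no a≢ | _ | _ = no λ { refl → a≢ refl }
  ... | _ | no b≢ | _ = no λ { refl → b≢ refl }
  ... | _ | _ | no c≢ = no λ { refl → c≢ refl }

  open FinAbGroup (_+G_ {n}) 0G -G_ G-isAbelianGroup _≟G_ using (_•_)

  parity-2n : parity (2 * n) ≡ false
  parity-2n = trans (cong (λ j → parity (n + j)) (+-identityʳ n)) (parity-double n)

  class : G n → V
  class ⟨ a , b , c ⟩ = parity (toℕ a) , parity (toℕ b) , parity (toℕ c)

  class-+G : ∀ x y → class (x +G y) ≡ class x ⊞ class y
  class-+G ⟨ a , b , c ⟩ ⟨ a′ , b′ , c′ ⟩ = ×-≡ (parity-addZ refl a a′) (parity-addZ refl b b′) (parity-addZ parity-2n c c′)

  kernel : ∀ x → class x ≡ 0V → ∃[ c ] ∃[ j ] (x ≡ ⟨ Fin.zero , Fin.zero , c ⟩ × toℕ c ≡ j + j)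
  kernel ⟨ a , b , c ⟩ e = c , j , ⟨⟩-≡ (even a (cong proj₁ e)) (even b (cong (proj₁ ∘ proj₂) e)) refl , c≡
    where
    even : ∀ (a : Fin 2) → parity (toℕ a) ≡ false → a ≡ Fin.zero
    even Fin.zero _ = refl
    even (Fin.suc Fin.zero) ()
    half = parity≡false⇒double (toℕ c) (cong (proj₂ ∘ proj₂) e)
    j = proj₁ half
    c≡ = proj₂ half

  -- The kernel consists of the `n` elements `(0, 0, 2i)` with `i < n`.
  class-bound : ∀ {S} → Unique S → All (λ x → class x ≡ 0V) S → length S ≤ n
  class-bound {S} uS KS = ≤-trans (⊑-length (Unique⇒⊑ uS inKernel)) (≤-reflexive (trans (length-map double (upTo n)) (length-upTo n)))
    where
    double : ℕ → G n
    double i = ⟨ Fin.zero , Fin.zero , (i + i) mod (2 * n) ⟩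
    half< : ∀ i j → i + i < j + j → i < j
    half< i j p = ≰⇒> λ j≤i → <-irrefl refl (≤-trans p (+-mono-≤ j≤i j≤i))
    inKernel : ∀ {x} → x ∈ S → x ∈ map double (upTo n)
    inKernel {x} x∈ =
      let c , j , x≡ , c≡ = kernel x (All.lookup KS x∈)
          j+j<2n = subst (_< 2 * n) c≡ (Finₚ.toℕ<n c)
          j<n = half< j n (subst (j + j <_) (cong (n +_) (+-identityʳ n)) j+j<2n)
      in subst (_∈ map double (upTo n)) (sym (trans x≡ (⟨⟩-≡ refl refl (Finₚ.toℕ-injective (trans c≡
           (sym (trans (Finₚ.toℕ-fromℕ< (m%n<n (j + j) (2 * n))) (m<n⇒m%n≡m j+j<2n))))))))
         (∈-map⁺ double (∈-upTo⁺ j<n))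

  •-⟨⟩ : ∀ i a b c → i • ⟨ a , b , c ⟩ ≡ ⟨ Z._•_ 1 i a , Z._•_ 1 i b , Z._•_ m i c ⟩
  •-⟨⟩ zero a b c = refl
  •-⟨⟩ (suc i) a b c = cong (⟨ a , b , c ⟩ +G_) (•-⟨⟩ i a b c)

  class-exponent : ∀ x → class x ≡ 0V → n • x ≡ 0G
  class-exponent x e = let c , j , x≡ , c≡ = kernel x e in
    trans (cong (n •_) x≡) (trans (•-⟨⟩ n Fin.zero Fin.zero c) (⟨⟩-≡ (Z.•-ε 1 n) (Z.•-ε 1 n) (Finₚ.toℕ-injective
      (trans (toℕ-• {m} n c) (trans (cong (λ z → (n * z) % (2 * n)) c≡) (trans (cong (_% (2 * n)) (rearrange j)) (m*n%n≡0 j (2 * n))))))))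
    where
    rearrange : ∀ j → n * (j + j) ≡ j * (2 * n)
    rearrange j = solve 2 (λ n j → n :* (j :+ j) := j :* (con 2 :* n)) refl n j
      where open +-*-Solver

-- Passage between the forms and the sequences of the statement.

module Theorem (k : ℕ) where

  private
    n : ℕ
    n = suc (suc k)

  open Concrete k
  open FinAbGroup (_+G_ {n}) 0G -G_ G-isAbelianGroup _≟G_
  open ZeroSumTheory (_+G_ {n}) 0G -G_ G-isAbelianGroup _≟G_ using (module Classes; module Converse)
  module C = Classes k class class-+G class-bound (λ {x} → class-exponent x)

  •≡·ℕ : ∀ j (x : G n) → j • x ≡ j ·ℕ x
  •≡·ℕ zero x = refl
  •≡·ℕ (suc j) x = cong (x +G_) (•≡·ℕ j x)

  ⊛≡· : ∀ a (x : G n) → a C.⊛ x ≡ a · x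
  ⊛≡· (ℤ.+ j) x = •≡·ℕ j x
  ⊛≡· -[1+ j ] x = cong -G_ (•≡·ℕ (suc j) x)

  2*≡ : ∀ j → 2 * j ≡ j + j
  2*≡ j = cong (j +_) (+-identityʳ j)

  2*+1 : ∀ j → 2 * j + 1 ≡ suc (j + j)
  2*+1 j = trans (+-comm (2 * j) 1) (cong suc (2*≡ j))

  complement-exponent : ∀ i j → i + j ≡ suc k → 2 * n ∸ 2 * i ∸ 1 ≡ suc (j + j)
  complement-exponent i j e = cong (_∸ 1) (trans (cong (_∸ 2 * i) double) (m+n∸m≡n (2 * i) (suc (suc (j + j)))))
    where
    double : 2 * n ≡ 2 * i + suc (suc (j + j))
    double = trans (cong (λ m → 2 * suc m) (sym e)) (solve 2 (λ i j → con 2 :* (con 1 :+ (i :+ j)) := con 2 :* i :+ (con 2 :+ (j :+ j))) refl i j)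
      where open +-*-Solver

  complement-exponent′ : ∀ i j → j + i ≡ suc k → 2 * n ∸ 1 ∸ 2 * i ≡ suc (j + j)
  complement-exponent′ i j e = trans (∸-+-assoc (2 * n) 1 (2 * i)) (trans (cong (2 * n ∸_) (+-comm 1 (2 * i)))
    (trans (sym (∸-+-assoc (2 * n) (2 * i) 1)) (complement-exponent i j (trans (+-comm i j) e))))

  odd-total : ∀ i j → i + j ≡ suc k → suc (i + i) + suc (j + j) ≡ n + n
  odd-total i j e = trans (solve 2 (λ i j → (con 1 :+ (i :+ i)) :+ (con 1 :+ (j :+ j)) := (con 1 :+ (i :+ j)) :+ (con 1 :+ (i :+ j))) refl i j)
    (cong (λ m → suc m + suc m) e)
    where open +-*-Solver

  -- For `a = j + 2` the integer `1 - a` computes to `-[1+ j ]`. Elsewhere `(1 - a) f₃` is handled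
  -- by cancelling `a • f₃` through this identity.
  one-minus : ∀ a (f : G n) → 2 ≤ a → ((ℤ.+ 1 ℤ.- ℤ.+ a) · f) +G (a • f) ≡ f
  one-minus 1 f (s≤s ())
  one-minus (suc (suc j)) f _ = trans (cong (λ w → (-G w) +G (f +G (suc j • f))) (sym (•≡·ℕ (suc j) f)))
    (trans (cong ((-G (suc j • f)) +G_) (comm f (suc j • f))) (⁻¹-∙-cancelˡ (suc j • f) f))

  seq1-list : (f₁ f₂ f₃ z z′ : G n) (α γ δ β : ℕ) → List (G n)
  seq1-list f₁ f₂ f₃ z z′ α γ δ β = replicate (suc (α + α)) 0G ++ replicate (suc (γ + γ)) f₂ ++
    replicate (suc (δ + δ)) f₃ ++ replicate (suc (β + β)) (f₃ +G f₂) ++ z ∷ z′ ∷ []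

  seq1≡ : ∀ (f₁ f₂ f₃ : G n) a α β γ δ → α + γ ≡ suc k → δ + β ≡ suc k →
    seq1 f₁ f₂ f₃ a α β ≡ seq1-list f₁ f₂ f₃ ((ℤ.+ a) · f₃ +G f₁) ((ℤ.+ 1 ℤ.- ℤ.+ a) · f₃ +G f₂ +G f₁) α γ δ β
  seq1≡ f₁ f₂ f₃ a α β γ δ αγ δβ = cong₂ _++_ (cong (λ j → replicate j 0G) (2*+1 α))
    (cong₂ _++_ (cong (λ j → replicate j f₂) (complement-exponent α γ αγ))
      (cong₂ _++_ (cong (λ j → replicate j f₃) (complement-exponent′ β δ δβ))
        (cong (λ j → replicate j (f₃ +G f₂) ++ ((ℤ.+ a) · f₃ +G f₁) ∷ ((ℤ.+ 1 ℤ.- ℤ.+ a) · f₃ +G f₂ +G f₁) ∷ []) (2*+1 β))))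

  seq3≡ : ∀ (f₁ f₂ f₃ : G n) α β γ d → seq3 f₁ f₂ f₃ α β γ d ≡
    replicate (suc (α + α)) 0G ++ replicate (suc (β + β)) f₁ ++ replicate (suc (γ + γ)) f₂ ++ map (f₃ +G_) d
  seq3≡ f₁ f₂ f₃ α β γ d = cong₂ _++_ (cong (λ j → replicate j 0G) (2*+1 α)) (cong₂ _++_ (cong (λ j → replicate j f₁) (2*+1 β))
    (cong (λ j → replicate j f₂ ++ map (f₃ +G_) d) (2*+1 γ)))

  SequenceForms : (f₁ f₂ f₃ f : G n) → List (G n) → Set
  SequenceForms f₁ f₂ f₃ f S =
    (∃[ a ] ∃[ α ] ∃[ β ] (a ∈[ 2 , n ∸ 1 ] × α ∈[ 0 , n ∸ 1 ] × β ∈[ 0 , n ∸ 1 ] ×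
      ((-G f) +ₛ S ↭ seq1 f₁ f₂ f₃ a α β)))
    ⊎ (∃[ a ] ∃[ b ] (a ∈[ 2 , n ∸ 1 ] × b ∈[ 2 , n ∸ 1 ] × b ≤ a ×
      ((-G f) +ₛ S ↭ seq2 f₁ f₂ f₃ a b)))
    ⊎ (∃[ α ] ∃[ β ] ∃[ γ ] ∃[ d ] (α ∈[ 0 , n ∸ 1 ] × β ∈[ 0 , n ∸ 1 ] × γ ∈[ 0 , n ∸ 1 ] ×
      α + β + γ ≡ n ∸ 1 × length d ≡ 2 * n + 1 × All In⟨ f₁ , f₂ ⟩ d × σ d ∉ d ×
      ((-G f) +ₛ S ↭ seq3 f₁ f₂ f₃ α β γ d)))

  Conclusion : List (G n) → Set
  Conclusion S = ∃[ f₁ ] ∃[ f₂ ] ∃[ f₃ ] ∃[ f ]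
    (IsBasis f₁ f₂ f₃ × Order f₁ 2 × Order f₂ 2 × Order f₃ (2 * n) × SequenceForms f₁ f₂ f₃ f S)

  order-2 : ∀ {f} → f +G f ≡ 0G → class f ≢ 0V → Order f 2
  order-2 {f} f²≡ε cl-f = s≤s z≤n , trans (cong (f +G_) (identityʳ f)) f²≡ε ,
    λ m 0<m e → C.order-torsion cl-f m 0<m (trans (•≡·ℕ m f) e)

  basis-orders : ∀ {f₁ f₂ f₃} → C.AdaptedBasis f₁ f₂ f₃ → IsBasis f₁ f₂ f₃ × Order f₁ 2 × Order f₂ 2 × Order f₃ (2 * n)
  basis-orders {f₁} {f₂} {f₃} B = (independent , generates) ,
    order-2 (C.AdaptedBasis.square₁ B) (C.cl-f₁≢0 B) , order-2 (C.AdaptedBasis.square₂ B) (C.cl-f₂≢0 B) ,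
    s≤s z≤n , trans (cong (_·ℕ f₃) (2*≡ n)) (trans (sym (•≡·ℕ (n + n) f₃)) (C.order-f₃′ B)) ,
    λ m 0<m e → ≤-trans (≤-reflexive (2*≡ n)) (C.order-f₃ B m 0<m (trans (•≡·ℕ m f₃) e))
    where
    independent : Independent f₁ f₂ f₃
    independent a b c e =
      let e₁ , e₂ , e₃ = C.independent⇒ B a b c (trans (cong₂ _+G_ (cong₂ _+G_ (⊛≡· a f₁) (⊛≡· b f₂)) (⊛≡· c f₃)) e)
      in trans (sym (⊛≡· a f₁)) e₁ , trans (sym (⊛≡· b f₂)) e₂ , trans (sym (⊛≡· c f₃)) e₃
    generates : Generates f₁ f₂ f₃
    generates x = integral (C.generates B x)
      where
      integral : ∃[ a ] ∃[ b ] ∃[ c ] x ≡ ((a • f₁) +G (b • f₂)) +G (c • f₃) →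
        ∃[ a ] ∃[ b ] ∃[ c ] x ≡ a · f₁ +G b · f₂ +G c · f₃
      integral (a , b , c , e) = ℤ.+ a , ℤ.+ b , ℤ.+ c , trans e (cong₂ _+G_ (cong₂ _+G_ (•≡·ℕ a f₁) (•≡·ℕ b f₂)) (•≡·ℕ c f₃))

  partner : ∀ {a f₃ r z′} → 2 ≤ a → z′ +G (a • f₃) ≡ f₃ +G r → z′ ≡ ((ℤ.+ 1 ℤ.- ℤ.+ a) · f₃) +G r
  partner {a} {f₃} {r} {z′} 2≤a e = ∙-cancelʳ (a • f₃) _ _ (trans e (trans (cong (_+G r) (sym (one-minus a f₃ 2≤a)))
    (exchange ((ℤ.+ 1 ℤ.- ℤ.+ a) · f₃) (a • f₃) r)))
    where
    exchange : ∀ c w r → (c +G w) +G r ≡ (c +G r) +G w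
    exchange = solve 3 (λ c w r → (c ⊕ w) ⊕ r ⊜ (c ⊕ r) ⊕ w) refl
      where open ∙-Solver using (solve; _⊕_; _⊜_)

  conclusion₁ : ∀ {S f} → C.Form₁ (map ((-G f) +G_) S) → Conclusion S
  conclusion₁ {S} {f} F =
    let basis , o₁ , o₂ , o₃ = basis-orders F.basis in
    F.f₁ , F.f₂ , F.f₃ , f , basis , o₁ , o₂ , o₃ ,
    inj₁ (F.a , F.α , F.β , (F.2≤a , F.a≤) , (z≤n , ≤-trans (m≤m+n F.α F.γ) (≤-reflexive F.α+γ)) ,
      (z≤n , ≤-trans (m≤n+m F.β F.δ) (≤-reflexive F.δ+β)) ,
      ↭-trans F.split (↭-reflexive (trans (cong₂ (λ z z′ → seq1-list F.f₁ F.f₂ F.f₃ z z′ F.α F.γ F.δ F.β)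
        (trans F.z≡ (cong (_+G F.f₁) (•≡·ℕ F.a F.f₃)))
        (trans (partner F.2≤a (trans F.z′≡ (assoc F.f₃ F.f₂ F.f₁))) (sym (assoc ((ℤ.+ 1 ℤ.- ℤ.+ F.a) · F.f₃) F.f₂ F.f₁))))
        (sym (seq1≡ F.f₁ F.f₂ F.f₃ F.a F.α F.β F.γ F.δ F.α+γ F.δ+β)))))
    where module F = C.Form₁ F

  seq2-list : (f₃ z₂ z₂′ z₁ z₁′ : G n) → List (G n)
  seq2-list f₃ z₂ z₂′ z₁ z₁′ = replicate (2 * n ∸ 1) 0G ++ replicate (2 * n ∸ 1) f₃ ++ z₂ ∷ z₂′ ∷ z₁ ∷ z₁′ ∷ []

  conclusion₂ : ∀ {S f} (F : C.Form₂ (map ((-G f) +G_) S)) → C.Form₂.b F ≤ C.Form₂.a F → Conclusion S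
  conclusion₂ {S} {f} F b≤a =
    let basis , o₁ , o₂ , o₃ = basis-orders F.basis in
    F.f₁ , F.f₂ , F.f₃ , f , basis , o₁ , o₂ , o₃ ,
    inj₂ (inj₁ (F.a , F.b , (F.2≤a , F.a≤) , (F.2≤b , F.b≤) , b≤a ,
      ↭-trans F.split (↭-reflexive (trans (cong (λ j → replicate j 0G ++ replicate j F.f₃ ++ F.z₂ ∷ F.z₂′ ∷ F.z₁ ∷ F.z₁′ ∷ []) M≡)
        (trans (cong₂ (λ z z′ → seq2-list F.f₃ z z′ F.z₁ F.z₁′) (trans F.z₂≡ (cong (_+G F.f₂) (•≡·ℕ F.a F.f₃))) (partner F.2≤a F.z₂′≡))
          (cong₂ (seq2-list F.f₃ ((ℤ.+ F.a) · F.f₃ +G F.f₂) ((ℤ.+ 1 ℤ.- ℤ.+ F.a) · F.f₃ +G F.f₂)) (trans F.z₁≡ (cong (_+G F.f₁) (•≡·ℕ F.b F.f₃))) (partner F.2≤b F.z₁′≡)))))))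
    where
    module F = C.Form₂ F
    M≡ : suc (suc k + suc k) ≡ 2 * n ∸ 1
    M≡ = solve 1 (λ k → con 1 :+ ((con 1 :+ k) :+ (con 1 :+ k)) := (con 1 :+ k) :+ ((con 2 :+ k) :+ con 0)) refl k
      where open +-*-Solver

  -- The symmetry of (s2) in `f₁` and `f₂` provides the normalisation `b ≤ a`.
  swap-pairs : ∀ {S} → C.Form₂ S → C.Form₂ S
  swap-pairs F = record
    { f₁ = F.f₂ ; f₂ = F.f₁ ; f₃ = F.f₃ ; z₂ = F.z₁ ; z₂′ = F.z₁′ ; z₁ = F.z₂ ; z₁′ = F.z₂′
    ; basis = record { square₁ = B.square₂ ; square₂ = B.square₁ ; K-square₃ = B.K-square₃ ; order₃ = B.order₃ ; independent = LI-swap B.independent }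
    ; a = F.b ; b = F.a ; 2≤a = F.2≤b ; a≤ = F.b≤ ; 2≤b = F.2≤a ; b≤ = F.a≤ ; z₂≡ = F.z₁≡ ; z₂′≡ = F.z₁′≡ ; z₁≡ = F.z₂≡ ; z₁′≡ = F.z₂′≡
    ; split = ↭-trans F.split (↭-++⁺ˡ (replicate (suc (suc k + suc k)) 0G) (↭-++⁺ˡ (replicate (suc (suc k + suc k)) F.f₃)
        (++-comm (F.z₂ ∷ F.z₂′ ∷ []) (F.z₁ ∷ F.z₁′ ∷ [])))) }
    where
    module F = C.Form₂ F
    module B = C.AdaptedBasis F.basis

  conclusion₃ : ∀ {S f} → C.Form₃ (map ((-G f) +G_) S) → Conclusion S
  conclusion₃ {S} {f} F =
    let basis , o₁ , o₂ , o₃ = basis-orders F.basis in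
    F.f₁ , F.f₂ , F.f₃ , f , basis , o₁ , o₂ , o₃ ,
    inj₂ (inj₂ (F.α , F.β , F.γ , F.d ,
      (z≤n , ≤-trans (m≤m+n F.α F.β) (≤-trans (m≤m+n (F.α + F.β) F.γ) (≤-reflexive F.α+β+γ))) ,
      (z≤n , ≤-trans (m≤n+m F.β F.α) (≤-trans (m≤m+n (F.α + F.β) F.γ) (≤-reflexive F.α+β+γ))) ,
      (z≤n , ≤-trans (m≤n+m F.γ (F.α + F.β)) (≤-reflexive F.α+β+γ)) ,
      F.α+β+γ , trans F.length-d (sym (2*+1 n)) , All.map inSpan F.d∈ , F.sum∉ ,
      ↭-trans F.split (↭-reflexive (sym (seq3≡ F.f₁ F.f₂ F.f₃ F.α F.β F.γ F.d)))))
    where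
    module F = C.Form₃ F
    inSpan : ∀ {b} → b ≡ 0G ⊎ b ≡ F.f₁ ⊎ b ≡ F.f₂ → In⟨ F.f₁ , F.f₂ ⟩ b
    inSpan (inj₁ e) = ℤ.+ 0 , ℤ.+ 0 , trans e (sym (identityʳ 0G))
    inSpan (inj₂ (inj₁ e)) = ℤ.+ 1 , ℤ.+ 0 , trans e (sym (trans (identityʳ _) (identityʳ F.f₁)))
    inSpan (inj₂ (inj₂ e)) = ℤ.+ 0 , ℤ.+ 1 , trans e (sym (trans (identityˡ _) (identityʳ F.f₂)))

  forward : ∀ S → length S ≡ 4 * n + 2 → ¬ HasZeroSumSubseqOfLength S (2 * n) → Conclusion S
  forward S lS none = conclude (C.forms free (trans lS (cong (_+ 2) quadruple)))
    where
    quadruple : 4 * n ≡ (n + n) + (n + n)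
    quadruple = solve 1 (λ n → con 4 :* n := (n :+ n) :+ (n :+ n)) refl n
      where open +-*-Solver
    free : C.Free S
    free T T⊑S lT eT = let T′ , p , T′⊆S = ⊑⇒⊆ T⊑S in
      none (T′ , T′⊆S , trans (sym (↭-length p)) (trans lT (sym (2*≡ n))) , trans (sym (sum-↭ p)) eT)
    conclude : ∃[ f ] C.Forms (map ((-G f) +G_) S) → Conclusion S
    conclude (f , inj₁ F) = conclusion₁ {S} {f} F
    conclude (f , inj₂ (inj₂ F)) = conclusion₃ {S} {f} F
    conclude (f , inj₂ (inj₁ F)) with ≤-total (C.Form₂.b F) (C.Form₂.a F)
    ... | inj₁ b≤a = conclusion₂ {S} {f} F b≤a
    ... | inj₂ a≤b = conclusion₂ {S} {f} (swap-pairs F) a≤b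

  vanishing-2n : ∀ x → (n + n) • x ≡ 0G
  vanishing-2n x = trans (•-+ n n x) (trans (sym (•-∙ n x x)) (class-exponent (x +G x) (trans (class-+G x x) (⊞-self (class x)))))

  module Backward {f₁ f₂ f₃ : G n} (basis : IsBasis f₁ f₂ f₃) (o₁ : Order f₁ 2) (o₂ : Order f₂ 2) (o₃ : Order f₃ (2 * n)) where

    square : ∀ {f} → Order f 2 → f +G f ≡ 0G
    square {f} (_ , e , _) = trans (cong (f +G_) (sym (identityʳ f))) e

    nonzero : ∀ {f} → Order f 2 → f ≢ 0G
    nonzero {f} (_ , _ , least) e with s≤s () ← least 1 (s≤s z≤n) (trans (identityʳ f) e)

    independent : ∀ a b c → ((a • f₁) +G (b • f₂)) +G (c • f₃) ≡ 0G → a • f₁ ≡ 0G × b • f₂ ≡ 0G × c • f₃ ≡ 0G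
    independent a b c e =
      let e₁ , e₂ , e₃ = proj₁ basis (ℤ.+ a) (ℤ.+ b) (ℤ.+ c)
            (trans (sym (cong₂ _+G_ (cong₂ _+G_ (•≡·ℕ a f₁) (•≡·ℕ b f₂)) (•≡·ℕ c f₃))) e)
      in trans (•≡·ℕ a f₁) e₁ , trans (•≡·ℕ b f₂) e₂ , trans (•≡·ℕ c f₃) e₃

    order : ∀ m → 0 < m → m • f₃ ≡ 0G → n + n ≤ m
    order m 0<m e = ≤-trans (≤-reflexive (sym (2*≡ n))) (proj₂ (proj₂ o₃) m 0<m (trans (sym (•≡·ℕ m f₃)) e))

    open Converse n {f₁} {f₂} {f₃} independent (square o₁) (nonzero o₁) (square o₂) (nonzero o₂) order

    -- Translation by `-f` changes a sum of `2n` terms by `2n (-f) = 0`, so absence of zero sums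
    -- passes from the listed sequence to `S`.
    transport : ∀ {S L f} → (-G f) +ₛ S ↭ L → Avoids L → ¬ HasZeroSumSubseqOfLength S (2 * n)
    transport {S} {L} {f} p avoids (T , T⊆S , lT , eT) =
      let T′ , q , T′⊆L = ⊆-resp-↭ p (⊆-map⁺ ((-G f) +G_) T⊆S)
          lT′ = trans lT (2*≡ n)
      in avoids T′ T′⊆L (trans (sym (↭-length q)) (trans (length-map ((-G f) +G_) T) lT′))
           (trans (sym (sum-↭ q)) (trans (sum-map-∙ (-G f) T) (trans (cong₂ _+G_
             (trans (cong (_• (-G f)) lT′) (vanishing-2n (-G f))) eT) (identityʳ 0G))))

    -- (1 − a) f₃ as a natural multiple of f₃, using −f₃ = (2n − 1) f₃.
    one-minus-multiple : ∀ a → 2 ≤ a → (ℤ.+ 1 ℤ.- ℤ.+ a) · f₃ ≡ suc (suc (k + n) * a) • f₃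
    one-minus-multiple a 2≤a = ∙-cancelʳ (a • f₃) _ _ (trans (one-minus a f₃ 2≤a) (sym (begin
      (suc (suc (k + n) * a) • f₃) +G (a • f₃) ≡⟨ •-+ (suc (suc (k + n) * a)) a f₃ ⟨
      (suc (suc (k + n) * a) + a) • f₃ ≡⟨ cong (_• f₃) (cong suc (solve 2 (λ k a → (con 1 :+ (k :+ (con 2 :+ k))) :* a :+ a :=
                                                        a :* ((con 2 :+ k) :+ (con 2 :+ k))) refl k a)) ⟩
      f₃ +G ((a * (n + n)) • f₃) ≡⟨ cong (f₃ +G_) (trans (•-* a (n + n) f₃) (trans (cong (a •_) (vanishing-2n f₃)) (•-ε a))) ⟩
      f₃ +G 0G ≡⟨ identityʳ f₃ ⟩
      f₃ ∎)))
      where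
      open ≡-Reasoning
      open +-*-Solver

    one-minus-sum : ∀ a → 2 ≤ a → ((ℤ.+ a) · f₃) +G ((ℤ.+ 1 ℤ.- ℤ.+ a) · f₃) ≡ f₃
    one-minus-sum a 2≤a = trans (comm ((ℤ.+ a) · f₃) ((ℤ.+ 1 ℤ.- ℤ.+ a) · f₃)) (trans
      (cong (((ℤ.+ 1 ℤ.- ℤ.+ a) · f₃) +G_) (sym (•≡·ℕ a f₃))) (one-minus a f₃ 2≤a))

    avoids-seq1 : ∀ a α β → 2 ≤ a → α ≤ n ∸ 1 → β ≤ n ∸ 1 → Avoids (seq1 f₁ f₂ f₃ a α β)
    avoids-seq1 a α β 2≤a α≤ β≤ = subst Avoids (sym (seq1≡ f₁ f₂ f₃ a α β (suc k ∸ α) (suc k ∸ β) αγ δβ))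
      (avoids₁ {z} {z′} {a} {suc (suc (k + n) * a)} cz cz′ czz′ {α} {β} {suc k ∸ α} {suc k ∸ β}
        (odd-total α (suc k ∸ α) αγ) (odd-total (suc k ∸ β) β δβ))
      where
      αγ : α + (suc k ∸ α) ≡ suc k
      αγ = m+[n∸m]≡n α≤
      δβ : (suc k ∸ β) + β ≡ suc k
      δβ = m∸n+n≡m β≤
      x y z z′ : G n
      x = (ℤ.+ a) · f₃
      y = (ℤ.+ 1 ℤ.- ℤ.+ a) · f₃
      z = x +G f₁
      z′ = y +G f₂ +G f₁
      f₂f₁ : Coordinates (f₂ +G f₁) 1 1 0
      f₂f₁ = coordinates-∙ {f₂} {f₁} {0} {1} {0} {1} {0} {0} coordinates-f₂ coordinates-f₁
      cz : Coordinates z 1 0 a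
      cz = multiple-plus {x} {f₁} a 1 0 (sym (•≡·ℕ a f₃)) coordinates-f₁
      cz′ : Coordinates z′ 1 1 (suc (suc (k + n) * a))
      cz′ = trans (assoc y f₂ f₁) (multiple-plus {y} {f₂ +G f₁} (suc (suc (k + n) * a)) 1 1 (one-minus-multiple a 2≤a) f₂f₁)
      czz′ : Coordinates (z +G z′) 2 1 1
      czz′ = trans (cong (z +G_) (assoc y f₂ f₁)) (pair-coordinates {x} {y} {f₁} {f₂ +G f₁} 2 1 (one-minus-sum a 2≤a)
        (coordinates-∙ {f₁} {f₂ +G f₁} {1} {0} {0} {1} {1} {0} coordinates-f₁ f₂f₁))

    avoids-seq2 : ∀ a b → 2 ≤ a → 2 ≤ b → Avoids (seq2 f₁ f₂ f₃ a b)
    avoids-seq2 a b 2≤a 2≤b = avoids₂ {x a +G f₂} {y a +G f₂} {x b +G f₁} {y b +G f₁} {a} {suc (suc (k + n) * a)} {b} {suc (suc (k + n) * b)}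
      (multiple-plus {x a} {f₂} a 0 1 (sym (•≡·ℕ a f₃)) coordinates-f₂)
      (multiple-plus {y a} {f₂} (suc (suc (k + n) * a)) 0 1 (one-minus-multiple a 2≤a) coordinates-f₂)
      (pair-coordinates {x a} {y a} {f₂} {f₂} 0 2 (one-minus-sum a 2≤a)
        (coordinates-∙ {f₂} {f₂} {0} {1} {0} {0} {1} {0} coordinates-f₂ coordinates-f₂))
      (multiple-plus {x b} {f₁} b 1 0 (sym (•≡·ℕ b f₃)) coordinates-f₁)
      (multiple-plus {y b} {f₁} (suc (suc (k + n) * b)) 1 0 (one-minus-multiple b 2≤b) coordinates-f₁)
      (pair-coordinates {x b} {y b} {f₁} {f₁} 2 0 (one-minus-sum b 2≤b)
        (coordinates-∙ {f₁} {f₁} {1} {0} {0} {1} {0} {0} coordinates-f₁ coordinates-f₁))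
      (2 * n ∸ 1) (2*≡ n)
      where
      x y : ℕ → G n
      x a = (ℤ.+ a) · f₃
      y a = (ℤ.+ 1 ℤ.- ℤ.+ a) · f₃

    avoids-seq3 : ∀ α β γ d → α + β + γ ≡ n ∸ 1 → length d ≡ 2 * n + 1 → All In⟨ f₁ , f₂ ⟩ d → σ d ∉ d → Avoids (seq3 f₁ f₂ f₃ α β γ d)
    avoids-seq3 α β γ d αβγ ld d∈ σ∉ = subst Avoids (sym (seq3≡ f₁ f₂ f₃ α β γ d))
      (avoids₃ {α} {β} {γ} {d} (cong suc αβγ) (trans ld (2*+1 n)) (All.map natural d∈) σ∉ (vanishing-2n f₃))
      where
      absolute : ∀ {f} → Order f 2 → ∀ a → a · f ≡ ∣ a ∣ • f
      absolute {f} o (ℤ.+ j) = sym (•≡·ℕ j f)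
      absolute {f} o -[1+ j ] = trans (cong -G_ (sym (•≡·ℕ (suc j) f))) (sym (inverseʳ-unique (suc j • f) (suc j • f)
        (trans (sym (•-∙ (suc j) f f)) (trans (cong (suc j •_) (square o)) (•-ε (suc j))))))
      natural : ∀ {x} → In⟨ f₁ , f₂ ⟩ x → ∃[ a ] ∃[ b ] Coordinates x a b 0
      natural (a , b , e) = ∣ a ∣ , ∣ b ∣ , trans e (trans (cong₂ _+G_ (absolute o₁ a) (absolute o₂ b)) (sym (identityʳ _)))

  backward : ∀ S → Conclusion S → ¬ HasZeroSumSubseqOfLength S (2 * n)
  backward S (f₁ , f₂ , f₃ , f , basis , o₁ , o₂ , o₃ , forms) = from-form forms
    where
    open Backward basis o₁ o₂ o₃
    from-form : SequenceForms f₁ f₂ f₃ f S → ¬ HasZeroSumSubseqOfLength S (2 * n)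
    from-form (inj₁ (a , α , β , (2≤a , _) , (_ , α≤) , (_ , β≤) , p)) = transport {S} {f = f} p (avoids-seq1 a α β 2≤a α≤ β≤)
    from-form (inj₂ (inj₁ (a , b , (2≤a , _) , (2≤b , _) , _ , p))) = transport {S} {f = f} p (avoids-seq2 a b 2≤a 2≤b)
    from-form (inj₂ (inj₂ (α , β , γ , d , _ , _ , _ , αβγ , ld , d∈ , σ∉ , p))) = transport {S} {f = f} p (avoids-seq3 α β γ d αβγ ld d∈ σ∉)

theorem5p1 : (n : ℕ) {{_ : NonZero n}} → 2 ≤ n → (S : List (G n)) → length S ≡ 4 * n + 2 →
    (¬ HasZeroSumSubseqOfLength S (2 * n)
    → ∃[ f₁ ] ∃[ f₂ ] ∃[ f₃ ] ∃[ f ]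
    (IsBasis f₁ f₂ f₃ × Order f₁ 2 × Order f₂ 2 × Order f₃ (2 * n) ×
    ((∃[ a ] ∃[ α ] ∃[ β ] (a ∈[ 2 , n ∸ 1 ] × α ∈[ 0 , n ∸ 1 ] × β ∈[ 0 , n ∸ 1 ] ×
    ((-G f) +ₛ S ↭ seq1 f₁ f₂ f₃ a α β)))
    ⊎ (∃[ a ] ∃[ b ] (a ∈[ 2 , n ∸ 1 ] × b ∈[ 2 , n ∸ 1 ] × b ≤ a ×
    ((-G f) +ₛ S ↭ seq2 f₁ f₂ f₃ a b)))
    ⊎ (∃[ α ] ∃[ β ] ∃[ γ ] ∃[ d ] (α ∈[ 0 , n ∸ 1 ] × β ∈[ 0 , n ∸ 1 ] × γ ∈[ 0 , n ∸ 1 ] ×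
    α + β + γ ≡ n ∸ 1 × length d ≡ 2 * n + 1 × All In⟨ f₁ , f₂ ⟩ d × σ d ∉ d ×
    ((-G f) +ₛ S ↭ seq3 f₁ f₂ f₃ α β γ d))))))
    × (∃[ f₁ ] ∃[ f₂ ] ∃[ f₃ ] ∃[ f ]
    (IsBasis f₁ f₂ f₃ × Order f₁ 2 × Order f₂ 2 × Order f₃ (2 * n) ×
    ((∃[ a ] ∃[ α ] ∃[ β ] (a ∈[ 2 , n ∸ 1 ] × α ∈[ 0 , n ∸ 1 ] × β ∈[ 0 , n ∸ 1 ] ×
    ((-G f) +ₛ S ↭ seq1 f₁ f₂ f₃ a α β)))
    ⊎ (∃[ a ] ∃[ b ] (a ∈[ 2 , n ∸ 1 ] × b ∈[ 2 , n ∸ 1 ] × b ≤ a ×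
    ((-G f) +ₛ S ↭ seq2 f₁ f₂ f₃ a b)))
    ⊎ (∃[ α ] ∃[ β ] ∃[ γ ] ∃[ d ] (α ∈[ 0 , n ∸ 1 ] × β ∈[ 0 , n ∸ 1 ] × γ ∈[ 0 , n ∸ 1 ] ×
    α + β + γ ≡ n ∸ 1 × length d ≡ 2 * n + 1 × All In⟨ f₁ , f₂ ⟩ d × σ d ∉ d ×
    ((-G f) +ₛ S ↭ seq3 f₁ f₂ f₃ α β γ d)))))
    → ¬ HasZeroSumSubseqOfLength S (2 * n))
theorem5p1 (suc (suc k)) (s≤s (s≤s z≤n)) S length-S = Theorem.forward k S length-S , Theorem.backward k S
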